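{- There is an absolute constant $C>0$ such that the following holds. Let $D \ge 1$ be an integer and let $G$ be a $D$-degenerate graph with $n \ge 2$ vertices and $k \geq n$ edges. Then there is a positive integer $m$ with $m^3 \le C\, D\, k \log n$ such that $G$ has a grid-drawing in $[m]^3$.
   Context: For a positive integer $m$, $[m]=\{0,1,\ldots,m-1\}$. A grid-drawing of a graph $G$ in $[m]^3$ is a representation of $G$ in which the vertices are mapped to distinct points of $[m]^3\subseteq\mathbb{Z}^3$ and each edge is drawn as the straight-line segment between the images of its endpoints, such that (i) no edge's segment contains the image of a vertex not incident to that edge, and (ii) no two edges' segments share a common interior point. The degeneracy of a graph is the smallest positive integer $D$ such that every subgraph has a vertex of degree at most $D$; a graph is $D$-degenerate if its degeneracy is at most $D$. The statement in the paper is written as: there is a grid-drawing of $G$ in $[m]^3$ where $m^3 = O(Dk\log n)$. -}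

module Defs where

open import Data.Nat using (ℕ; zero; suc; _+_; _*_; _∸_; _<_; _≤_; _<ᵇ_)
open import Data.Fin using (Fin; toℕ)
open import Data.Bool using (Bool; true; false; _∧_; if_then_else_)
open import Data.Product using (Σ; ∃; ∃-syntax; _×_; _,_)
open import Relation.Binary.PropositionalEquality using (_≡_; _≢_)
open import Relation.Nullary using (¬_)

count : {n : ℕ} → (Fin n → Bool) → ℕ
count {zero} p = 0
count {suc n} p = (if p Fin.zero then 1 else 0) + count (λ i → p (Fin.suc i))

sumFin : {n : ℕ} → (Fin n → ℕ) → ℕ
sumFin {zero} f = 0
sumFin {suc n} f = f Fin.zero + sumFin (λ i → f (Fin.suc i))

record Graph (n : ℕ) : Set where
  field
    adj     : Fin n → Fin n → Bool
    adj-sym : ∀ u v → adj u v ≡ adj v u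
    irrefl  : ∀ v → adj v v ≡ false
open Graph public

edgeCount : {n : ℕ} → Graph n → ℕ
edgeCount {n} G = sumFin (λ i → count (λ j → adj G i j ∧ (toℕ i <ᵇ toℕ j)))

record Subgraph {n : ℕ} (G : Graph n) : Set where
  field
    S     : Fin n → Bool
    F     : Fin n → Fin n → Bool
    F-sym : ∀ u v → F u v ≡ F v u
    F⊆G   : ∀ u v → F u v ≡ true → adj G u v ≡ true
    F-S   : ∀ u v → F u v ≡ true → S u ≡ true
open Subgraph public

degreeIn : {n : ℕ} {G : Graph n} → Subgraph G → Fin n → ℕ
degreeIn H v = count (F H v)

Degenerate : {n : ℕ} → ℕ → Graph n → Set
Degenerate D G = (H : Subgraph G) → (∃[ v ] S H v ≡ true) →
  ∃[ v ] (S H v ≡ true × degreeIn H v ≤ D)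

Point : Set
Point = Fin 3 → ℕ

OnSegment : Point → Point → Point → Set
OnSegment P Q W = ∃[ a ] ∃[ b ] (0 < b × a ≤ b ×
  (∀ i → b * W i ≡ (b ∸ a) * P i + a * Q i))

-- segments [P,Q] and [R,T] share a point interior to both:
-- (1-s)P + sQ = (1-t)R + tT with s = a/b, t = c/d, 0<s<1, 0<t<1
ShareInterior : Point → Point → Point → Point → Set
ShareInterior P Q R T = ∃[ a ] ∃[ b ] ∃[ c ] ∃[ d ]
  (0 < a × a < b × 0 < c × c < d ×
   (∀ i → d * ((b ∸ a) * P i + a * Q i) ≡ b * ((d ∸ c) * R i + c * T i)))

record GridDrawing {n : ℕ} (G : Graph n) (m : ℕ) : Set where
  field
    pos      : Fin n → Point
    inGrid   : ∀ v i → pos v i < m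
    distinct : ∀ u v → u ≢ v → ∃[ i ] pos u i ≢ pos v i
    noVertexOnEdge : ∀ u v w → adj G u v ≡ true → w ≢ u → w ≢ v →
      ¬ OnSegment (pos u) (pos v) (pos w)
    noCrossing : ∀ u v x y → adj G u v ≡ true → adj G x y ≡ true →
      ¬ (u ≡ x × v ≡ y) → ¬ (u ≡ y × v ≡ x) →
      ¬ ShareInterior (pos u) (pos v) (pos x) (pos y)

{-# OPTIONS --safe #-}
{-
The proof reduces crossing-freeness to general position: after attaching a pendant vertex to
every vertex, it suffices that no two disjoint edges have coplanar endpoints.

Counting.  For a fixed grid point a, the number of triples (b , c , d) of grid points coplanar
with a is O(m⁶ log m).  Indeed a singular 3 × 3 matrix with entries at most m in absolute value
has a primitive left or right kernel vector h with |h| ≤ 2m, since the cofactor matrix is g hᵀ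
with |g_i h_j| ≤ 2m²; the plane orthogonal to h contains O(m² / |h|) points of the box; and
m⁶ / |h|³ is summed over dyadic ranges of |h|.

Placement.  The vertices are peeled into layers X_0 ⊇ X_1 ⊇ ... such that a vertex v of
X_l ∖ X_{l+1} has degree O(D) inside X_l and degree O(2^l D) in the graph, and D Σ_{l≥1} 2^l |X_l| = O(k).
The layers are placed from the innermost one outwards.  One layer is placed by a counting
version of the local lemma in which, besides forbidden events, upper bounds on sums of
nonnegative terms are allowed: drawings are weighted by Π_c (β_c ∸ Q_c), and adding a vertex
changes the total weight by at most a factor 2.  The bounded sums control, for every placed
vertex, the expected number of coplanarities with the edges of the graph when the unplaced vertices
are random; this is what makes the local lemma applicable to the next layer.  The budgets of
the layers add up to O(k log n), so volume O(D k log n) suffices.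
-}
module Submission where

open import Defs
open import Data.Nat using (ℕ; zero; suc; _+_; _*_; _∸_; _^_; _⊓_; _≤_; _<_; _≤ᵇ_; _<ᵇ_; z≤n; s≤s; NonZero; >-nonZero) renaming (_≟_ to _≟ℕ_)
open import Data.Nat.Properties hiding (_≟_)
open import Data.Nat.Divisibility using (_∣?_)
open import Data.Nat.Logarithm using (⌊log₂_⌋; ⌊log₂⌋-mono-≤; ⌊log₂[2^n]⌋≡n)
open import Data.Nat.Tactic.RingSolver using (solve-∀)
open import Data.Integer using (ℤ; -[1+_]; 0ℤ; 1ℤ; ∣_∣) renaming (+_ to ⁺_; _+_ to _+ℤ_; _*_ to _*ℤ_; _-_ to _-ℤ_; -_ to -ℤ_; ≢-nonZero to ≢-nonZeroℤ)
open import Data.Integer.DivMod using (_/ℕ_; _%ℕ_; n%ℕd<d; a≡a%ℕn+[a/ℕn]*n)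
open import Data.Integer.Divisibility.Signed using (divides; ∣ᵤ⇒∣; ∣⇒∣ᵤ)
open import Data.Integer.Tactic.RingSolver using () renaming (solve-∀ to solveℤ)
import Data.Integer.Properties as ℤₚ
open import Data.Bool using (Bool; true; false; _∧_; _∨_; not; if_then_else_) renaming (T to So)
open import Data.Fin using (Fin; toℕ; _↑ˡ_; _↑ʳ_; _≟_)
open import Data.Fin.Patterns using (0F; 1F; 2F)
open import Data.Fin.Properties using (toℕ<n; toℕ-injective; toℕ-↑ˡ; toℕ-↑ʳ; ↑ˡ-injective; ↑ʳ-injective)
open import Data.List using (List; []; _∷_; _++_; map; concatMap; length; allFin; tabulate) renaming (lookup to lookupˡ)
open import Data.List.Properties using (length-++; length-tabulate)
open import Data.List.Membership.Propositional using (_∈_)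
open import Data.List.Membership.Propositional.Properties using (∈-allFin; ∈-map⁺; ∈-map⁻; ∈-++⁺ˡ; ∈-++⁺ʳ; ∈-concatMap⁺)
open import Data.List.Relation.Unary.Any using (Any; here; there; index)
open import Data.List.Relation.Unary.Any.Properties using (lookup-index)
open import Data.Vec using (Vec; []; _∷_; lookup; _[_]≔_)
open import Data.Vec.Properties using (lookup∘update; lookup∘update′)
open import Data.Maybe using (Maybe; just; nothing; is-just)
open import Data.Product using (Σ; ∃; ∃-syntax; _×_; _,_; proj₁; proj₂)
open import Data.Sum using (_⊎_; inj₁; inj₂)
open import Data.Empty using (⊥; ⊥-elim)
open import Relation.Nullary using (¬_; Dec; yes; no; does)
open import Relation.Binary.Definitions using (Tri; tri<; tri≈; tri>)
open import Relation.Binary.PropositionalEquality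

-- The obstacle is a vertex x of large degree. The usual local lemma over all pairs of edges sees
-- about deg(x) · k conflicts through x and would give the maximum degree in place of `D`. With
-- layers, only the O(D) edges from x into its own layer and the inner ones can conflict when x is
-- placed. But inner vertices are then fixed, and an unlucky position may be coplanar with far too
-- many of the edges still to come, so such positions must be excluded when the inner vertex is
-- placed. By Markov's inequality "the expected number of later conflicts is too large" is only an
-- event of small constant probability, and each such event depends on very many vertices; the local
-- lemma for events does not tolerate this. A factor β ∸ Q reacts to one vertex only in proportion
-- to the share of the mean of Q that passes through that vertex, and these shares, relative to the
-- bounds, add up to at most 1 over all constraints.

-- Finite sums

+-left-comm : ∀ a b c → a + (b + c) ≡ b + (a + c)
+-left-comm = solve-∀

*-left-comm : ∀ a b c → a * (b * c) ≡ b * (a * c)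
*-left-comm = solve-∀

double : ∀ a → a + a ≡ 2 * a
double = solve-∀

infix 5 ∑
∑ : ∀ {a} {A : Set a} → List A → (A → ℕ) → ℕ
∑ []       F = 0
∑ (x ∷ xs) F = F x + ∑ xs F

syntax ∑ xs (λ x → e) = ∑[ x ∈ xs ] e

𝟙 : Bool → ℕ
𝟙 true  = 1
𝟙 false = 0

𝟙≤1 : ∀ b → 𝟙 b ≤ 1
𝟙≤1 true  = ≤-refl
𝟙≤1 false = z≤n

𝟙* : ∀ b c → 𝟙 b * c ≤ c
𝟙* true  c = ≤-reflexive (+-identityʳ c)
𝟙* false c = z≤n

𝟙-∧ : ∀ a b → 𝟙 (a ∧ b) ≡ 𝟙 a * 𝟙 b
𝟙-∧ true  b = sym (+-identityʳ (𝟙 b))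
𝟙-∧ false b = refl

module _ {a} {A : Set a} where

  ∑-cong : (xs : List A) {F G : A → ℕ} → (∀ x → F x ≡ G x) → ∑ xs F ≡ ∑ xs G
  ∑-cong []       h = refl
  ∑-cong (x ∷ xs) h = cong₂ _+_ (h x) (∑-cong xs h)

  ∑-mono : (xs : List A) {F G : A → ℕ} → (∀ x → F x ≤ G x) → ∑ xs F ≤ ∑ xs G
  ∑-mono []       h = z≤n
  ∑-mono (x ∷ xs) h = +-mono-≤ (h x) (∑-mono xs h)

  ∑-mono-∈ : (xs : List A) {F G : A → ℕ} → (∀ x → x ∈ xs → F x ≤ G x) → ∑ xs F ≤ ∑ xs G
  ∑-mono-∈ []       h = z≤n
  ∑-mono-∈ (x ∷ xs) h = +-mono-≤ (h x (here refl)) (∑-mono-∈ xs (λ y y∈ → h y (there y∈)))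

  ∑-+ : (xs : List A) (F G : A → ℕ) → (∑[ x ∈ xs ] F x + G x) ≡ ∑ xs F + ∑ xs G
  ∑-+ []       F G = refl
  ∑-+ (x ∷ xs) F G rewrite ∑-+ xs F G = lemma (F x) (G x) (∑ xs F) (∑ xs G)
    where
    lemma : ∀ a b c d → a + b + (c + d) ≡ a + c + (b + d)
    lemma = solve-∀

  ∑-*ˡ : (xs : List A) (c : ℕ) (F : A → ℕ) → (∑[ x ∈ xs ] c * F x) ≡ c * ∑ xs F
  ∑-*ˡ []       c F = sym (*-zeroʳ c)
  ∑-*ˡ (x ∷ xs) c F rewrite ∑-*ˡ xs c F = sym (*-distribˡ-+ c (F x) (∑ xs F))

  ∑-*ʳ : (xs : List A) (c : ℕ) (F : A → ℕ) → (∑[ x ∈ xs ] F x * c) ≡ ∑ xs F * c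
  ∑-*ʳ []       c F = refl
  ∑-*ʳ (x ∷ xs) c F rewrite ∑-*ʳ xs c F = sym (*-distribʳ-+ c (F x) (∑ xs F))

  ∑-const : (xs : List A) (c : ℕ) → (∑[ _ ∈ xs ] c) ≡ length xs * c
  ∑-const []       c = refl
  ∑-const (x ∷ xs) c = cong (c +_) (∑-const xs c)

  ∑-0 : (xs : List A) → (∑[ _ ∈ xs ] 0) ≡ 0
  ∑-0 []       = refl
  ∑-0 (x ∷ xs) = ∑-0 xs

  ∑-bound : (xs : List A) {F : A → ℕ} (c : ℕ) → (∀ x → F x ≤ c) → ∑ xs F ≤ length xs * c
  ∑-bound xs c h = ≤-trans (∑-mono xs h) (≤-reflexive (∑-const xs c))

  ∑-++ : (xs ys : List A) (F : A → ℕ) → ∑ (xs ++ ys) F ≡ ∑ xs F + ∑ ys F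
  ∑-++ []       ys F = refl
  ∑-++ (x ∷ xs) ys F rewrite ∑-++ xs ys F = sym (+-assoc (F x) (∑ xs F) (∑ ys F))

  ∈⇒≤∑ : {xs : List A} {x : A} (F : A → ℕ) → x ∈ xs → F x ≤ ∑ xs F
  ∈⇒≤∑ F (here refl) = m≤m+n _ _
  ∈⇒≤∑ F (there {x = y} x∈) = ≤-trans (∈⇒≤∑ F x∈) (m≤n+m _ (F y))

module _ {a b} {A : Set a} {B : Set b} where

  ∑-map : (g : B → A) (xs : List B) (F : A → ℕ) → ∑ (map g xs) F ≡ ∑ xs (λ x → F (g x))
  ∑-map g []       F = refl
  ∑-map g (x ∷ xs) F = cong (F (g x) +_) (∑-map g xs F)

  ∑-concatMap : (g : B → List A) (xs : List B) (F : A → ℕ) →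
                ∑ (concatMap g xs) F ≡ (∑[ x ∈ xs ] ∑ (g x) F)
  ∑-concatMap g []       F = refl
  ∑-concatMap g (x ∷ xs) F =
    trans (∑-++ (g x) (concatMap g xs) F) (cong (∑ (g x) F +_) (∑-concatMap g xs F))

  ∑-swap : (xs : List A) (ys : List B) (F : A → B → ℕ) →
           (∑[ x ∈ xs ] ∑[ y ∈ ys ] F x y) ≡ (∑[ y ∈ ys ] ∑[ x ∈ xs ] F x y)
  ∑-swap []       ys F = sym (∑-0 ys)
  ∑-swap (x ∷ xs) ys F =
    trans (cong (∑ ys (F x) +_) (∑-swap xs ys F)) (sym (∑-+ ys (F x) (λ y → ∑ xs (λ x → F x y))))

∑-tabulate : ∀ {a} {A : Set a} n (g : Fin n → A) (F : A → ℕ) →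
             ∑ (tabulate g) F ≡ ∑ (allFin n) (λ i → F (g i))
∑-tabulate zero    g F = refl
∑-tabulate (suc n) g F = cong (F (g Fin.zero) +_)
  (trans (∑-tabulate n (λ i → g (Fin.suc i)) F)
         (sym (∑-tabulate n Fin.suc (λ i → F (g i)))))

∑-allFin-suc : ∀ n (F : Fin (suc n) → ℕ) →
               ∑ (allFin (suc n)) F ≡ F Fin.zero + ∑ (allFin n) (λ i → F (Fin.suc i))
∑-allFin-suc n F = cong (F Fin.zero +_) (∑-tabulate n Fin.suc F)

∑-pos⇒∃ : ∀ {A : Set} (xs : List A) {G : A → ℕ} → 0 < ∑ xs G → Σ A (λ x → 0 < G x)
∑-pos⇒∃ (x ∷ xs) {G} h with G x in eq
... | suc _ = x , subst (0 <_) (sym eq) (s≤s z≤n)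
... | zero  = ∑-pos⇒∃ xs h

module _ {P : Set} (ps : List P) where

  ∑ᵛ : ∀ n → (Vec P n → ℕ) → ℕ
  ∑ᵛ zero    F = F []
  ∑ᵛ (suc n) F = ∑[ q ∈ ps ] ∑ᵛ n (λ f → F (q ∷ f))

  ∑ᵛ-cong : ∀ n {F G} → (∀ f → F f ≡ G f) → ∑ᵛ n F ≡ ∑ᵛ n G
  ∑ᵛ-cong zero    h = h []
  ∑ᵛ-cong (suc n) h = ∑-cong ps (λ q → ∑ᵛ-cong n (λ f → h (q ∷ f)))

  ∑ᵛ-mono : ∀ n {F G} → (∀ f → F f ≤ G f) → ∑ᵛ n F ≤ ∑ᵛ n G
  ∑ᵛ-mono zero    h = h []
  ∑ᵛ-mono (suc n) h = ∑-mono ps (λ q → ∑ᵛ-mono n (λ f → h (q ∷ f)))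

  ∑ᵛ-+ : ∀ n F G → ∑ᵛ n (λ f → F f + G f) ≡ ∑ᵛ n F + ∑ᵛ n G
  ∑ᵛ-+ zero    F G = refl
  ∑ᵛ-+ (suc n) F G = trans (∑-cong ps (λ q → ∑ᵛ-+ n (λ f → F (q ∷ f)) (λ f → G (q ∷ f)))) (∑-+ ps _ _)

  ∑ᵛ-*ˡ : ∀ n c F → ∑ᵛ n (λ f → c * F f) ≡ c * ∑ᵛ n F
  ∑ᵛ-*ˡ zero    c F = refl
  ∑ᵛ-*ˡ (suc n) c F = trans (∑-cong ps (λ q → ∑ᵛ-*ˡ n c (λ f → F (q ∷ f)))) (∑-*ˡ ps c _)

  ∑ᵛ-∑ : ∀ {A : Set} n (xs : List A) (F : A → Vec P n → ℕ) →
         ∑ᵛ n (λ f → ∑ xs (λ x → F x f)) ≡ (∑[ x ∈ xs ] ∑ᵛ n (F x))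
  ∑ᵛ-∑ n []       F = zeros n
    where
    zeros : ∀ n → ∑ᵛ n (λ _ → 0) ≡ 0
    zeros zero    = refl
    zeros (suc n) = trans (∑-cong ps (λ _ → zeros n)) (∑-0 ps)
  ∑ᵛ-∑ n (x ∷ xs) F = trans (∑ᵛ-+ n (F x) _) (cong (∑ᵛ n (F x) +_) (∑ᵛ-∑ n xs F))

  -- Overwriting one coordinate by a fresh value forgets its old value, which ranges over
  -- `length ps` possibilities.
  resample : ∀ {n} (x : Fin n) (h : Vec P n → ℕ) →
             (∑[ q ∈ ps ] ∑ᵛ n (λ f → h (f [ x ]≔ q))) ≡ length ps * ∑ᵛ n h
  resample {suc n} Fin.zero    h =
    trans (∑-cong ps (λ q → ∑-const ps _)) (∑-*ˡ ps (length ps) _)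
  resample {suc n} (Fin.suc x) h =
    trans (∑-swap ps ps (λ q q′ → ∑ᵛ n (λ f → h (q′ ∷ (f [ x ]≔ q)))))
          (trans (∑-cong ps (λ q′ → resample x (λ f → h (q′ ∷ f)))) (∑-*ˡ ps (length ps) _))

  ∑ᵛ-pos⇒∃ : ∀ n (F : Vec P n → ℕ) → 0 < ∑ᵛ n F → Σ (Vec P n) (λ f → 0 < F f)
  ∑ᵛ-pos⇒∃ zero    F h = [] , h
  ∑ᵛ-pos⇒∃ (suc n) F h with ∑-pos⇒∃ ps h
  ... | q , h′ with ∑ᵛ-pos⇒∃ n (λ f → F (q ∷ f)) h′
  ... | f , h″ = q ∷ f , h″

-- Weighted local lemma

infix 4 _==_
_==_ : ∀ {n} → Fin n → Fin n → Bool
x == y = does (x ≟ y)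

==-refl : ∀ {n} (x : Fin n) → (x == x) ≡ true
==-refl x with x ≟ x
... | yes _ = refl
... | no ¬p = ⊥-elim (¬p refl)

==⇒≡ : ∀ {n} {x y : Fin n} → (x == y) ≡ true → x ≡ y
==⇒≡ {x = x} {y} h with x ≟ y
... | yes p = p

mem : ∀ {n} → Fin n → List (Fin n) → Bool
mem x []       = false
mem x (y ∷ ys) = (x == y) ∨ mem x ys

mem-head : ∀ {n} (y : Fin n) ys → mem y (y ∷ ys) ≡ true
mem-head y ys rewrite ==-refl y = refl

mem-tail : ∀ {n} (x y : Fin n) ys → mem x ys ≡ true → mem x (y ∷ ys) ≡ true
mem-tail x y ys m with x == y
... | true = refl
... | false = m

-- `U` is a common denominator. The rational share 1 / `least` of a constraint is represented by
-- `weight`, with `weight * least ≡ U`, and all estimates stay in ℕ.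
module LocalLemma {P : Set} (ps : List P) (ps≢[] : 0 < length ps) {n : ℕ}
                  (Free : Fin n → Bool) (U : ℕ) (U>0 : 0 < U) where

  -- Unnormalised expectation over uniformly random placements. The inequalities below are
  -- homogeneous in `E`, so the number of placements is never divided out.
  E : (Vec P n → ℕ) → ℕ
  E = ∑ᵛ ps n

  IndepOf : (Vec P n → ℕ) → Fin n → Set
  IndepOf W x = ∀ f q → W (f [ x ]≔ q) ≡ W f

  -- `avg` asks for more than a bound on the expectation: it must survive any weight that does not
  -- see the scope. Four vertices suffice since a coplanarity involves four points.
  record Term : Set where
    field
      scope : List (Fin n)
      val   : Vec P n → ℕ
      mean  : ℕ
      short : length scope ≤ 4
      free  : ∀ x → mem x scope ≡ true → Free x ≡ true
      local : ∀ x → mem x scope ≡ false → IndepOf val x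
      avg   : ∀ W → (∀ x → mem x scope ≡ true → IndepOf W x) →
              E (λ f → val f * W f) ≤ mean * E W
  open Term public

  -- `bound` may vary inside a family of constraints; `least` is a lower bound for it that can be
  -- shared by the whole family, and the share of a vertex is measured against `least`. `room`
  -- leaves the mean of the sum well below the bound.
  record Constraint : Set where
    field
      terms  : List Term
      bound  : ℕ
      least  : ℕ
      weight : ℕ
      scale  : weight * least ≡ U
      least≤ : least ≤ bound
      room   : (∑[ τ ∈ terms ] 64 * mean τ) ≤ bound
  open Constraint public

  private
    Set? = Fin n → Bool

    inside : Set? → List (Fin n) → Bool
    inside H []       = true
    inside H (y ∷ ys) = H y ∧ inside H ys

    ins del : Set? → Fin n → Set?
    ins H x v = if v == x then true else H v
    del H x v = if v == x then false else H v

    dels : Set? → List (Fin n) → Set?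
    dels H []       = H
    dels H (y ∷ ys) = dels (del H y) ys

    size : Set? → ℕ
    size H = ∑[ v ∈ allFin n ] 𝟙 (H v)

    -- `H` is the set of vertices taken into account so far. A term counts only once its whole scope
    -- lies in `H`, so enlarging `H` can only lower the weight `W`.
    Q : Set? → Constraint → Vec P n → ℕ
    Q H c f = ∑[ τ ∈ terms c ] 𝟙 (inside H (scope τ)) * val τ f

    W : Set? → List Constraint → Vec P n → ℕ
    W H []      f = 1
    W H (c ∷ K) f = (bound c ∸ Q H c f) * W H K f

    M : Set? → List Constraint → ℕ
    M H K = E (W H K)

    _⊑_ : Set? → Set? → Set
    H ⊑ H′ = ∀ v → H v ≡ true → H′ v ≡ true

    inside-mono : ∀ {H H′} → H ⊑ H′ → ∀ s → 𝟙 (inside H s) ≤ 𝟙 (inside H′ s)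
    inside-mono h [] = ≤-refl
    inside-mono {H} {H′} h (y ∷ ys) with H y in eq
    ... | false = z≤n
    ... | true rewrite h y eq = inside-mono h ys

    Q-mono : ∀ {H H′} → H ⊑ H′ → ∀ c f → Q H c f ≤ Q H′ c f
    Q-mono h c f = ∑-mono (terms c) (λ τ → *-monoˡ-≤ (val τ f) (inside-mono h (scope τ)))

    W-anti : ∀ {H H′} → H ⊑ H′ → ∀ K f → W H′ K f ≤ W H K f
    W-anti h []      f = ≤-refl
    W-anti h (c ∷ K) f = *-mono-≤ (∸-monoʳ-≤ (bound c) (Q-mono h c f)) (W-anti h K f)

    M-anti : ∀ {H H′} → H ⊑ H′ → ∀ K → M H′ K ≤ M H K
    M-anti h K = ∑ᵛ-mono ps n (W-anti h K)

    inside⇒ : ∀ H s → inside H s ≡ true → ∀ x → mem x s ≡ true → H x ≡ true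
    inside⇒ H (y ∷ ys) h x m with H y in eq | x ≟ y
    ... | true | yes refl = eq
    ... | true | no _ = inside⇒ H ys h x m

    Q-indep : ∀ H x → H x ≡ false → ∀ c → IndepOf (Q H c) x
    Q-indep H x hx c f q = ∑-cong (terms c) go
      where
      go : ∀ τ → 𝟙 (inside H (scope τ)) * val τ (f [ x ]≔ q) ≡ 𝟙 (inside H (scope τ)) * val τ f
      go τ with inside H (scope τ) in eq | mem x (scope τ) in m
      ... | false | _ = refl
      ... | true | false = cong (1 *_) (local τ x m f q)
      ... | true | true with trans (sym hx) (inside⇒ H (scope τ) eq x m)
      ... | ()

    W-indep : ∀ H x → H x ≡ false → ∀ K → IndepOf (W H K) x
    W-indep H x hx []      f q = refl
    W-indep H x hx (c ∷ K) f q =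
      cong₂ (λ a b → (bound c ∸ a) * b) (Q-indep H x hx c f q) (W-indep H x hx K f q)

    del-⊑ : ∀ H x → del H x ⊑ H
    del-⊑ H x v h with v ≟ x
    ... | no _ = h

    dels-⊑ : ∀ s H → dels H s ⊑ H
    dels-⊑ []       H v h = h
    dels-⊑ (y ∷ ys) H v h = del-⊑ H y v (dels-⊑ ys (del H y) v h)

    ⊑-false : ∀ {H H′} → H ⊑ H′ → ∀ v → H′ v ≡ false → H v ≡ false
    ⊑-false {H} h v e with H v in eq
    ... | false = refl
    ... | true = trans (sym (h v eq)) e

    dels-∉ : ∀ s H x → mem x s ≡ true → dels H s x ≡ false
    dels-∉ (y ∷ ys) H x m with x ≟ y
    ... | yes refl = ⊑-false (dels-⊑ ys (del H x)) x (gone H x)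
      where
      gone : ∀ H x → del H x x ≡ false
      gone H x rewrite ==-refl x = refl
    ... | no _ = dels-∉ ys (del H y) x m

    size-del : ∀ H x → H x ≡ true → size (del H x) < size H
    size-del H x hx = go (allFin n) (∈-allFin x)
      where
      weak : ∀ v → 𝟙 (del H x v) ≤ 𝟙 (H v)
      weak v with v ≟ x
      ... | yes _ = z≤n
      ... | no _ = ≤-refl
      strict : 𝟙 (del H x x) < 𝟙 (H x)
      strict rewrite ==-refl x | hx = s≤s z≤n
      go : ∀ xs → x ∈ xs → ∑ xs (λ v → 𝟙 (del H x v)) < ∑ xs (λ v → 𝟙 (H v))
      go (_ ∷ xs) (here refl) = +-mono-<-≤ strict (∑-mono xs weak)
      go (y ∷ xs) (there x∈) = +-mono-≤-< (weak y) (go xs x∈)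

    -- All ways to single out one constraint from the rest: the index set for the telescoped
    -- difference of two products of factors.
    splits : ∀ {A : Set} → List A → List (A × List A)
    splits []       = []
    splits (x ∷ xs) = (x , xs) ∷ map (λ (y , ys) → y , x ∷ ys) (splits xs)

    ∑-splits : ∀ {A : Set} (xs : List A) (F : A → ℕ) → (∑[ s ∈ splits xs ] F (proj₁ s)) ≡ ∑ xs F
    ∑-splits []       F = refl
    ∑-splits (x ∷ xs) F = cong (F x +_) (trans (∑-map _ (splits xs) _) (∑-splits xs F))

    splits-≡ : ∀ {A : Set} (xs : List A) (F : A → ℕ) s → s ∈ splits xs →
               ∑ xs F ≡ F (proj₁ s) + ∑ (proj₂ s) F
    splits-≡ xs F s s∈ = go xs s s∈
      where
      go : ∀ xs s → s ∈ splits xs → ∑ xs F ≡ F (proj₁ s) + ∑ (proj₂ s) F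
      go (x ∷ xs) s (here refl) = refl
      go (x ∷ xs) s (there s∈) with ∈-map⁻ _ s∈
      ... | (y , ys) , s∈′ , refl rewrite go xs (y , ys) s∈′ = +-left-comm (F x) (F y) (∑ ys F)

    splits-W : ∀ H K s → s ∈ splits K → ∀ f → W H K f ≡ W H (proj₁ s ∷ proj₂ s) f
    splits-W H K s s∈ f = go K s s∈
      where
      go : ∀ K s → s ∈ splits K → W H K f ≡ W H (proj₁ s ∷ proj₂ s) f
      go (x ∷ xs) s (here refl) = refl
      go (x ∷ xs) s (there s∈) with ∈-map⁻ _ s∈
      ... | (y , ys) , s∈′ , refl rewrite go xs (y , ys) s∈′ = *-left-comm (bound x ∸ Q H x f) (bound y ∸ Q H y f) (W H ys f)

  load : Fin n → Constraint → ℕ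
  load x c = ∑[ τ ∈ terms c ] 𝟙 (mem x (scope τ)) * (64 * mean τ)

  Sparse : List Constraint → Set
  Sparse K = ∀ x → Free x ≡ true → (∑[ c ∈ K ] weight c * load x c) ≤ U

  private
    Sparse-split : ∀ {K} → Sparse K → ∀ s → s ∈ splits K → Sparse (proj₂ s)
    Sparse-split {K} sp s s∈ x fx =
      ≤-trans (m≤n+m _ (weight (proj₁ s) * load x (proj₁ s)))
        (≤-trans (≤-reflexive (sym (splits-≡ K (λ c → weight c * load x c) s s∈))) (sp x fx))

    -- The induction claim: adding a free vertex at most halves the total weight. It ranges over all
    -- sparse constraint lists because it is also applied after one constraint has been removed, and
    -- `t` bounds the size of `H` because re-adding deleted vertices needs only smaller sets.
    Grow : ℕ → Set
    Grow t = ∀ H → size H < t → ∀ K → Sparse K → ∀ x → Free x ≡ true → M H K ≤ 2 * M (ins H x) K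

    module Step (t : ℕ) (ih : Grow t) where

      -- Deletions are undone from the last to the first. Each one that removed something is undone
      -- from a set strictly smaller than `H`, where the induction hypothesis gives the factor 2.
      readd : ∀ s H → size H ≤ t → (∀ x → mem x s ≡ true → Free x ≡ true) → ∀ K → Sparse K →
              M (dels H s) K ≤ 2 ^ length s * M H K
      readd []       H h fr K sp = ≤-reflexive (sym (+-identityʳ _))
      readd (y ∷ ys) H h fr K sp = begin
        M (dels (del H y) ys) K           ≤⟨ readd ys (del H y) (≤-trans del≤ h) (λ x m → fr x (mem-tail x y ys m)) K sp ⟩
        2 ^ length ys * M (del H y) K     ≤⟨ *-monoʳ-≤ (2 ^ length ys) one ⟩
        2 ^ length ys * (2 * M H K)       ≡⟨ lemma (2 ^ length ys) (M H K) ⟩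
        2 ^ length (y ∷ ys) * M H K       ∎
        where
        open ≤-Reasoning
        lemma : ∀ a b → a * (2 * b) ≡ 2 * a * b
        lemma = solve-∀
        del≤ : size (del H y) ≤ size H
        del≤ = ∑-mono (allFin n) (λ v → weak v)
          where
          weak : ∀ v → 𝟙 (del H y v) ≤ 𝟙 (H v)
          weak v with v ≟ y
          ... | yes _ = z≤n
          ... | no _ = ≤-refl
        one : M (del H y) K ≤ 2 * M H K
        one with H y in eq
        ... | true = ≤-trans (ih (del H y) (<-≤-trans (size-del H y eq) h) K sp y (fr y (mem-head y ys)))
                       (*-monoʳ-≤ 2 (∑ᵛ-mono ps n λ f → W-anti⁻ f))
          where
          W-anti⁻ : ∀ f → W (ins (del H y) y) K f ≤ W H K f
          W-anti⁻ = W-anti (λ v hv → back v hv) K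
            where
            back : H ⊑ ins (del H y) y
            back v hv with v ≟ y
            ... | yes _ = refl
            ... | no _ = hv
        ... | false = ≤-trans (M-anti (λ v hv → keep v hv) K) (m≤n*m _ 2)
          where
          keep : H ⊑ del H y
          keep v hv with v ≟ y
          ... | yes refl = trans (sym eq) hv
          ... | no _ = hv

      -- Deleting the scope of the term from `H` only raises the weight and makes it independent of
      -- the scope, so `avg` applies. Restoring at most four vertices costs 2 ^ 4 = 16.
      drop-term : ∀ H → size H ≤ t → ∀ K → Sparse K → ∀ τ →
                  E (λ f → val τ f * W H K f) ≤ 16 * mean τ * M H K
      drop-term H h K sp τ = begin
        E (λ f → val τ f * W H K f)
          ≤⟨ ∑ᵛ-mono ps n (λ f → *-monoʳ-≤ (val τ f) (W-anti (dels-⊑ s H) K f)) ⟩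
        E (λ f → val τ f * W (dels H s) K f)
          ≤⟨ avg τ (W (dels H s) K) (λ x m → W-indep (dels H s) x (dels-∉ s H x m) K) ⟩
        mean τ * M (dels H s) K
          ≤⟨ *-monoʳ-≤ (mean τ) (readd s H h (free τ) K sp) ⟩
        mean τ * (2 ^ length s * M H K)
          ≤⟨ *-monoʳ-≤ (mean τ) (*-monoˡ-≤ (M H K) (^-monoʳ-≤ 2 (short τ))) ⟩
        mean τ * (16 * M H K)
          ≡⟨ lemma (mean τ) (M H K) ⟩
        16 * mean τ * M H K ∎
        where
        open ≤-Reasoning
        s = scope τ
        lemma : ∀ a b → a * (16 * b) ≡ 16 * a * b
        lemma = solve-∀

      -- By `drop-term` and `room` the mean of `Q` under the remaining weight is at most a quarter
      -- of `bound c`; for the factor 2, a half would be enough.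
      drop-constraint : ∀ H → size H ≤ t → ∀ c R → Sparse R → bound c * M H R ≤ 2 * M H (c ∷ R)
      drop-constraint H h c R sp = +-cancelʳ-≤ (bound c * M H R) _ _ (begin
        bound c * M H R + bound c * M H R
          ≡⟨ double (bound c * M H R) ⟩
        2 * (bound c * M H R)
          ≤⟨ *-monoʳ-≤ 2 split ⟩
        2 * (M H (c ∷ R) + E (λ f → Q H c f * W H R f))
          ≡⟨ *-distribˡ-+ 2 (M H (c ∷ R)) _ ⟩
        2 * M H (c ∷ R) + 2 * E (λ f → Q H c f * W H R f)
          ≤⟨ +-monoʳ-≤ _ small ⟩
        2 * M H (c ∷ R) + bound c * M H R ∎)
        where
        open ≤-Reasoning
        split : bound c * M H R ≤ M H (c ∷ R) + E (λ f → Q H c f * W H R f)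
        split = begin
          bound c * M H R
            ≡⟨ ∑ᵛ-*ˡ ps n (bound c) (W H R) ⟨
          E (λ f → bound c * W H R f)
            ≤⟨ ∑ᵛ-mono ps n (λ f → ≤-trans (*-monoˡ-≤ (W H R f) (m≤n+m∸n (bound c) (Q H c f)))
                 (≤-reflexive (lemma₂ (Q H c f) (bound c ∸ Q H c f) (W H R f)))) ⟩
          E (λ f → (bound c ∸ Q H c f) * W H R f + Q H c f * W H R f)
            ≡⟨ ∑ᵛ-+ ps n _ _ ⟩
          M H (c ∷ R) + E (λ f → Q H c f * W H R f) ∎
          where
          lemma₂ : ∀ a b c → (a + b) * c ≡ b * c + a * c
          lemma₂ = solve-∀
        small : 2 * E (λ f → Q H c f * W H R f) ≤ bound c * M H R
        small = begin
          2 * E (λ f → Q H c f * W H R f)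
            ≤⟨ *-monoʳ-≤ 2 (∑ᵛ-mono ps n (λ f → *-monoˡ-≤ (W H R f)
                 (∑-mono (terms c) (λ τ → 𝟙* (inside H (scope τ)) (val τ f))))) ⟩
          2 * E (λ f → ∑ (terms c) (λ τ → val τ f) * W H R f)
            ≡⟨ cong (2 *_) (trans (∑ᵛ-cong ps n (λ f → sym (∑-*ʳ (terms c) (W H R f) _))) (∑ᵛ-∑ ps n (terms c) _)) ⟩
          2 * ∑ (terms c) (λ τ → E (λ f → val τ f * W H R f))
            ≤⟨ *-monoʳ-≤ 2 (∑-mono (terms c) (drop-term H h R sp)) ⟩
          2 * ∑ (terms c) (λ τ → 16 * mean τ * M H R)
            ≡⟨ ∑-*ˡ (terms c) 2 _ ⟨
          ∑ (terms c) (λ τ → 2 * (16 * mean τ * M H R))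
            ≤⟨ ∑-mono (terms c) (λ τ → ≤-trans (≤-reflexive (lemma₃ (mean τ) (M H R)))
                 (*-monoˡ-≤ (M H R) (*-monoˡ-≤ (mean τ) {32} {64} (m≤m+n 32 32)))) ⟩
          ∑ (terms c) (λ τ → 64 * mean τ * M H R)
            ≡⟨ ∑-*ʳ (terms c) (M H R) _ ⟩
          ∑ (terms c) (λ τ → 64 * mean τ) * M H R
            ≤⟨ *-monoˡ-≤ (M H R) (room c) ⟩
          bound c * M H R ∎
          where
          lemma₃ : ∀ a b → 2 * (16 * a * b) ≡ 32 * a * b
          lemma₃ = solve-∀

    δ : Fin n → Constraint → Vec P n → ℕ
    δ x c f = ∑[ τ ∈ terms c ] 𝟙 (mem x (scope τ)) * val τ f

    inside-ins : ∀ H x s → mem x s ≡ false → inside (ins H x) s ≡ inside H s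
    inside-ins H x []       m = refl
    inside-ins H x (y ∷ ys) m with x ≟ y | y ≟ x
    ... | no _  | no _ = cong (H y ∧_) (inside-ins H x ys m)
    ... | no ¬p | yes p = ⊥-elim (¬p (sym p))

    Q-ins : ∀ H x c f → Q (ins H x) c f ≤ Q H c f + δ x c f
    Q-ins H x c f = ≤-trans (∑-mono (terms c) go) (≤-reflexive (∑-+ (terms c) _ _))
      where
      go : ∀ τ → 𝟙 (inside (ins H x) (scope τ)) * val τ f ≤
                 𝟙 (inside H (scope τ)) * val τ f + 𝟙 (mem x (scope τ)) * val τ f
      go τ with mem x (scope τ) in m
      ... | true = ≤-trans (≤-trans (𝟙* (inside (ins H x) (scope τ)) _) (≤-reflexive (sym (+-identityʳ _))))
                           (m≤n+m _ (𝟙 (inside H (scope τ)) * val τ f))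
      ... | false rewrite inside-ins H x (scope τ) m = m≤m+n _ _

    -- Telescoping over the factors: each one drops by at most the terms through `x`, and the other
    -- factors are replaced by their larger values before the change.
    perturb : ∀ H x K f → W H K f ≤ W (ins H x) K f + (∑[ s ∈ splits K ] δ x (proj₁ s) f * W H (proj₂ s) f)
    perturb H x []      f = m≤m+n _ _
    perturb H x (c ∷ K) f = begin
      a * w                                   ≤⟨ *-monoˡ-≤ w (m≤n+m∸n a d) ⟩
      (d + (a ∸ d)) * w                       ≡⟨ *-distribʳ-+ w d (a ∸ d) ⟩
      d * w + (a ∸ d) * w                     ≤⟨ +-monoʳ-≤ (d * w) (*-monoʳ-≤ (a ∸ d) (perturb H x K f)) ⟩
      d * w + (a ∸ d) * (w′ + p)              ≡⟨ cong (d * w +_) (*-distribˡ-+ (a ∸ d) w′ p) ⟩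
      d * w + ((a ∸ d) * w′ + (a ∸ d) * p)    ≤⟨ +-monoʳ-≤ (d * w) (+-mono-≤ (*-monoˡ-≤ w′ a∸d≤a′) (*-monoˡ-≤ p (m∸n≤m a d))) ⟩
      d * w + (a′ * w′ + a * p)               ≡⟨ +-left-comm (d * w) (a′ * w′) (a * p) ⟩
      a′ * w′ + (d * w + a * p)               ≡⟨ cong (λ z → a′ * w′ + (d * w + z)) tail ⟩
      a′ * w′ + (d * w + ∑ (map (λ (y , ys) → y , c ∷ ys) (splits K)) (λ s → δ x (proj₁ s) f * W H (proj₂ s) f)) ∎
      where
      open ≤-Reasoning
      a = bound c ∸ Q H c f
      a′ = bound c ∸ Q (ins H x) c f
      d = δ x c f
      w = W H K f
      w′ = W (ins H x) K f
      p = ∑ (splits K) (λ s → δ x (proj₁ s) f * W H (proj₂ s) f)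
      a∸d≤a′ : a ∸ d ≤ a′
      a∸d≤a′ = ≤-trans (≤-reflexive (∸-+-assoc (bound c) (Q H c f) d)) (∸-monoʳ-≤ (bound c) (Q-ins H x c f))
      tail : a * p ≡ ∑ (map (λ (y , ys) → y , c ∷ ys) (splits K)) (λ s → δ x (proj₁ s) f * W H (proj₂ s) f)
      tail = trans (sym (∑-*ˡ (splits K) a _))
               (trans (∑-cong (splits K) (λ s → *-left-comm a (δ x (proj₁ s) f) (W H (proj₂ s) f)))
                      (sym (∑-map _ (splits K) _)))

    grow : ∀ t → Grow t
    grow (suc t) H (s≤s h) K sp x fx = *-cancelˡ-≤ U ⦃ >-nonZero U>0 ⦄ (+-cancelʳ-≤ (U * M H K) _ _ (begin
      U * M H K + U * M H K
        ≡⟨ double (U * M H K) ⟩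
      2 * (U * M H K)
        ≤⟨ *-monoʳ-≤ 2 (*-monoʳ-≤ U mass) ⟩
      2 * (U * (M′ + ∑ (splits K) (λ s → X s)))
        ≡⟨ lemma₂ U M′ _ ⟩
      U * (2 * M′) + 2 * (U * ∑ (splits K) (λ s → X s))
        ≤⟨ +-monoʳ-≤ (U * (2 * M′)) rest ⟩
      U * (2 * M′) + U * M H K ∎))
      where
      open ≤-Reasoning
      open Step t (grow t)
      M′ = M (ins H x) K
      X : Constraint × List Constraint → ℕ
      X s = E (λ f → δ x (proj₁ s) f * W H (proj₂ s) f)
      lemma₂ : ∀ u a b → 2 * (u * (a + b)) ≡ u * (2 * a) + 2 * (u * b)
      lemma₂ = solve-∀
      mass : M H K ≤ M′ + ∑ (splits K) X
      mass = ≤-trans (∑ᵛ-mono ps n (perturb H x K))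
               (≤-reflexive (trans (∑ᵛ-+ ps n _ _) (cong (M′ +_) (∑ᵛ-∑ ps n (splits K) _))))
      -- The 64 in `load` is 2 · 16 · 2: only half of the weight may be lost, a term costs 16 by
      -- `drop-term`, and putting the constraint back costs 2 by `drop-constraint`.
      each : ∀ s → s ∈ splits K → 2 * (U * X s) ≤ weight (proj₁ s) * load x (proj₁ s) * M H K
      each s@(c , R) s∈ = begin
        2 * (U * X s)                         ≡⟨ cong (λ u → 2 * (u * X s)) (sym (scale c)) ⟩
        2 * (weight c * least c * X s)        ≡⟨ lemma₃ (weight c) (least c) (X s) ⟩
        weight c * (2 * (least c * X s))      ≤⟨ *-monoʳ-≤ (weight c) (*-monoʳ-≤ 2 (*-monoˡ-≤ (X s) (least≤ c))) ⟩
        weight c * (2 * (bound c * X s))      ≤⟨ *-monoʳ-≤ (weight c) main ⟩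
        weight c * (load x c * M H K)         ≡⟨ *-assoc (weight c) _ _ ⟨
        weight c * load x c * M H K           ∎
        where
        lemma₃ : ∀ a b c → 2 * (a * b * c) ≡ a * (2 * (b * c))
        lemma₃ = solve-∀
        lemma₄ : ∀ b i m r → 2 * (b * (i * (16 * m * r))) ≡ i * (32 * m) * (b * r)
        lemma₄ = solve-∀
        lemma₅ : ∀ i m r → i * (32 * m) * (2 * r) ≡ i * (64 * m) * r
        lemma₅ = solve-∀
        spR = Sparse-split sp s s∈
        main : 2 * (bound c * X s) ≤ load x c * M H K
        main = begin
          2 * (bound c * X s)
            ≡⟨ cong (λ z → 2 * (bound c * z)) (trans
                 (∑ᵛ-cong ps n (λ f → sym (∑-*ʳ (terms c) (W H R f) _))) (∑ᵛ-∑ ps n (terms c) _)) ⟩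
          2 * (bound c * ∑ (terms c) (λ τ → E (λ f → 𝟙 (mem x (scope τ)) * val τ f * W H R f)))
            ≡⟨ cong (λ z → 2 * (bound c * z)) (∑-cong (terms c) (λ τ → trans
                 (∑ᵛ-cong ps n (λ f → *-assoc (𝟙 (mem x (scope τ))) (val τ f) (W H R f)))
                 (∑ᵛ-*ˡ ps n (𝟙 (mem x (scope τ))) _))) ⟩
          2 * (bound c * ∑ (terms c) (λ τ → 𝟙 (mem x (scope τ)) * E (λ f → val τ f * W H R f)))
            ≡⟨ trans (cong (2 *_) (sym (∑-*ˡ (terms c) (bound c) _))) (sym (∑-*ˡ (terms c) 2 _)) ⟩
          ∑ (terms c) (λ τ → 2 * (bound c * (𝟙 (mem x (scope τ)) * E (λ f → val τ f * W H R f))))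
            ≤⟨ ∑-mono (terms c) (λ τ → *-monoʳ-≤ 2 (*-monoʳ-≤ (bound c)
                 (*-monoʳ-≤ (𝟙 (mem x (scope τ))) (drop-term H h R spR τ)))) ⟩
          ∑ (terms c) (λ τ → 2 * (bound c * (𝟙 (mem x (scope τ)) * (16 * mean τ * M H R))))
            ≡⟨ ∑-cong (terms c) (λ τ → lemma₄ (bound c) (𝟙 (mem x (scope τ))) (mean τ) (M H R)) ⟩
          ∑ (terms c) (λ τ → 𝟙 (mem x (scope τ)) * (32 * mean τ) * (bound c * M H R))
            ≤⟨ ∑-mono (terms c) (λ τ → *-monoʳ-≤ (𝟙 (mem x (scope τ)) * (32 * mean τ))
                 (drop-constraint H h c R spR)) ⟩
          ∑ (terms c) (λ τ → 𝟙 (mem x (scope τ)) * (32 * mean τ) * (2 * M H (c ∷ R)))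
            ≡⟨ ∑-cong (terms c) (λ τ → lemma₅ (𝟙 (mem x (scope τ))) (mean τ) (M H (c ∷ R))) ⟩
          ∑ (terms c) (λ τ → 𝟙 (mem x (scope τ)) * (64 * mean τ) * M H (c ∷ R))
            ≡⟨ ∑-*ʳ (terms c) _ _ ⟩
          load x c * M H (c ∷ R)
            ≡⟨ cong (load x c *_) (sym (∑ᵛ-cong ps n (splits-W H K s s∈))) ⟩
          load x c * M H K ∎
      rest : 2 * (U * ∑ (splits K) X) ≤ U * M H K
      rest = begin
        2 * (U * ∑ (splits K) X)
          ≡⟨ trans (cong (2 *_) (sym (∑-*ˡ (splits K) U X))) (sym (∑-*ˡ (splits K) 2 _)) ⟩
        ∑ (splits K) (λ s → 2 * (U * X s))
          ≤⟨ ∑-mono-∈ (splits K) each ⟩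
        ∑ (splits K) (λ s → weight (proj₁ s) * load x (proj₁ s) * M H K)
          ≡⟨ trans (∑-*ʳ (splits K) (M H K) _)
               (cong (_* M H K) (∑-splits K (λ c → weight c * load x c))) ⟩
        ∑ K (λ c → weight c * load x c) * M H K
          ≤⟨ *-monoˡ-≤ (M H K) (sp x fx) ⟩
        U * M H K ∎

    bound-pos : ∀ c → 0 < bound c
    bound-pos c with least c in eq | scale c | least≤ c
    ... | suc _ | _ | le = ≤-trans (s≤s z≤n) (subst (_≤ bound c) eq (least≤ c))
    ... | zero | sc | _ = ⊥-elim (<-irrefl refl (subst (0 <_) (trans (sym sc) (*-zeroʳ (weight c))) U>0))

    none : Set?
    none _ = false

    half-pos : ∀ {a b} → 0 < a → a ≤ 2 * b → 0 < b
    half-pos {b = suc b} _ _ = s≤s z≤n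
    half-pos {suc a} {zero} _ ()

    -- Terms with empty scope count even for the empty set, so this weight is not simply the product
    -- of the bounds; `drop-constraint` takes care of them.
    M-none : ∀ K → Sparse K → 0 < M none K
    M-none []      sp = ones n
      where
      ones : ∀ k → 0 < ∑ᵛ ps k (λ _ → 1)
      ones zero    = s≤s z≤n
      ones (suc k) = <-≤-trans (*-mono-< ps≢[] (ones k)) (≤-reflexive (sym (∑-const ps _)))
    M-none (c ∷ K) sp = half-pos (*-mono-< (bound-pos c) (M-none K spK))
                          (Step.drop-constraint (size none) (grow _) none ≤-refl c K spK)
      where
      spK : Sparse K
      spK x fx = ≤-trans (m≤n+m _ _) (sp x fx)

    fill : List (Fin n) → Set? → Set?
    fill []       H = H
    fill (x ∷ xs) H = fill xs (if Free x then ins H x else H)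

    fill-pos : ∀ xs H K → Sparse K → 0 < M H K → 0 < M (fill xs H) K
    fill-pos []       H K sp h = h
    fill-pos (x ∷ xs) H K sp h with Free x in eq
    ... | true = fill-pos xs (ins H x) K sp (half-pos h (grow (suc (size H)) H ≤-refl K sp x eq))
    ... | false = fill-pos xs H K sp h

    fill-⊒ : ∀ xs H → H ⊑ fill xs H
    fill-⊒ []       H v h = h
    fill-⊒ (x ∷ xs) H v h with Free x
    ... | false = fill-⊒ xs H v h
    ... | true = fill-⊒ xs (ins H x) v more
      where
      more : ins H x v ≡ true
      more with v == x
      ... | true = refl
      ... | false = h

    fill-∋ : ∀ xs H x → x ∈ xs → Free x ≡ true → fill xs H x ≡ true
    fill-∋ (x ∷ xs) H x (here refl) fx rewrite fx = fill-⊒ xs (ins H x) x new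
      where
      new : ins H x x ≡ true
      new rewrite ==-refl x = refl
    fill-∋ (y ∷ xs) H x (there x∈) fx = fill-∋ xs (if Free y then ins H y else H) x x∈ fx

    inside-all : ∀ H s → (∀ x → mem x s ≡ true → H x ≡ true) → inside H s ≡ true
    inside-all H []       h = refl
    inside-all H (y ∷ ys) h rewrite h y (mem-head y ys) = inside-all H ys (λ x m → h x (mem-tail x y ys m))

    factor-pos : ∀ H K f → 0 < W H K f → ∀ c → c ∈ K → Q H c f < bound c
    factor-pos H (c ∷ K) f h c (here refl) with bound c ∸ Q H c f in eq
    ... | suc k = m<n∸m (subst (0 <_) (sym eq) (s≤s z≤n))
      where
      m<n∸m : ∀ {m n} → 0 < n ∸ m → m < n
      m<n∸m {zero} {suc n} _ = s≤s z≤n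
      m<n∸m {suc m} {suc n} h = s≤s (m<n∸m {m} {n} h)
    factor-pos H (d ∷ K) f h c (there c∈) with W H K f in eq
    ... | suc k = factor-pos H K f (subst (0 <_) (sym eq) (s≤s z≤n)) c c∈
    ... | zero = ⊥-elim (<-irrefl refl (subst (0 <_) (*-zeroʳ (bound d ∸ Q H d f)) h))

  -- Once all free vertices are included the total weight is still positive, so some placement has
  -- no vanishing factor, which makes every inequality strict.
  solution : ∀ K → Sparse K →
             Σ (Vec P n) λ f → ∀ c → c ∈ K → (∑[ τ ∈ terms c ] val τ f) < bound c
  solution K sp with ∑ᵛ-pos⇒∃ ps n (W H K) (fill-pos (allFin n) none K sp (M-none K sp))
    where
    H = fill (allFin n) none
  ... | f , pos = f , λ c c∈ → subst (_< bound c) (full c) (factor-pos H K f pos c c∈)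
    where
    H = fill (allFin n) none
    full : ∀ c → Q H c f ≡ (∑[ τ ∈ terms c ] val τ f)
    full c = ∑-cong (terms c) λ τ →
      trans (cong (λ b → 𝟙 b * val τ f)
              (inside-all H (scope τ) (λ x m → fill-∋ (allFin n) none x (∈-allFin x) (free τ x m))))
            (+-identityʳ (val τ f))

-- Averaged kernels

-- Positions are averaged out where the argument is nothing; each slot carries a factor
-- length ps, so that averages stay in ℕ.
module Kernel {P : Set} (ps : List P) (κ : P → P → P → P → ℕ)
              (κ-swap₁₂ : ∀ a b c d → κ a b c d ≡ κ b a c d)
              (κ-swap₂₃ : ∀ a b c d → κ a b c d ≡ κ a c b d)
              (κ-swap₃₄ : ∀ a b c d → κ a b c d ≡ κ a b d c)
              (G₀ : ℕ) (κ-sum : ∀ a → (∑[ b ∈ ps ] ∑[ c ∈ ps ] ∑[ d ∈ ps ] κ a b c d) ≤ G₀) where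

  N G₁ : ℕ
  N = length ps
  G₁ = N * G₀

  av : Maybe P → (P → ℕ) → ℕ
  av (just p) F = N * F p
  av nothing  F = ∑ ps F

  av-cong : ∀ o {F G} → (∀ p → F p ≡ G p) → av o F ≡ av o G
  av-cong (just p) h = cong (N *_) (h p)
  av-cong nothing  h = ∑-cong ps h

  av-*ˡ : ∀ o c F → av o (λ p → c * F p) ≡ c * av o F
  av-*ˡ (just p) c F = *-left-comm N c (F p)
  av-*ˡ nothing  c F = ∑-*ˡ ps c F

  av-∑ : ∀ {A : Set} o (xs : List A) (F : A → P → ℕ) → av o (λ p → ∑ xs (λ x → F x p)) ≡ (∑[ x ∈ xs ] av o (F x))
  av-∑ (just p) xs F = sym (∑-*ˡ xs N _)
  av-∑ nothing  xs F = ∑-swap ps xs (λ p x → F x p)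

  av-swap : ∀ a b (F : P → P → ℕ) → av a (λ p → av b (F p)) ≡ av b (λ q → av a (λ p → F p q))
  av-swap a (just q) F = av-*ˡ a N (λ p → F p q)
  av-swap a nothing  F = av-∑ a ps (λ q p → F p q)

  -- `N⁴` times the expectation of `κ` when the missing points are independent and uniform.
  K : Maybe P → Maybe P → Maybe P → Maybe P → ℕ
  K a b c d = av a λ p → av b λ q → av c λ r → av d λ s → κ p q r s

  K-swap₁₂ : ∀ a b c d → K a b c d ≡ K b a c d
  K-swap₁₂ a b c d = trans (av-swap a b _)
    (av-cong b λ q → av-cong a λ p → av-cong c λ r → av-cong d λ s → κ-swap₁₂ p q r s)

  K-swap₂₃ : ∀ a b c d → K a b c d ≡ K a c b d
  K-swap₂₃ a b c d = av-cong a λ p → trans (av-swap b c _)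
    (av-cong c λ r → av-cong b λ q → av-cong d λ s → κ-swap₂₃ p q r s)

  K-swap₃₄ : ∀ a b c d → K a b c d ≡ K a b d c
  K-swap₃₄ a b c d = av-cong a λ p → av-cong b λ q → trans (av-swap c d _)
    (av-cong d λ s → av-cong c λ r → κ-swap₃₄ p q r s)

  K-avg₁ : ∀ b c d → (∑[ q ∈ ps ] K (just q) b c d) ≡ N * K nothing b c d
  K-avg₁ b c d = ∑-*ˡ ps N _

  K-avg₂ : ∀ a c d → (∑[ q ∈ ps ] K a (just q) c d) ≡ N * K a nothing c d
  K-avg₂ a c d = trans (∑-cong ps (λ q → K-swap₁₂ a (just q) c d))
    (trans (K-avg₁ a c d) (cong (N *_) (K-swap₁₂ nothing a c d)))

  K-avg₃ : ∀ a b d → (∑[ q ∈ ps ] K a b (just q) d) ≡ N * K a b nothing d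
  K-avg₃ a b d = trans (∑-cong ps (λ q → K-swap₂₃ a b (just q) d))
    (trans (K-avg₂ a b d) (cong (N *_) (K-swap₂₃ a nothing b d)))

  K-avg₄ : ∀ a b c → (∑[ q ∈ ps ] K a b c (just q)) ≡ N * K a b c nothing
  K-avg₄ a b c = trans (∑-cong ps (λ q → K-swap₃₄ a b c (just q)))
    (trans (K-avg₃ a b c) (cong (N *_) (K-swap₃₄ a b nothing c)))

  K-one₁ : ∀ a → K a nothing nothing nothing ≤ G₁
  K-one₁ (just p) = *-monoʳ-≤ N (κ-sum p)
  K-one₁ nothing  = ∑-bound ps G₀ κ-sum

  K-one₂ : ∀ a → K nothing a nothing nothing ≤ G₁
  K-one₂ a = ≤-trans (≤-reflexive (K-swap₁₂ nothing a nothing nothing)) (K-one₁ a)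

  K-one₃ : ∀ a → K nothing nothing a nothing ≤ G₁
  K-one₃ a = ≤-trans (≤-reflexive (K-swap₂₃ nothing nothing a nothing)) (K-one₂ a)

  N⁴ : ℕ
  N⁴ = N * (N * (N * N))

  K-all : ∀ a b c d → K (just a) (just b) (just c) (just d) ≡ N⁴ * κ a b c d
  K-all a b c d = lemma N (κ a b c d)
    where
    lemma : ∀ n k → n * (n * (n * (n * k))) ≡ n * (n * (n * n)) * k
    lemma = solve-∀

  module Placement {n : ℕ} where

    Label : Set
    Label = Maybe (Fin n)

    at : (Fin n → Maybe P) → Label → Maybe P
    at φ nothing  = nothing
    at φ (just v) = φ v

    -- The label `nothing` is an extra random point rather than a vertex, so two occurrences of it
    -- are independent points and count as separate.
    sep : Label → Label → Bool
    sep (just u) (just v) = not (u == v)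
    sep _        _        = true

    distinct : Label → Label → Label → Label → Bool
    distinct a b c d = (sep a b ∧ sep a c ∧ sep a d) ∧ (sep b c ∧ sep b d) ∧ sep c d

    distinct⇒ : ∀ a b c d → distinct a b c d ≡ true →
                (sep a b ≡ true × sep a c ≡ true × sep a d ≡ true) × (sep b c ≡ true × sep b d ≡ true) × sep c d ≡ true
    distinct⇒ a b c d h with sep a b | sep a c | sep a d | sep b c | sep b d | sep c d
    ... | true | true | true | true | true | true = (refl , refl , refl) , (refl , refl) , refl

    Kₗ : (Fin n → Maybe P) → Label → Label → Label → Label → ℕ
    Kₗ φ a b c d = K (at φ a) (at φ b) (at φ c) (at φ d)

    choose : Maybe P → Bool → P → Maybe P
    choose (just p) _     q = just p
    choose nothing  true  q = just q
    choose nothing  false q = nothing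

    free? : Maybe P → Bool → Bool
    free? (just p) _ = false
    free? nothing  b = b

    free?⇒ : ∀ o {b} → free? o b ≡ true → (b ≡ true) × (is-just o ≡ false)
    free?⇒ nothing h = h , refl

    ¬free?⇒ : ∀ o {b} → free? o b ≡ false → b ≡ true → is-just o ≡ true
    ¬free?⇒ (just _) _ _ = refl
    ¬free?⇒ nothing  h k = trans (sym h) k

    module Extension (N>0 : 0 < N) (φ : Fin n → Maybe P) (X : Fin n → Bool) (U : ℕ) (U>0 : 0 < U) where

      -- Placed vertices keep their points, vertices of `X` take theirs from `f`, and the rest
      -- remain random; coordinates of `f` at non-free vertices are never read.
      ext : Vec P n → Fin n → Maybe P
      ext f v = choose (φ v) (X v) (lookup f v)

      Free : Fin n → Bool
      Free v = free? (φ v) (X v)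

      open LocalLemma ps N>0 Free U U>0

      slot : Label → List (Fin n)
      slot nothing  = []
      slot (just v) = if Free v then v ∷ [] else []

      hits : Label → Fin n → ℕ
      hits nothing  x = 0
      hits (just v) x = 𝟙 (v == x)

      mem-++ : ∀ x (s t : List (Fin n)) → mem x (s ++ t) ≡ mem x s ∨ mem x t
      mem-++ x []      t = refl
      mem-++ x (y ∷ s) t with x == y
      ... | true = refl
      ... | false = mem-++ x s t

      mem-slot : ∀ x o → mem x (slot o) ≡ true → (o ≡ just x) × (Free x ≡ true)
      mem-slot x (just v) m with Free v in eq
      ... | true with x ≟ v
      ...   | yes refl = refl , eq

      slot-short : ∀ o → length (slot o) ≤ 1
      slot-short nothing = z≤n
      slot-short (just v) with Free v
      ... | true = ≤-refl
      ... | false = z≤n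

      mem-hits : ∀ x o → 𝟙 (mem x (slot o)) ≤ hits o x
      mem-hits x o with mem x (slot o) in eq
      ... | false = z≤n
      ... | true with mem-slot x o eq
      ...   | refl , _ rewrite ==-refl x = ≤-refl

      ext-other : ∀ o x f q → o ≢ just x → at (ext (f [ x ]≔ q)) o ≡ at (ext f) o
      ext-other nothing  x f q h = refl
      ext-other (just v) x f q h = cong (choose (φ v) (X v)) (lookup∘update′ (λ { refl → h refl }) f q)

      ext-local : ∀ o x f q → mem x (slot o) ≡ false → at (ext (f [ x ]≔ q)) o ≡ at (ext f) o
      ext-local nothing  x f q h = refl
      ext-local (just v) x f q h with v ≟ x
      ... | no v≢x = ext-other (just v) x f q (λ { refl → v≢x refl })
      ... | yes refl with φ v | X v
      ...   | just p  | _     = refl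
      ...   | nothing | false = refl
      ...   | nothing | true with trans (sym h) (mem-head v [])
      ...     | ()

      -- If `o` is a free vertex, its coordinate occurs nowhere else in the integrand, so it can be
      -- resampled and summed out, which turns a placed argument back into a missing one. The
      -- cancelled factor `N` is the number of values forgotten in `resample`.
      average : ∀ (o : Label) (h : Maybe P → Vec P n → ℕ) W →
                (∀ x → o ≡ just x → Free x ≡ true → (∀ a → IndepOf (h a) x) × IndepOf W x) →
                (∀ f → (∑[ q ∈ ps ] h (just q) f) ≡ N * h nothing f) →
                E (λ f → h (at (ext f) o) f * W f) ≡ E (λ f → h (at φ o) f * W f)
      average nothing  h W ind mean≡ = refl
      average (just v) h W ind mean≡ with φ v in eφ | X v in eX
      ... | just p  | _     = refl
      ... | nothing | false = refl
      ... | nothing | true with ind v refl (trans (cong (λ z → free? z (X v)) eφ) eX)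
      ...   | indh , indW = *-cancelˡ-≡ _ _ N ⦃ >-nonZero N>0 ⦄ (begin
        N * E (λ f → h (just (lookup f v)) f * W f)
          ≡⟨ resample ps v _ ⟨
        ∑ ps (λ q → E (λ f → h (just (lookup (f [ v ]≔ q) v)) (f [ v ]≔ q) * W (f [ v ]≔ q)))
          ≡⟨ ∑-cong ps (λ q → ∑ᵛ-cong ps n (λ f → cong₂ _*_
               (trans (cong (λ z → h (just z) (f [ v ]≔ q)) (lookup∘update v f q)) (indh (just q) f q)) (indW f q))) ⟩
        ∑ ps (λ q → E (λ f → h (just q) f * W f))
          ≡⟨ ∑ᵛ-∑ ps n ps (λ q f → h (just q) f * W f) ⟨
        E (λ f → ∑ ps (λ q → h (just q) f * W f))
          ≡⟨ ∑ᵛ-cong ps n (λ f → trans (∑-*ʳ ps (W f) _) (trans (cong (_* W f) (mean≡ f)) (*-assoc N _ _))) ⟩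
        E (λ f → N * (h nothing f * W f))
          ≡⟨ ∑ᵛ-*ˡ ps n N _ ⟩
        N * E (λ f → h nothing f * W f) ∎)
        where open ≡-Reasoning

      module _ (k : ℕ) (a b c d : Label) where

        private
          s = slot a ++ slot b ++ slot c ++ slot d
          w = 𝟙 (distinct a b c d)

          m-s : ∀ x → mem x s ≡ mem x (slot a) ∨ mem x (slot b) ∨ mem x (slot c) ∨ mem x (slot d)
          m-s x = trans (mem-++ x (slot a) _) (cong (mem x (slot a) ∨_)
            (trans (mem-++ x (slot b) _) (cong (mem x (slot b) ∨_) (mem-++ x (slot c) (slot d)))))

          short′ : length s ≤ 4
          short′ rewrite length-++ (slot a) {slot b ++ slot c ++ slot d}
                       | length-++ (slot b) {slot c ++ slot d}
                       | length-++ (slot c) {slot d}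
            = +-mono-≤ (slot-short a) (+-mono-≤ (slot-short b) (+-mono-≤ (slot-short c) (slot-short d)))

          free′ : ∀ x → mem x s ≡ true → Free x ≡ true
          free′ x m with mem x (slot a) in ea | mem x (slot b) in eb | mem x (slot c) in ec | mem x (slot d) in ed | trans (sym m) (m-s x)
          ... | true | _ | _ | _ | _ = proj₂ (mem-slot x a ea)
          ... | false | true | _ | _ | _ = proj₂ (mem-slot x b eb)
          ... | false | false | true | _ | _ = proj₂ (mem-slot x c ec)
          ... | false | false | false | true | _ = proj₂ (mem-slot x d ed)

          value : Vec P n → ℕ
          value f = w * (k * Kₗ (ext f) a b c d)

          local′ : ∀ x → mem x s ≡ false → IndepOf value x
          local′ x m f q with mem x (slot a) in ea | mem x (slot b) in eb | mem x (slot c) in ec | mem x (slot d) in ed | trans (sym m) (m-s x)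
          ... | false | false | false | false | _
            rewrite ext-local a x f q ea | ext-local b x f q eb | ext-local c x f q ec | ext-local d x f q ed = refl

          in-s : ∀ x → (mem x (slot a) ≡ true ⊎ mem x (slot b) ≡ true) ⊎ (mem x (slot c) ≡ true ⊎ mem x (slot d) ≡ true) → mem x s ≡ true
          in-s x h = trans (m-s x) (go h)
            where
            go : (mem x (slot a) ≡ true ⊎ mem x (slot b) ≡ true) ⊎ (mem x (slot c) ≡ true ⊎ mem x (slot d) ≡ true) →
                 mem x (slot a) ∨ mem x (slot b) ∨ mem x (slot c) ∨ mem x (slot d) ≡ true
            go (inj₁ (inj₁ e)) rewrite e = refl
            go (inj₁ (inj₂ e)) with mem x (slot a)
            ... | true = refl
            ... | false rewrite e = refl
            go (inj₂ (inj₁ e)) with mem x (slot a) | mem x (slot b)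
            ... | true | _ = refl
            ... | false | true = refl
            ... | false | false rewrite e = refl
            go (inj₂ (inj₂ e)) with mem x (slot a) | mem x (slot b) | mem x (slot c)
            ... | true | _ | _ = refl
            ... | false | true | _ = refl
            ... | false | false | true = refl
            ... | false | false | false = e

          slot-self : ∀ x → Free x ≡ true → mem x (slot (just x)) ≡ true
          slot-self x fx rewrite fx = mem-head x []

          sep⇒ : ∀ o o′ x → sep o o′ ≡ true → o ≡ just x → o′ ≢ just x
          sep⇒ o o′ x h refl refl rewrite ==-refl x with h
          ... | ()

          -- The four labels are averaged out one at a time. Distinctness makes averaging one of
          -- them leave the others untouched; if it fails, the term is zero.
          avg′ : ∀ W → (∀ x → mem x s ≡ true → IndepOf W x) →
                 E (λ f → value f * W f) ≤ w * (k * Kₗ φ a b c d) * E W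
          avg′ W ind with distinct a b c d in ed
          ... | false = ≤-reflexive (∑ᵛ-*ˡ ps n 0 W)
          ... | true with distinct⇒ a b c d ed
          ... | (ab , ac , ad) , (bc , bd) , cd = ≤-reflexive (begin
            E (λ f → (1 * (k * Kₗ (ext f) a b c d)) * W f)
              ≡⟨ pull (λ f → Kₗ (ext f) a b c d) ⟩
            k * E (λ f → Kₗ (ext f) a b c d * W f)
              ≡⟨ cong (k *_) (average a (λ o f → K o (at (ext f) b) (at (ext f) c) (at (ext f) d)) W
                   (λ { x refl fx → (λ o f q → cong₃ (K o) (ext-other b x f q (sep⇒ a b x ab refl))
                                      (ext-other c x f q (sep⇒ a c x ac refl)) (ext-other d x f q (sep⇒ a d x ad refl)))
                                  , ind x (in-s x (inj₁ (inj₁ (slot-self x fx)))) }) (λ f → K-avg₁ (at (ext f) b) (at (ext f) c) (at (ext f) d))) ⟩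
            k * E (λ f → K (at φ a) (at (ext f) b) (at (ext f) c) (at (ext f) d) * W f)
              ≡⟨ cong (k *_) (average b (λ o f → K (at φ a) o (at (ext f) c) (at (ext f) d)) W
                   (λ { x refl fx → (λ o f q → cong₂ (K (at φ a) o)
                                      (ext-other c x f q (sep⇒ b c x bc refl)) (ext-other d x f q (sep⇒ b d x bd refl)))
                                  , ind x (in-s x (inj₁ (inj₂ (slot-self x fx)))) }) (λ f → K-avg₂ (at φ a) (at (ext f) c) (at (ext f) d))) ⟩
            k * E (λ f → K (at φ a) (at φ b) (at (ext f) c) (at (ext f) d) * W f)
              ≡⟨ cong (k *_) (average c (λ o f → K (at φ a) (at φ b) o (at (ext f) d)) W
                   (λ { x refl fx → (λ o f q → cong (K (at φ a) (at φ b) o) (ext-other d x f q (sep⇒ c d x cd refl)))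
                                  , ind x (in-s x (inj₂ (inj₁ (slot-self x fx)))) }) (λ f → K-avg₃ (at φ a) (at φ b) (at (ext f) d))) ⟩
            k * E (λ f → K (at φ a) (at φ b) (at φ c) (at (ext f) d) * W f)
              ≡⟨ cong (k *_) (average d (λ o f → K (at φ a) (at φ b) (at φ c) o) W
                   (λ { x refl fx → (λ o f q → refl)
                                  , ind x (in-s x (inj₂ (inj₂ (slot-self x fx)))) }) (λ f → K-avg₄ (at φ a) (at φ b) (at φ c))) ⟩
            k * E (λ f → Kₗ φ a b c d * W f)
              ≡⟨ cong (k *_) (∑ᵛ-*ˡ ps n (Kₗ φ a b c d) W) ⟩
            k * (Kₗ φ a b c d * E W)
              ≡⟨ lemma k (Kₗ φ a b c d) (E W) ⟩
            1 * (k * Kₗ φ a b c d) * E W ∎)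
            where
            open ≡-Reasoning
            lemma : ∀ a b c → a * (b * c) ≡ 1 * (a * b) * c
            lemma = solve-∀
            pull : ∀ (g : Vec P n → ℕ) → E (λ f → (1 * (k * g f)) * W f) ≡ k * E (λ f → g f * W f)
            pull g = trans (∑ᵛ-cong ps n (λ f → sym (lemma k (g f) (W f)))) (∑ᵛ-*ˡ ps n k _)
            cong₃ : ∀ {A : Set} (F : A → A → A → ℕ) {x x′ y y′ z z′} → x ≡ x′ → y ≡ y′ → z ≡ z′ → F x y z ≡ F x′ y′ z′
            cong₃ F refl refl refl = refl

        term : Term
        term = record
          { scope = s ; val = value ; mean = w * (k * Kₗ φ a b c d)
          ; short = short′ ; free = free′ ; local = local′ ; avg = avg′ }

        term-hits : ∀ x → 𝟙 (mem x (scope term)) ≤ hits a x + (hits b x + (hits c x + hits d x))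
        term-hits x rewrite m-s x = ≤-trans (∨-sum (mem x (slot a)) _) (+-mono-≤ (mem-hits x a)
            (≤-trans (∨-sum (mem x (slot b)) _) (+-mono-≤ (mem-hits x b)
              (≤-trans (∨-sum (mem x (slot c)) _) (+-mono-≤ (mem-hits x c) (mem-hits x d))))))
          where
          ∨-sum : ∀ p q → 𝟙 (p ∨ q) ≤ 𝟙 p + 𝟙 q
          ∨-sum true  q = s≤s z≤n
          ∨-sum false q = ≤-refl

-- Extending a partial drawing

bool-ext : ∀ {p q} → (p ≡ true → q ≡ true) → (q ≡ true → p ≡ true) → p ≡ q
bool-ext {true}  {true}  _ _ = refl
bool-ext {false} {false} _ _ = refl
bool-ext {true}  {false} f _ = sym (f refl)
bool-ext {false} {true}  _ g = g refl

𝟙-mono : ∀ {p q} → (p ≡ true → q ≡ true) → 𝟙 p ≤ 𝟙 q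
𝟙-mono {false} h = z≤n
𝟙-mono {true}  h rewrite h refl = ≤-refl

∧-true : ∀ p {q} → p ∧ q ≡ true → (p ≡ true) × (q ≡ true)
∧-true true {true} _ = refl , refl

==-sym : ∀ {n} (x y : Fin n) → (x == y) ≡ (y == x)
==-sym x y = bool-ext (λ h → go (==⇒≡ h)) (λ h → sym-go (==⇒≡ h))
  where
  go : x ≡ y → (y == x) ≡ true
  go refl = ==-refl x
  sym-go : y ≡ x → (x == y) ≡ true
  sym-go refl = ==-refl x

∑-δ : ∀ n (x : Fin n) (F : Fin n → ℕ) → (∑[ v ∈ allFin n ] 𝟙 (v == x) * F v) ≡ F x
∑-δ (suc n) Fin.zero F =
  trans (∑-allFin-suc n (λ v → 𝟙 (v == Fin.zero) * F v))
        (trans (cong (F Fin.zero + 0 +_) (∑-0 (allFin n))) (lemma (F Fin.zero)))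
  where
  lemma : ∀ a → a + 0 + 0 ≡ a
  lemma = solve-∀
∑-δ (suc n) (Fin.suc x) F =
  trans (∑-allFin-suc n (λ v → 𝟙 (v == Fin.suc x) * F v)) (∑-δ n x (λ v → F (Fin.suc v)))

maybe-status : ∀ {A : Set} (o : Maybe A) → o ≡ nothing ⊎ is-just o ≡ true
maybe-status nothing  = inj₁ refl
maybe-status (just _) = inj₂ refl

𝟙-cases : ∀ b c {d} → (b ≡ true → c ≤ d) → 𝟙 b * c ≤ d
𝟙-cases false c h = z≤n
𝟙-cases true  c h = ≤-trans (≤-reflexive (+-identityʳ c)) (h refl)

weight-anti : ∀ {p q} → (p ≡ true → q ≡ true) → (if q then 1 else 64) ≤ (if p then 1 else 64)
weight-anti {false} {true}  h = s≤s z≤n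
weight-anti {false} {false} h = ≤-refl
weight-anti {true}  {true}  h = ≤-refl
weight-anti {true}  {false} h with h refl
... | ()

𝟙-mono-cases : ∀ b {c d} → (b ≡ true → c ≤ d) → 𝟙 b * c ≤ 𝟙 b * d
𝟙-mono-cases false h = z≤n
𝟙-mono-cases true  h = *-monoʳ-≤ 1 (h refl)

𝟙-==-zero : ∀ {n} (v x : Fin n) (F : Fin n → ℕ) → F x ≡ 0 → 𝟙 (v == x) * F v ≡ 0
𝟙-==-zero v x F h with v ≟ x
... | no _ = refl
... | yes refl = trans (+-identityʳ _) h

∈-concatMap : ∀ {A B : Set} (f : A → List B) {xs x y} → x ∈ xs → y ∈ f x → y ∈ concatMap f xs
∈-concatMap f x∈ y∈ = ∈-concatMap⁺ f (go x∈)
  where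
  go : ∀ {xs} → _ ∈ xs → Any (λ x → _ ∈ f x) xs
  go (here refl) = here y∈
  go (there x∈)  = there (go x∈)

true≢false : ∀ {A : Set} → true ≡ false → A
true≢false ()

not-both-just : ∀ {A : Set} (a b : Maybe A) → a ≡ nothing ⊎ b ≡ nothing → not (is-just a ∧ is-just b) ≡ true
not-both-just nothing  b       h = refl
not-both-just (just _) nothing h = refl
not-both-just (just _) (just _) (inj₁ ())
not-both-just (just _) (just _) (inj₂ ())

module Incidence {n m : ℕ} (src tgt : Fin m → Fin n) where

  Vs : List (Fin n)
  Vs = allFin n
  Es : List (Fin m)
  Es = allFin m

  within : (Fin n → Bool) → Fin m → Bool
  within X e = X (src e) ∧ X (tgt e)

  inc : Fin m → Fin n → ℕ
  inc e x = 𝟙 (src e == x) + 𝟙 (tgt e == x)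

  inc-cases : ∀ e x → inc e x ≡ 0 ⊎ (src e ≡ x ⊎ tgt e ≡ x)
  inc-cases e x with src e ≟ x | tgt e ≟ x
  ... | yes p | _ = inj₂ (inj₁ p)
  ... | no _ | yes p = inj₂ (inj₂ p)
  ... | no _ | no _ = inj₁ refl

  inc-mono : ∀ e x {a b} → (src e ≡ x ⊎ tgt e ≡ x → a ≤ b) → inc e x * a ≤ inc e x * b
  inc-mono e x h with inc-cases e x
  ... | inj₁ eq rewrite eq = z≤n
  ... | inj₂ hit = *-monoʳ-≤ (inc e x) (h hit)

  deg : Fin n → ℕ
  deg x = ∑[ e ∈ Es ] inc e x

  degIn : (Fin n → Bool) → Fin n → ℕ
  degIn X x = ∑[ e ∈ Es ] inc e x * 𝟙 (within X e)

-- Potentials of a partial drawing and the placement of one layer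

module Drawing {P : Set} (ps : List P) (κ : P → P → P → P → ℕ)
               (κ-swap₁₂ : ∀ a b c d → κ a b c d ≡ κ b a c d)
               (κ-swap₂₃ : ∀ a b c d → κ a b c d ≡ κ a c b d)
               (κ-swap₃₄ : ∀ a b c d → κ a b c d ≡ κ a b d c)
               (G₀ : ℕ) (κ-sum : ∀ a → (∑[ b ∈ ps ] ∑[ c ∈ ps ] ∑[ d ∈ ps ] κ a b c d) ≤ G₀)
               (N>0 : 0 < length ps)
               (n m : ℕ) (src tgt : Fin m → Fin n) where

  open Kernel ps κ κ-swap₁₂ κ-swap₂₃ κ-swap₃₄ G₀ κ-sum public
  open Placement {n} public

  open Incidence src tgt public

  srcᴸ tgtᴸ : Fin m → Label
  srcᴸ e = just (src e)
  tgtᴸ e = just (tgt e)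

  placed : (Fin n → Maybe P) → Fin n → Bool
  placed φ v = is-just (φ v)

  -- An edge that is not yet completely placed carries weight 64, which pays for the
  -- factor lost when the local lemma turns its expected contribution into a hard bound.
  cost : (Fin n → Maybe P) → Fin m → ℕ
  cost φ e = if within (placed φ) e then 1 else 64

  -- The price of a future edge from `o` to a vertex not yet placed: up to scaling and costs, the
  -- expected number of edges coplanar with it, its free end and all other unplaced ends being
  -- random.
  potential : (Fin n → Maybe P) → Label → ℕ
  potential φ o = ∑[ e ∈ Es ] 𝟙 (distinct o (srcᴸ e) (tgtᴸ e) nothing) * (cost φ e * Kₗ φ o (srcᴸ e) (tgtᴸ e) nothing)

  -- Bounds the total influence that one edge between `w` and a vertex still random has on the
  -- potentials of all placed vertices.
  closeness : (Fin n → Maybe P) → Fin n → ℕ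
  closeness φ w = ∑[ u ∈ Vs ] 𝟙 (placed φ u) *
            (𝟙 (distinct (just u) (just w) nothing nothing) * Kₗ φ (just u) (just w) nothing nothing)

  Valid : (Fin n → Maybe P) → Set
  Valid φ = ∀ g e → within (placed φ) g ≡ true → within (placed φ) e ≡ true →
            distinct (srcᴸ g) (tgtᴸ g) (srcᴸ e) (tgtᴸ e) ≡ true → Kₗ φ (srcᴸ g) (tgtᴸ g) (srcᴸ e) (tgtᴸ e) ≡ 0

  1≤cost : ∀ φ e → 1 ≤ cost φ e
  1≤cost φ e with within (placed φ) e
  ... | true = ≤-refl
  ... | false = s≤s z≤n

  cost≤64 : ∀ φ e → cost φ e ≤ 64
  cost≤64 φ e with within (placed φ) e
  ... | true = s≤s z≤n
  ... | false = ≤-refl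

  sep-sym : ∀ a b → sep a b ≡ sep b a
  sep-sym nothing  nothing  = refl
  sep-sym nothing  (just _) = refl
  sep-sym (just _) nothing  = refl
  sep-sym (just u) (just v) = cong not (==-sym u v)

  sep-nothing : ∀ a → sep a nothing ≡ true
  sep-nothing nothing  = refl
  sep-nothing (just _) = refl

  distinct⇐ : ∀ a b c d →
              (sep a b ≡ true × sep a c ≡ true × sep a d ≡ true) × (sep b c ≡ true × sep b d ≡ true) × sep c d ≡ true →
              distinct a b c d ≡ true
  distinct⇐ a b c d ((ab , ac , ad) , (bc , bd) , cd) rewrite ab | ac | ad | bc | bd | cd = refl

  distinct-drop₁ : ∀ a b c d → distinct a b c d ≡ true → distinct b c d nothing ≡ true
  distinct-drop₁ a b c d h with distinct⇒ a b c d h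
  ... | (ab , ac , ad) , (bc , bd) , cd =
    distinct⇐ b c d nothing ((bc , bd , sep-nothing b) , (cd , sep-nothing c) , sep-nothing d)

  distinct-swap₁₂ : ∀ a b c d → distinct a b c d ≡ true → distinct b a c d ≡ true
  distinct-swap₁₂ a b c d h with distinct⇒ a b c d h
  ... | (ab , ac , ad) , (bc , bd) , cd =
    distinct⇐ b a c d ((trans (sep-sym b a) ab , bc , bd) , (ac , ad) , cd)

  distinct-swapᵖ : ∀ a b c d → distinct a b c d ≡ true → distinct c d a b ≡ true
  distinct-swapᵖ a b c d h with distinct⇒ a b c d h
  ... | (ab , ac , ad) , (bc , bd) , cd =
    distinct⇐ c d a b ((cd , trans (sep-sym c a) ac , trans (sep-sym c b) bc) , (trans (sep-sym d a) ad , trans (sep-sym d b) bd) , ab)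

  K-swapᵖ : ∀ a b c d → K a b c d ≡ K c d a b
  K-swapᵖ a b c d = trans (K-swap₂₃ a b c d) (trans (K-swap₁₂ a c b d) (trans (K-swap₃₄ c a b d)
                      (trans (K-swap₂₃ c a d b) refl)))

  K-rotate : ∀ b c d → K nothing b c d ≡ K b c d nothing
  K-rotate b c d = trans (K-swap₁₂ nothing b c d) (trans (K-swap₂₃ b nothing c d) (K-swap₃₄ b c nothing d))

  K-not-both : ∀ a b → 𝟙 (not (is-just a ∧ is-just b)) * K a b nothing nothing ≤ G₁
  K-not-both (just _) (just _) = z≤n
  K-not-both nothing  b        = ≤-trans (𝟙* _ _) (K-one₂ b)
  K-not-both (just p) nothing  = ≤-trans (𝟙* true _) (K-one₁ (just p))

  distinct-src : ∀ a b c → distinct a b c nothing ≡ true → distinct a b nothing nothing ≡ true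
  distinct-src a b c h with distinct⇒ a b c nothing h
  ... | (ab , _ , an) , (_ , bn) , _ = distinct⇐ a b nothing nothing ((ab , an , an) , (bn , bn) , refl)

  distinct-tgt : ∀ a b c → distinct a b c nothing ≡ true → distinct a c nothing nothing ≡ true
  distinct-tgt a b c h with distinct⇒ a b c nothing h
  ... | (_ , ac , an) , _ , cn = distinct⇐ a c nothing nothing ((ac , an , an) , (cn , cn) , refl)

  distinct-forget : ∀ a b c → distinct a b c nothing ≡ true → distinct nothing b c nothing ≡ true
  distinct-forget a b c h with distinct⇒ a b c nothing h
  ... | _ , bc , cn = distinct⇐ nothing b c nothing ((refl , refl , refl) , bc , cn)

  at-placed : ∀ φ v → placed φ v ≡ false → φ v ≡ nothing
  at-placed φ v h with φ v
  ... | nothing = refl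

  is-just-choose : ∀ o b q → (is-just o ≡ true → b ≡ true) → is-just (choose o b q) ≡ b
  is-just-choose (just p) b     q h = sym (h refl)
  is-just-choose nothing  true  q h = refl
  is-just-choose nothing  false q h = refl

  choose-placed : ∀ o b q → is-just o ≡ true → choose o b q ≡ o
  choose-placed (just p) b q h = refl

  choose-outside : ∀ o q → (is-just o ≡ true → false ≡ true) → (o ≡ nothing) × (choose o false q ≡ nothing)
  choose-outside (just p) q h with h refl
  ... | ()
  choose-outside nothing  q h = refl , refl

  K-all-placed : ∀ a b c d → is-just a ≡ true → is-just b ≡ true → is-just c ≡ true → is-just d ≡ true →
                 K a b c d < N⁴ → K a b c d ≡ 0
  K-all-placed (just a) (just b) (just c) (just d) _ _ _ _ h rewrite K-all a b c d with κ a b c d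
  ... | zero  = *-zeroʳ N⁴
  ... | suc k = ⊥-elim (<⇒≱ h (m≤m*n N⁴ (suc k)))

  -- φ places the vertices of Y ⊆ X; the remaining vertices of X are to be placed next.
  record Partial : Set where
    field
      φ      : Fin n → Maybe P
      X      : Fin n → Bool
      dmax Δ t r j⋆ j β₂ β₃ β₄ : ℕ
      Y⊆X    : ∀ v → placed φ v ≡ true → X v ≡ true
      valid  : Valid φ
      R≤     : ∀ w → closeness φ w ≤ r
      J⋆≤    : potential φ nothing ≤ j⋆
      J≤     : ∀ o → potential φ o ≤ j
      X≤t    : (∑[ v ∈ Vs ] 𝟙 (X v)) ≤ t
      degIn≤ : ∀ x → X x ≡ true → placed φ x ≡ false → degIn X x ≤ dmax
      deg≤   : ∀ x → X x ≡ true → placed φ x ≡ false → deg x ≤ Δ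
      -- `h₁` to `h₄` each keep one of the four families of constraints within a quarter of the
      -- sparsity budget, whence the leading 4. `h₁′` is the `room` of a forbidden pair of edges,
      -- which `h₁` does not give when `dmax` is 0.
      h₁     : 4 * (64 * (2 * (dmax * j))) ≤ N⁴
      h₁′    : 64 * j ≤ N⁴
      h₂     : 4 * (64 * (2 * (t * G₁))) ≤ β₂
      h₃     : 4 * (64 * (dmax * (r + t * G₁))) ≤ β₃
      h₄     : 4 * (64 * (j⋆ + 64 * (t * (Δ * G₁)))) ≤ β₄

  module Stage (partial : Partial) where

    open Partial partial

    Y : Fin n → Bool
    Y = placed φ

    -- The product of the values of `least` of the four families; the weight of a family is the
    -- product of the other three. The successors keep it positive when some β vanishes.
    U : ℕ
    U = N⁴ * (suc β₂ * (suc β₃ * suc β₄))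

    N⁴>0 : 0 < N⁴
    N⁴>0 = *-mono-< N>0 (*-mono-< N>0 (*-mono-< N>0 N>0))

    U>0 : 0 < U
    U>0 = *-mono-< N⁴>0 (s≤s z≤n)

    open Extension N>0 φ X U U>0
    open LocalLemma ps N>0 Free U U>0

    Free⇒ : ∀ x → Free x ≡ true → (X x ≡ true) × (Y x ≡ false)
    Free⇒ x = free?⇒ (φ x)

    Free⇒nothing : ∀ x → Free x ≡ true → φ x ≡ nothing
    Free⇒nothing x h = at-placed φ x (proj₂ (Free⇒ x h))

    ¬Free⇒ : ∀ x → Free x ≡ false → X x ≡ true → Y x ≡ true
    ¬Free⇒ x = ¬free?⇒ (φ x)

    -- Since `a` is still a random point, symmetry moves it to the last place, and the sum becomes a
    -- potential of `b` without its costs, which are at least 1.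
    pair-sum₁ : ∀ a b → at φ a ≡ nothing → (∑[ e ∈ Es ] 𝟙 (distinct a b (srcᴸ e) (tgtᴸ e)) * Kₗ φ a b (srcᴸ e) (tgtᴸ e)) ≤ j
    pair-sum₁ a b h = ≤-trans (∑-mono Es λ e → *-mono-≤ (𝟙-mono (distinct-drop₁ a b (srcᴸ e) (tgtᴸ e)))
        (≤-trans (≤-reflexive (trans (cong (λ z → K z (at φ b) (φ (src e)) (φ (tgt e))) h) (K-rotate (at φ b) (φ (src e)) (φ (tgt e)))))
          (m≤n*m _ (cost φ e) ⦃ >-nonZero (1≤cost φ e) ⦄))) (J≤ b)

    pair-sum : ∀ a b → at φ a ≡ nothing ⊎ at φ b ≡ nothing →
               (∑[ e ∈ Es ] 𝟙 (distinct a b (srcᴸ e) (tgtᴸ e)) * Kₗ φ a b (srcᴸ e) (tgtᴸ e)) ≤ j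
    pair-sum a b (inj₁ h) = pair-sum₁ a b h
    pair-sum a b (inj₂ h) = ≤-trans (∑-mono Es λ e → *-mono-≤ (𝟙-mono (distinct-swap₁₂ a b (srcᴸ e) (tgtᴸ e)))
        (≤-reflexive (K-swap₁₂ (at φ a) (at φ b) (φ (src e)) (φ (tgt e))))) (pair-sum₁ b a h)

    private
      c₁ : Fin m → Fin m → ℕ
      c₁ g e = 𝟙 (within X g) * 𝟙 (within X e)

      τ₁ : Fin m → Fin m → Term
      τ₁ g e = term (c₁ g e) (srcᴸ g) (tgtᴸ g) (srcᴸ e) (tgtᴸ e)

      mean₁-sym : ∀ g e → mean (τ₁ g e) ≡ mean (τ₁ e g)
      mean₁-sym g e = cong₂ _*_ (cong 𝟙 (bool-ext (distinct-swapᵖ (srcᴸ g) (tgtᴸ g) (srcᴸ e) (tgtᴸ e)) (distinct-swapᵖ (srcᴸ e) (tgtᴸ e) (srcᴸ g) (tgtᴸ g))))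
        (cong₂ _*_ (*-comm (𝟙 (within X g)) (𝟙 (within X e))) (K-swapᵖ (φ (src g)) (φ (tgt g)) (φ (src e)) (φ (tgt e))))

      mean₁≤ : ∀ g e → mean (τ₁ g e) ≤ 𝟙 (within X g) * (𝟙 (distinct (srcᴸ g) (tgtᴸ g) (srcᴸ e) (tgtᴸ e)) * Kₗ φ (srcᴸ g) (tgtᴸ g) (srcᴸ e) (tgtᴸ e))
      mean₁≤ g e = ≤-trans (*-monoʳ-≤ w (*-monoˡ-≤ k (*-monoʳ-≤ p (𝟙≤1 (within X e))))) (≤-reflexive (lemma w p k))
        where
        w = 𝟙 (distinct (srcᴸ g) (tgtᴸ g) (srcᴸ e) (tgtᴸ e))
        p = 𝟙 (within X g)
        k = Kₗ φ (srcᴸ g) (tgtᴸ g) (srcᴸ e) (tgtᴸ e)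
        lemma : ∀ w p k → w * (p * 1 * k) ≡ p * (w * k)
        lemma = solve-∀

      ∑mean₁≤ : ∀ g → φ (src g) ≡ nothing ⊎ φ (tgt g) ≡ nothing → (∑[ e ∈ Es ] mean (τ₁ g e)) ≤ 𝟙 (within X g) * j
      ∑mean₁≤ g h = ≤-trans (∑-mono Es (mean₁≤ g)) (≤-trans (≤-reflexive (∑-*ˡ Es (𝟙 (within X g)) _))
        (*-monoʳ-≤ (𝟙 (within X g)) (pair-sum (srcᴸ g) (tgtᴸ g) h)))

      status : ∀ v → φ v ≡ nothing ⊎ Y v ≡ true
      status v = maybe-status (φ v)

      -- With an unplaced end the mean is one summand of a sum bounded by `j`; with all four ends
      -- placed it vanishes by `valid`.
      mean₁≤j : ∀ g e → mean (τ₁ g e) ≤ j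
      mean₁≤j g e = go (status (src g)) (status (tgt g)) (status (src e)) (status (tgt e))
        where
        single : ∀ g e → φ (src g) ≡ nothing ⊎ φ (tgt g) ≡ nothing → mean (τ₁ g e) ≤ j
        single g e h = ≤-trans (∈⇒≤∑ (λ e → mean (τ₁ g e)) (∈-allFin e)) (≤-trans (∑mean₁≤ g h) (𝟙* (within X g) j))
        single′ : φ (src e) ≡ nothing ⊎ φ (tgt e) ≡ nothing → mean (τ₁ g e) ≤ j
        single′ h = ≤-trans (≤-reflexive (mean₁-sym g e)) (single e g h)
        go : φ (src g) ≡ nothing ⊎ Y (src g) ≡ true → φ (tgt g) ≡ nothing ⊎ Y (tgt g) ≡ true →
             φ (src e) ≡ nothing ⊎ Y (src e) ≡ true → φ (tgt e) ≡ nothing ⊎ Y (tgt e) ≡ true → mean (τ₁ g e) ≤ j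
        go (inj₁ h) _ _ _ = single g e (inj₁ h)
        go _ (inj₁ h) _ _ = single g e (inj₂ h)
        go _ _ (inj₁ h) _ = single′ (inj₁ h)
        go _ _ _ (inj₁ h) = single′ (inj₂ h)
        go (inj₂ a) (inj₂ b) (inj₂ c) (inj₂ d) = 𝟙-cases (distinct (srcᴸ g) (tgtᴸ g) (srcᴸ e) (tgtᴸ e)) _ λ eq →
          ≤-trans (≤-reflexive (trans (cong (c₁ g e *_) (valid g e (cong₂ _∧_ a b) (cong₂ _∧_ c d) eq)) (*-zeroʳ (c₁ g e)))) z≤n

      -- A forbidden event in the form of a bounded sum: with all four ends placed the term is a
      -- multiple of `N⁴`, so staying below `N⁴` forces it to be 0.
      con₁ : Fin m → Fin m → Constraint
      con₁ g e = record
        { terms = τ₁ g e ∷ [] ; bound = N⁴ ; least = N⁴ ; weight = suc β₂ * (suc β₃ * suc β₄)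
        ; scale = *-comm (suc β₂ * (suc β₃ * suc β₄)) N⁴ ; least≤ = ≤-refl
        ; room = ≤-trans (≤-reflexive (+-identityʳ _)) (≤-trans (*-monoʳ-≤ 64 (mean₁≤j g e)) h₁′) }

      inc-∑mean₁ : ∀ x → Free x ≡ true → ∀ g → inc g x * (∑[ e ∈ Es ] mean (τ₁ g e)) ≤ inc g x * (𝟙 (within X g) * j)
      inc-∑mean₁ x fx g = inc-mono g x λ h →
        ∑mean₁≤ g (unplaced h)
        where
        unplaced : src g ≡ x ⊎ tgt g ≡ x → φ (src g) ≡ nothing ⊎ φ (tgt g) ≡ nothing
        unplaced (inj₁ h) = inj₁ (trans (cong φ h) (Free⇒nothing x fx))
        unplaced (inj₂ h) = inj₂ (trans (cong φ h) (Free⇒nothing x fx))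

      -- By symmetry it is enough to double the case that `x` lies on the first edge. There are at
      -- most `dmax` such edges inside `X`, and each has total mean at most `j` over all second
      -- edges.
      load₁ : ∀ x → Free x ≡ true → 4 * (∑[ g ∈ Es ] ∑[ e ∈ Es ] load x (con₁ g e)) ≤ N⁴
      load₁ x fx = ≤-trans (*-monoʳ-≤ 4 (begin
        ∑[ g ∈ Es ] ∑[ e ∈ Es ] load x (con₁ g e)
          ≤⟨ ∑-mono Es (λ g → ∑-mono Es (λ e → each g e)) ⟩
        ∑[ g ∈ Es ] ∑[ e ∈ Es ] 64 * (inc g x * mean (τ₁ g e) + inc e x * mean (τ₁ g e))
          ≡⟨ trans (∑-cong Es (λ g → ∑-*ˡ Es 64 _)) (∑-*ˡ Es 64 _) ⟩
        64 * (∑[ g ∈ Es ] ∑[ e ∈ Es ] inc g x * mean (τ₁ g e) + inc e x * mean (τ₁ g e))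
          ≡⟨ cong (64 *_) (trans (∑-cong Es (λ g → ∑-+ Es _ _)) (∑-+ Es _ _)) ⟩
        64 * (A + B)
          ≡⟨ cong (λ z → 64 * (A + z)) B≡A ⟩
        64 * (A + A)
          ≡⟨ lemma A ⟩
        64 * (2 * A)
          ≤⟨ *-monoʳ-≤ 64 (*-monoʳ-≤ 2 A≤) ⟩
        64 * (2 * (dmax * j)) ∎)) h₁
        where
        open ≤-Reasoning
        A = ∑[ g ∈ Es ] ∑[ e ∈ Es ] inc g x * mean (τ₁ g e)
        B = ∑[ g ∈ Es ] ∑[ e ∈ Es ] inc e x * mean (τ₁ g e)
        B≡A : B ≡ A
        B≡A = trans (∑-swap Es Es (λ g e → inc e x * mean (τ₁ g e)))
                (∑-cong Es (λ e → ∑-cong Es (λ g → cong (inc e x *_) (mean₁-sym g e))))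
        lemma : ∀ a → 64 * (a + a) ≡ 64 * (2 * a)
        lemma = solve-∀
        A≤ : A ≤ dmax * j
        A≤ = begin
          A ≡⟨ ∑-cong Es (λ g → ∑-*ˡ Es (inc g x) _) ⟩
          ∑[ g ∈ Es ] inc g x * (∑[ e ∈ Es ] mean (τ₁ g e)) ≤⟨ ∑-mono Es (inc-∑mean₁ x fx) ⟩
          ∑[ g ∈ Es ] inc g x * (𝟙 (within X g) * j) ≡⟨ trans (∑-cong Es (λ g → sym (*-assoc (inc g x) (𝟙 (within X g)) j))) (∑-*ʳ Es j _) ⟩
          degIn X x * j ≤⟨ *-monoˡ-≤ j (degIn≤ x (proj₁ (Free⇒ x fx)) (proj₂ (Free⇒ x fx))) ⟩
          dmax * j ∎
        each : ∀ g e → load x (con₁ g e) ≤ 64 * (inc g x * mean (τ₁ g e) + inc e x * mean (τ₁ g e))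
        each g e = ≤-trans (≤-reflexive (+-identityʳ _))
          (≤-trans (*-monoˡ-≤ (64 * mean (τ₁ g e)) (term-hits (c₁ g e) (srcᴸ g) (tgtᴸ g) (srcᴸ e) (tgtᴸ e) x))
            (≤-reflexive (lemma′ (hits (srcᴸ g) x) (hits (tgtᴸ g) x) (hits (srcᴸ e) x) (hits (tgtᴸ e) x) (mean (τ₁ g e)))))
          where
          lemma′ : ∀ a b c d k → (a + (b + (c + d))) * (64 * k) ≡ 64 * ((a + b) * k + (c + d) * k)
          lemma′ = solve-∀

      new₂ : Fin n → Fin n → ℕ
      new₂ w u = 𝟙 (X w) * (𝟙 (X u) * 𝟙 (not (Y w ∧ Y u)))

      τ₂ : Fin n → Fin n → Term
      τ₂ w u = term (new₂ w u) (just w) (just u) nothing nothing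

      mean₂≤ : ∀ w u → mean (τ₂ w u) ≤ 𝟙 (X w) * (𝟙 (X u) * G₁)
      mean₂≤ w u = ≤-trans (𝟙* (distinct (just w) (just u) nothing nothing) _)
        (≤-trans (≤-reflexive (lemma (𝟙 (X w)) (𝟙 (X u)) _ _)) (*-monoʳ-≤ (𝟙 (X w)) (*-monoʳ-≤ (𝟙 (X u)) one)))
        where
        lemma : ∀ a b c d → a * (b * c) * d ≡ a * (b * (c * d))
        lemma = solve-∀
        one : 𝟙 (not (Y w ∧ Y u)) * Kₗ φ (just w) (just u) nothing nothing ≤ G₁
        one = K-not-both (φ w) (φ u)

      ∑X≤ : ∀ c → (∑[ u ∈ Vs ] 𝟙 (X u) * c) ≤ t * c
      ∑X≤ c = ≤-trans (≤-reflexive (∑-*ʳ Vs c _)) (*-monoˡ-≤ c X≤t)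

      -- Limits the increase of the closeness of `w`: pairs placed earlier are excluded by `new₂`
      -- and remain covered by `R≤`.
      con₂ : Fin n → Constraint
      con₂ w = record
        { terms = map (τ₂ w) Vs ; bound = suc β₂ ; least = suc β₂ ; weight = N⁴ * (suc β₃ * suc β₄)
        ; scale = lemma N⁴ (suc β₂) (suc β₃ * suc β₄) ; least≤ = ≤-refl
        ; room = ≤-trans (≤-reflexive (trans (∑-map (τ₂ w) Vs _) (∑-*ˡ Vs 64 _)))
            (≤-trans (*-monoʳ-≤ 64 (≤-trans (∑-mono Vs (λ u → ≤-trans (mean₂≤ w u) (𝟙* (X w) _))) (∑X≤ G₁)))
              (≤-trans (slack (t * G₁)) (≤-trans h₂ (n≤1+n β₂)))) }
        where
        lemma : ∀ a b c → a * c * b ≡ a * (b * c)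
        lemma = solve-∀
        slack : ∀ a → 64 * a ≤ 4 * (64 * (2 * a))
        slack a = ≤-trans (*-monoʳ-≤ 64 (m≤n*m a 2)) (m≤n*m (64 * (2 * a)) 4)

      load₂ : ∀ x → 4 * (∑[ w ∈ Vs ] load x (con₂ w)) ≤ suc β₂
      load₂ x = ≤-trans (*-monoʳ-≤ 4 (begin
        ∑[ w ∈ Vs ] load x (con₂ w)
          ≡⟨ ∑-cong Vs (λ w → ∑-map (τ₂ w) Vs _) ⟩
        ∑[ w ∈ Vs ] ∑[ u ∈ Vs ] 𝟙 (mem x (scope (τ₂ w u))) * (64 * mean (τ₂ w u))
          ≤⟨ ∑-mono Vs (λ w → ∑-mono Vs (λ u → each w u)) ⟩
        ∑[ w ∈ Vs ] ∑[ u ∈ Vs ] 64 * (𝟙 (w == x) * (𝟙 (X u) * G₁) + 𝟙 (u == x) * (𝟙 (X w) * G₁))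
          ≡⟨ trans (∑-cong Vs (λ w → ∑-*ˡ Vs 64 _)) (∑-*ˡ Vs 64 _) ⟩
        64 * (∑[ w ∈ Vs ] ∑[ u ∈ Vs ] 𝟙 (w == x) * (𝟙 (X u) * G₁) + 𝟙 (u == x) * (𝟙 (X w) * G₁))
          ≡⟨ cong (64 *_) (trans (∑-cong Vs (λ w → trans (∑-+ Vs _ _) (cong₂ _+_ (∑-*ˡ Vs (𝟙 (w == x)) _) (∑-δ n x _)))) (∑-+ Vs _ _)) ⟩
        64 * ((∑[ w ∈ Vs ] 𝟙 (w == x) * (∑[ u ∈ Vs ] 𝟙 (X u) * G₁)) + (∑[ w ∈ Vs ] 𝟙 (X w) * G₁))
          ≡⟨ cong (λ z → 64 * (z + (∑[ w ∈ Vs ] 𝟙 (X w) * G₁))) (∑-δ n x (λ _ → ∑[ u ∈ Vs ] 𝟙 (X u) * G₁)) ⟩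
        64 * ((∑[ u ∈ Vs ] 𝟙 (X u) * G₁) + (∑[ w ∈ Vs ] 𝟙 (X w) * G₁))
          ≤⟨ *-monoʳ-≤ 64 (+-mono-≤ (∑X≤ G₁) (∑X≤ G₁)) ⟩
        64 * (t * G₁ + t * G₁)
          ≡⟨ cong (64 *_) (double (t * G₁)) ⟩
        64 * (2 * (t * G₁)) ∎)) (≤-trans h₂ (n≤1+n β₂))
        where
        open ≤-Reasoning
        lemma′ : ∀ a b p q g → (a + (b + 0)) * (64 * (p * (q * g))) ≡ 64 * (a * (p * (q * g)) + b * (q * (p * g)))
        lemma′ = solve-∀
        each : ∀ w u → 𝟙 (mem x (scope (τ₂ w u))) * (64 * mean (τ₂ w u)) ≤
                       64 * (𝟙 (w == x) * (𝟙 (X u) * G₁) + 𝟙 (u == x) * (𝟙 (X w) * G₁))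
        each w u = ≤-trans (*-mono-≤ (term-hits (new₂ w u) (just w) (just u) nothing nothing x) (*-monoʳ-≤ 64 (mean₂≤ w u)))
          (≤-trans (≤-reflexive (lemma′ (𝟙 (w == x)) (𝟙 (u == x)) (𝟙 (X w)) (𝟙 (X u)) G₁))
            (*-monoʳ-≤ 64 (+-mono-≤ (*-monoʳ-≤ (𝟙 (w == x)) (𝟙* (X w) _)) (*-monoʳ-≤ (𝟙 (u == x)) (𝟙* (X u) _)))))

      Os : List Label
      Os = nothing ∷ map just Vs

      pl : Label → Bool
      pl nothing  = true
      pl (just w) = Y w

      new₃ : Label → Fin m → ℕ
      new₃ o e = 𝟙 (pl o) * (𝟙 (within X e) * 𝟙 (not (within Y e)))

      τ₃ : Label → Fin m → Term
      τ₃ o e = term (new₃ o e) o (srcᴸ e) (tgtᴸ e) nothing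

      -- The bound follows the mean up to the factor 64. That part is free of charge, because a
      -- completed edge falls from cost 64 to cost 1; only `β₃` is added to the potential. Since the
      -- means differ from label to label, `least` is `suc β₃` alone.
      con₃ : Label → Constraint
      con₃ o = record
        { terms = map (τ₃ o) Es ; bound = 64 * (∑[ e ∈ Es ] mean (τ₃ o e)) + suc β₃ ; least = suc β₃
        ; weight = N⁴ * (suc β₂ * suc β₄)
        ; scale = lemma N⁴ (suc β₂) (suc β₃) (suc β₄) ; least≤ = m≤n+m (suc β₃) _
        ; room = ≤-trans (≤-reflexive (trans (∑-map (τ₃ o) Es _) (∑-*ˡ Es 64 _))) (m≤m+n _ (suc β₃)) }
        where
        lemma : ∀ a b c d → a * (b * d) * c ≡ a * (b * (c * d))
        lemma = solve-∀

      hits-pl : ∀ o x → Free x ≡ true → hits o x * 𝟙 (pl o) ≡ 0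
      hits-pl nothing  x fx = refl
      hits-pl (just v) x fx = 𝟙-==-zero v x (λ v → 𝟙 (Y v)) (cong 𝟙 (proj₂ (Free⇒ x fx)))

      1≤t : ∀ x → Free x ≡ true → 1 ≤ t
      1≤t x fx = ≤-trans (≤-reflexive (cong 𝟙 (sym (proj₁ (Free⇒ x fx))))) (≤-trans (∈⇒≤∑ (λ v → 𝟙 (X v)) (∈-allFin x)) X≤t)

      F₃ : Label → Fin m → ℕ
      F₃ o e = 𝟙 (pl o) * (𝟙 (distinct o (srcᴸ e) (tgtᴸ e) nothing) * Kₗ φ o (srcᴸ e) (tgtᴸ e) nothing)

      -- One end of `e` is still random, so over the placed vertices the sum is at most the
      -- closeness of the other end. The label `nothing` adds at most `G₁`, absorbed by `t * G₁`
      -- because `x` itself lies in `X`.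
      ∑F₃≤ : ∀ x → Free x ≡ true → ∀ e → src e ≡ x ⊎ tgt e ≡ x → (∑[ o ∈ Os ] F₃ o e) ≤ r + t * G₁
      ∑F₃≤ x fx e h = ≤-trans (+-mono-≤ head (≤-trans (≤-reflexive (∑-map just Vs (λ o → F₃ o e))) (tail h)))
                        (≤-reflexive (+-comm (t * G₁) r))
        where
        φs : ∀ {v} → v ≡ x → φ v ≡ nothing
        φs p = trans (cong φ p) (Free⇒nothing x fx)
        G₁≤ : G₁ ≤ t * G₁
        G₁≤ = ≤-trans (≤-reflexive (sym (+-identityʳ G₁))) (*-monoˡ-≤ G₁ (1≤t x fx))
        one : src e ≡ x ⊎ tgt e ≡ x → K nothing (φ (src e)) (φ (tgt e)) nothing ≤ G₁
        one (inj₁ p) = ≤-trans (≤-reflexive (cong (λ z → K nothing z (φ (tgt e)) nothing) (φs p))) (K-one₃ (φ (tgt e)))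
        one (inj₂ p) = ≤-trans (≤-reflexive (cong (λ z → K nothing (φ (src e)) z nothing) (φs p))) (K-one₂ (φ (src e)))
        head : F₃ nothing e ≤ t * G₁
        head = ≤-trans (𝟙* true _) (≤-trans (𝟙* (distinct nothing (srcᴸ e) (tgtᴸ e) nothing) _) (≤-trans (one h) G₁≤))
        tail : src e ≡ x ⊎ tgt e ≡ x → (∑[ w ∈ Vs ] F₃ (just w) e) ≤ r
        tail (inj₁ p) = ≤-trans (∑-mono Vs (λ w → *-monoʳ-≤ (𝟙 (Y w)) (*-mono-≤ (𝟙-mono (distinct-tgt (just w) (srcᴸ e) (tgtᴸ e)))
          (≤-reflexive (trans (cong (λ z → K (φ w) z (φ (tgt e)) nothing) (φs p)) (K-swap₂₃ (φ w) nothing (φ (tgt e)) nothing)))))) (R≤ (tgt e))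
        tail (inj₂ p) = ≤-trans (∑-mono Vs (λ w → *-monoʳ-≤ (𝟙 (Y w)) (*-mono-≤ (𝟙-mono (distinct-src (just w) (srcᴸ e) (tgtᴸ e)))
          (≤-reflexive (cong (λ z → K (φ w) (φ (src e)) z nothing) (φs p)))))) (R≤ (src e))

      load₃ : ∀ x → Free x ≡ true → 4 * (∑[ o ∈ Os ] load x (con₃ o)) ≤ suc β₃
      load₃ x fx = ≤-trans (*-monoʳ-≤ 4 (begin
        ∑[ o ∈ Os ] load x (con₃ o)
          ≡⟨ ∑-cong Os (λ o → ∑-map (τ₃ o) Es _) ⟩
        ∑[ o ∈ Os ] ∑[ e ∈ Es ] 𝟙 (mem x (scope (τ₃ o e))) * (64 * mean (τ₃ o e))
          ≤⟨ ∑-mono Os (λ o → ∑-mono Es (λ e → each o e)) ⟩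
        ∑[ o ∈ Os ] ∑[ e ∈ Es ] 64 * (inc e x * (𝟙 (within X e) * F₃ o e))
          ≡⟨ scale-out ⟩
        64 * (∑[ o ∈ Os ] ∑[ e ∈ Es ] inc e x * (𝟙 (within X e) * F₃ o e))
          ≡⟨ cong (64 *_) (trans (∑-swap Os Es _) (∑-cong Es (λ e → trans (∑-*ˡ Os (inc e x) _) (cong (inc e x *_) (∑-*ˡ Os (𝟙 (within X e)) _))))) ⟩
        64 * (∑[ e ∈ Es ] inc e x * (𝟙 (within X e) * (∑[ o ∈ Os ] F₃ o e)))
          ≤⟨ *-monoʳ-≤ 64 (∑-mono Es (λ e → inc-mono e x (λ h → *-monoʳ-≤ (𝟙 (within X e)) (∑F₃≤ x fx e h)))) ⟩
        64 * (∑[ e ∈ Es ] inc e x * (𝟙 (within X e) * (r + t * G₁)))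
          ≡⟨ cong (64 *_) (trans (∑-cong Es (λ e → sym (*-assoc (inc e x) _ _))) (∑-*ʳ Es (r + t * G₁) _)) ⟩
        64 * (degIn X x * (r + t * G₁))
          ≤⟨ *-monoʳ-≤ 64 (*-monoˡ-≤ (r + t * G₁) (degIn≤ x (proj₁ (Free⇒ x fx)) (proj₂ (Free⇒ x fx)))) ⟩
        64 * (dmax * (r + t * G₁)) ∎)) (≤-trans h₃ (n≤1+n β₃))
        where
        open ≤-Reasoning
        scale-out : (∑[ o ∈ Os ] ∑[ e ∈ Es ] 64 * (inc e x * (𝟙 (within X e) * F₃ o e))) ≡
                    64 * (∑[ o ∈ Os ] ∑[ e ∈ Es ] inc e x * (𝟙 (within X e) * F₃ o e))
        scale-out = trans (∑-cong Os (λ o → ∑-*ˡ Es 64 (λ e → inc e x * (𝟙 (within X e) * F₃ o e))))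
                          (∑-*ˡ Os 64 (λ o → ∑[ e ∈ Es ] inc e x * (𝟙 (within X e) * F₃ o e)))
        each : ∀ o e → 𝟙 (mem x (scope (τ₃ o e))) * (64 * mean (τ₃ o e)) ≤ 64 * (inc e x * (𝟙 (within X e) * F₃ o e))
        each o e = ≤-trans (*-monoˡ-≤ (64 * mean (τ₃ o e)) (term-hits (new₃ o e) o (srcᴸ e) (tgtᴸ e) nothing x))
          (≤-trans (≤-reflexive (trans (lemma (hits o x) (𝟙 (src e == x)) (𝟙 (tgt e == x)) d p q s k)
             (cong (λ z → z * (64 * (d * (q * s * k))) + 64 * (s * (inc e x * (q * (p * (d * k)))))) (hits-pl o x fx))))
            (*-monoʳ-≤ 64 (≤-trans (*-monoˡ-≤ _ (𝟙≤1 (not (within Y e)))) (≤-reflexive (+-identityʳ _)))))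
          where
          d = 𝟙 (distinct o (srcᴸ e) (tgtᴸ e) nothing)
          p = 𝟙 (pl o)
          q = 𝟙 (within X e)
          s = 𝟙 (not (within Y e))
          k = Kₗ φ o (srcᴸ e) (tgtᴸ e) nothing
          lemma : ∀ h a b d p q s k → (h + (a + (b + 0))) * (64 * (d * (p * (q * s) * k))) ≡
                  (h * p) * (64 * (d * (q * s * k))) + 64 * (s * ((a + b) * (q * (p * (d * k)))))
          lemma = solve-∀

      -- The cost once all of `X` is placed, expressed through `X` because the coefficient of a term
      -- cannot refer to the random placement.
      cost′ : Fin m → ℕ
      cost′ e = if within X e then 1 else 64

      new₄ : Fin n → Fin m → ℕ
      new₄ w e = 𝟙 (Free w) * cost′ e

      τ₄ : Fin n → Fin m → Term
      τ₄ w e = term (new₄ w e) (just w) (srcᴸ e) (tgtᴸ e) nothing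

      cost′≤ : ∀ e → cost′ e ≤ cost φ e
      cost′≤ e = weight-anti (λ h → within-mono h)
        where
        within-mono : within Y e ≡ true → within X e ≡ true
        within-mono h = cong₂ _∧_ (Y⊆X _ (proj₁ (∧-true (Y (src e)) h))) (Y⊆X _ (proj₂ (∧-true (Y (src e)) h)))

      M₄ : Fin m → ℕ
      M₄ e = 𝟙 (distinct nothing (srcᴸ e) (tgtᴸ e) nothing) * (cost φ e * Kₗ φ nothing (srcᴸ e) (tgtᴸ e) nothing)

      mean₄≤ : ∀ w e → mean (τ₄ w e) ≤ 𝟙 (Free w) * M₄ e
      mean₄≤ w e = ≤-trans (≤-reflexive (lemma d (𝟙 (Free w)) (cost′ e) (Kₗ φ (just w) (srcᴸ e) (tgtᴸ e) nothing)))
          (𝟙-mono-cases (Free w) (λ fw → *-mono-≤ (𝟙-mono (distinct-forget (just w) (srcᴸ e) (tgtᴸ e))) (*-mono-≤ (cost′≤ e)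
             (≤-reflexive (cong (λ z → K z (φ (src e)) (φ (tgt e)) nothing) (Free⇒nothing w fw))))))
        where
        d = 𝟙 (distinct (just w) (srcᴸ e) (tgtᴸ e) nothing)
        lemma : ∀ d f c k → d * (f * c * k) ≡ f * (d * (c * k))
        lemma = solve-∀

      ∑mean₄≤ : ∀ w → (∑[ e ∈ Es ] mean (τ₄ w e)) ≤ j⋆
      ∑mean₄≤ w = ≤-trans (∑-mono Es (λ e → ≤-trans (mean₄≤ w e) (𝟙* (Free w) _))) J⋆≤

      -- A free vertex is still a random point, so its potential has mean at most `j⋆`; this
      -- constraint turns the mean into the hard bound `β₄` at its new position.
      con₄ : Fin n → Constraint
      con₄ w = record
        { terms = map (τ₄ w) Es ; bound = suc β₄ ; least = suc β₄ ; weight = N⁴ * (suc β₂ * suc β₃)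
        ; scale = lemma N⁴ (suc β₂) (suc β₃) (suc β₄) ; least≤ = ≤-refl
        ; room = ≤-trans (≤-reflexive (trans (∑-map (τ₄ w) Es _) (∑-*ˡ Es 64 _)))
            (≤-trans (*-monoʳ-≤ 64 (∑mean₄≤ w)) (≤-trans (slack j⋆ _) (≤-trans h₄ (n≤1+n β₄)))) }
        where
        lemma : ∀ a b c d → a * (b * c) * d ≡ a * (b * (c * d))
        lemma = solve-∀
        slack : ∀ a b → 64 * a ≤ 4 * (64 * (a + b))
        slack a b = ≤-trans (*-monoʳ-≤ 64 (m≤m+n a b)) (m≤n*m (64 * (a + b)) 4)

      -- Either `x` is the vertex whose potential is bounded, which accounts for `j⋆`, or it is an
      -- end of one of at most `Δ` edges in the potential of one of at most `t` vertices; such an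
      -- edge costs at most 64 and, having a random end, has `K` at most `G₁`.
      load₄ : ∀ x → Free x ≡ true → 4 * (∑[ w ∈ Vs ] load x (con₄ w)) ≤ suc β₄
      load₄ x fx = ≤-trans (*-monoʳ-≤ 4 (begin
        ∑[ w ∈ Vs ] load x (con₄ w)
          ≡⟨ ∑-cong Vs (λ w → ∑-map (τ₄ w) Es _) ⟩
        ∑[ w ∈ Vs ] ∑[ e ∈ Es ] 𝟙 (mem x (scope (τ₄ w e))) * (64 * mean (τ₄ w e))
          ≤⟨ ∑-mono Vs (λ w → ∑-mono Es (λ e → each w e)) ⟩
        ∑[ w ∈ Vs ] ∑[ e ∈ Es ] 64 * (𝟙 (w == x) * mean (τ₄ w e) + inc e x * mean (τ₄ w e))
          ≡⟨ trans (∑-cong Vs (λ w → ∑-*ˡ Es 64 _)) (∑-*ˡ Vs 64 _) ⟩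
        64 * (∑[ w ∈ Vs ] ∑[ e ∈ Es ] 𝟙 (w == x) * mean (τ₄ w e) + inc e x * mean (τ₄ w e))
          ≡⟨ cong (64 *_) (trans (∑-cong Vs (λ w → trans (∑-+ Es _ _) (cong (_+ (∑[ e ∈ Es ] inc e x * mean (τ₄ w e))) (∑-*ˡ Es (𝟙 (w == x)) _)))) (∑-+ Vs _ _)) ⟩
        64 * ((∑[ w ∈ Vs ] 𝟙 (w == x) * (∑[ e ∈ Es ] mean (τ₄ w e))) + (∑[ w ∈ Vs ] ∑[ e ∈ Es ] inc e x * mean (τ₄ w e)))
          ≤⟨ *-monoʳ-≤ 64 (+-mono-≤ (≤-trans (≤-reflexive (∑-δ n x (λ w → ∑[ e ∈ Es ] mean (τ₄ w e)))) (∑mean₄≤ x)) second) ⟩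
        64 * (j⋆ + 64 * (t * (Δ * G₁))) ∎)) (≤-trans h₄ (n≤1+n β₄))
        where
        open ≤-Reasoning
        each : ∀ w e → 𝟙 (mem x (scope (τ₄ w e))) * (64 * mean (τ₄ w e)) ≤ 64 * (𝟙 (w == x) * mean (τ₄ w e) + inc e x * mean (τ₄ w e))
        each w e = ≤-trans (*-monoˡ-≤ (64 * mean (τ₄ w e)) (term-hits (new₄ w e) (just w) (srcᴸ e) (tgtᴸ e) nothing x))
          (≤-reflexive (lemma (𝟙 (w == x)) (𝟙 (src e == x)) (𝟙 (tgt e == x)) (mean (τ₄ w e))))
          where
          lemma : ∀ h a b k → (h + (a + (b + 0))) * (64 * k) ≡ 64 * (h * k + (a + b) * k)
          lemma = solve-∀
        M₄≤ : ∀ e → src e ≡ x ⊎ tgt e ≡ x → M₄ e ≤ 64 * G₁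
        M₄≤ e h = ≤-trans (𝟙* (distinct nothing (srcᴸ e) (tgtᴸ e) nothing) _) (*-mono-≤ (cost≤64 φ e) (one h))
          where
          φs : ∀ {v} → v ≡ x → φ v ≡ nothing
          φs p = trans (cong φ p) (Free⇒nothing x fx)
          one : src e ≡ x ⊎ tgt e ≡ x → K nothing (φ (src e)) (φ (tgt e)) nothing ≤ G₁
          one (inj₁ p) = ≤-trans (≤-reflexive (cong (λ z → K nothing z (φ (tgt e)) nothing) (φs p))) (K-one₃ (φ (tgt e)))
          one (inj₂ p) = ≤-trans (≤-reflexive (cong (λ z → K nothing (φ (src e)) z nothing) (φs p))) (K-one₂ (φ (src e)))
        second : (∑[ w ∈ Vs ] ∑[ e ∈ Es ] inc e x * mean (τ₄ w e)) ≤ 64 * (t * (Δ * G₁))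
        second = begin
          ∑[ w ∈ Vs ] ∑[ e ∈ Es ] inc e x * mean (τ₄ w e)
            ≤⟨ ∑-mono Vs (λ w → ∑-mono Es (λ e → inc-mono e x (λ h →
                 ≤-trans (mean₄≤ w e) (*-mono-≤ (𝟙-mono (λ fw → proj₁ (Free⇒ w fw))) (M₄≤ e h))))) ⟩
          ∑[ w ∈ Vs ] ∑[ e ∈ Es ] inc e x * (𝟙 (X w) * (64 * G₁))
            ≡⟨ ∑-cong Vs (λ w → ∑-*ʳ Es _ _) ⟩
          ∑[ w ∈ Vs ] deg x * (𝟙 (X w) * (64 * G₁))
            ≡⟨ ∑-*ˡ Vs (deg x) _ ⟩
          deg x * (∑[ w ∈ Vs ] 𝟙 (X w) * (64 * G₁))
            ≤⟨ *-mono-≤ (deg≤ x (proj₁ (Free⇒ x fx)) (proj₂ (Free⇒ x fx))) (∑X≤ (64 * G₁)) ⟩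
          Δ * (t * (64 * G₁))
            ≡⟨ lemma Δ t G₁ ⟩
          64 * (t * (Δ * G₁)) ∎
          where
          lemma : ∀ a b c → a * (b * (64 * c)) ≡ 64 * (b * (a * c))
          lemma = solve-∀

      fam₁ fam₂ fam₃ fam₄ system : List Constraint
      fam₁ = concatMap (λ g → map (con₁ g) Es) Es
      fam₂ = map con₂ Vs
      fam₃ = map con₃ Os
      fam₄ = map con₄ Vs
      system = fam₁ ++ (fam₂ ++ (fam₃ ++ fam₄))

      sparse : Sparse system
      sparse x fx = *-cancelˡ-≤ 4 (begin
        4 * ∑ system L
          ≡⟨ cong (4 *_) (trans (∑-++ fam₁ _ L) (cong (∑ fam₁ L +_) (trans (∑-++ fam₂ _ L) (cong (∑ fam₂ L +_) (∑-++ fam₃ fam₄ L))))) ⟩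
        4 * (∑ fam₁ L + (∑ fam₂ L + (∑ fam₃ L + ∑ fam₄ L)))
          ≡⟨ lemma (∑ fam₁ L) (∑ fam₂ L) (∑ fam₃ L) (∑ fam₄ L) ⟩
        4 * ∑ fam₁ L + 4 * ∑ fam₂ L + 4 * ∑ fam₃ L + 4 * ∑ fam₄ L
          ≤⟨ +-mono-≤ (+-mono-≤ (+-mono-≤ part₁
               (part Vs con₂ _ (suc β₂) (lemma₂ N⁴ (suc β₂) (suc β₃) (suc β₄)) (λ _ → refl) (load₂ x)))
               (part Os con₃ _ (suc β₃) (lemma₃ N⁴ (suc β₂) (suc β₃) (suc β₄)) (λ _ → refl) (load₃ x fx)))
               (part Vs con₄ _ (suc β₄) (lemma₄ N⁴ (suc β₂) (suc β₃) (suc β₄)) (λ _ → refl) (load₄ x fx)) ⟩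
        U + U + U + U
          ≡⟨ lemma₅ U ⟩
        4 * U ∎)
        where
        open ≤-Reasoning
        L : Constraint → ℕ
        L c = weight c * load x c
        lemma : ∀ a b c d → 4 * (a + (b + (c + d))) ≡ 4 * a + 4 * b + 4 * c + 4 * d
        lemma = solve-∀
        lemma₂ : ∀ a b c d → a * (c * d) * b ≡ a * (b * (c * d))
        lemma₂ = solve-∀
        lemma₃ : ∀ a b c d → a * (b * d) * c ≡ a * (b * (c * d))
        lemma₃ = solve-∀
        lemma₄ : ∀ a b c d → a * (b * c) * d ≡ a * (b * (c * d))
        lemma₄ = solve-∀
        lemma₅ : ∀ u → u + u + u + u ≡ 4 * u
        lemma₅ = solve-∀
        swap4 : ∀ w a → 4 * (w * a) ≡ w * (4 * a)
        swap4 = solve-∀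
        part : ∀ {A : Set} (xs : List A) (con : A → Constraint) w b → w * b ≡ U → (∀ i → weight (con i) ≡ w) →
               4 * (∑[ i ∈ xs ] load x (con i)) ≤ b → 4 * ∑ (map con xs) L ≤ U
        part xs con w b wb≡ w≡ h = begin
          4 * ∑ (map con xs) L ≡⟨ cong (4 *_) (trans (∑-map con xs L) (trans (∑-cong xs (λ i → cong (_* load x (con i)) (w≡ i))) (∑-*ˡ xs w _))) ⟩
          4 * (w * (∑[ i ∈ xs ] load x (con i))) ≡⟨ swap4 w _ ⟩
          w * (4 * (∑[ i ∈ xs ] load x (con i))) ≤⟨ *-monoʳ-≤ w h ⟩
          w * b ≡⟨ wb≡ ⟩
          U ∎
        part₁ : 4 * ∑ fam₁ L ≤ U
        part₁ = begin
          4 * ∑ fam₁ L ≡⟨ cong (4 *_) (trans (∑-concatMap _ Es L) (trans (∑-cong Es (λ g → trans (∑-map (con₁ g) Es L) (∑-*ˡ Es w₁ _))) (∑-*ˡ Es w₁ _))) ⟩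
          4 * (w₁ * A) ≡⟨ swap4 w₁ A ⟩
          w₁ * (4 * A) ≤⟨ *-monoʳ-≤ w₁ (load₁ x fx) ⟩
          w₁ * N⁴ ≡⟨ *-comm w₁ N⁴ ⟩
          U ∎
          where
          w₁ = suc β₂ * (suc β₃ * suc β₄)
          A = ∑[ g ∈ Es ] ∑[ e ∈ Es ] load x (con₁ g e)

    module Outcome (f⋆ : Vec P n) (good : ∀ c → c ∈ system → (∑[ τ ∈ terms c ] val τ f⋆) < bound c) where

      ψ : Fin n → Maybe P
      ψ = ext f⋆

      placed-ψ : ∀ v → placed ψ v ≡ X v
      placed-ψ v = is-just-choose (φ v) (X v) (lookup f⋆ v) (Y⊆X v)

      private
        keep : ∀ v → Y v ≡ true → ψ v ≡ φ v
        keep v = choose-placed (φ v) (X v) (lookup f⋆ v)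

        outside : ∀ v → X v ≡ false → (φ v ≡ nothing) × (ψ v ≡ nothing)
        outside v h = go (X v) h (Y⊆X v)
          where
          go : ∀ b → b ≡ false → (Y v ≡ true → b ≡ true) → (φ v ≡ nothing) × (choose (φ v) b (lookup f⋆ v) ≡ nothing)
          go false refl g = choose-outside (φ v) (lookup f⋆ v) g

        ok₁ : ∀ g e → val (τ₁ g e) f⋆ + 0 < N⁴
        ok₁ g e = good (con₁ g e) (∈-++⁺ˡ (∈-concatMap (λ g → map (con₁ g) Es) (∈-allFin g) (∈-map⁺ (con₁ g) (∈-allFin e))))

        ok₂ : ∀ w → (∑[ u ∈ Vs ] val (τ₂ w u) f⋆) ≤ β₂
        ok₂ w = ≤-pred (subst (_< suc β₂) (∑-map (τ₂ w) Vs _)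
          (good (con₂ w) (∈-++⁺ʳ fam₁ (∈-++⁺ˡ (∈-map⁺ con₂ (∈-allFin w))))))

        ok₃ : ∀ o → o ∈ Os → (∑[ e ∈ Es ] val (τ₃ o e) f⋆) ≤ 64 * (∑[ e ∈ Es ] mean (τ₃ o e)) + β₃
        ok₃ o o∈ = ≤-pred (subst (_≤ suc (64 * (∑[ e ∈ Es ] mean (τ₃ o e)) + β₃)) (cong suc (∑-map (τ₃ o) Es _))
          (≤-trans (good (con₃ o) (∈-++⁺ʳ fam₁ (∈-++⁺ʳ fam₂ (∈-++⁺ˡ (∈-map⁺ con₃ o∈)))))
                   (≤-reflexive (+-suc _ β₃))))

        ok₄ : ∀ w → (∑[ e ∈ Es ] val (τ₄ w e) f⋆) ≤ β₄
        ok₄ w = ≤-pred (subst (_< suc β₄) (∑-map (τ₄ w) Es _)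
          (good (con₄ w) (∈-++⁺ʳ fam₁ (∈-++⁺ʳ fam₂ (∈-++⁺ʳ fam₃ (∈-map⁺ con₄ (∈-allFin w)))))))

        within-ψ : ∀ e → within (placed ψ) e ≡ within X e
        within-ψ e = cong₂ _∧_ (placed-ψ (src e)) (placed-ψ (tgt e))

      valid-ψ : Valid ψ
      valid-ψ g e hg he hd = K-all-placed (ψ (src g)) (ψ (tgt g)) (ψ (src e)) (ψ (tgt e))
          (proj₁ (∧-true _ hg)) (proj₂ (∧-true (placed ψ (src g)) hg)) (proj₁ (∧-true _ he)) (proj₂ (∧-true (placed ψ (src e)) he))
          (≤-<-trans (≤-reflexive (sym (trans (+-identityʳ _) one))) (ok₁ g e))
        where
        one : val (τ₁ g e) f⋆ ≡ Kₗ ψ (srcᴸ g) (tgtᴸ g) (srcᴸ e) (tgtᴸ e)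
        one = trans (cong₂ _*_ (cong 𝟙 hd) (cong (_* Kₗ ψ (srcᴸ g) (tgtᴸ g) (srcᴸ e) (tgtᴸ e))
                (cong₂ (λ a b → 𝟙 a * 𝟙 b) (trans (sym (within-ψ g)) hg) (trans (sym (within-ψ e)) he))))
                (lemma (Kₗ ψ (srcᴸ g) (tgtᴸ g) (srcᴸ e) (tgtᴸ e)))
          where
          lemma : ∀ a → 1 * (1 * 1 * a) ≡ a
          lemma = solve-∀

      private
        tG₁≤β₂ : t * G₁ ≤ β₂
        tG₁≤β₂ = ≤-trans (m≤n*m (t * G₁) 512) (≤-trans (≤-reflexive (lemma (t * G₁))) h₂)
          where
          lemma : ∀ a → 512 * a ≡ 4 * (64 * (2 * a))
          lemma = solve-∀
        not-both : ∀ w u → φ w ≡ nothing ⊎ φ u ≡ nothing → not (Y w ∧ Y u) ≡ true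
        not-both w u = not-both-just (φ w) (φ u)

        close-step : ∀ w → X w ≡ true → ∀ u →
          𝟙 (placed ψ u) * (𝟙 (distinct (just u) (just w) nothing nothing) * Kₗ ψ (just u) (just w) nothing nothing) ≤
          𝟙 (Y u) * (𝟙 (distinct (just u) (just w) nothing nothing) * Kₗ φ (just u) (just w) nothing nothing) + val (τ₂ w u) f⋆
        close-step w hw u = go (status w) (status u)
          where
          open ≤-Reasoning
          d = 𝟙 (distinct (just u) (just w) nothing nothing)
          d′ = 𝟙 (distinct (just w) (just u) nothing nothing)
          fresh : φ w ≡ nothing ⊎ φ u ≡ nothing → 𝟙 (placed ψ u) * (d * Kₗ ψ (just u) (just w) nothing nothing) ≤ val (τ₂ w u) f⋆
          fresh h = begin
            𝟙 (placed ψ u) * (d * K (ψ u) (ψ w) nothing nothing)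
              ≤⟨ *-mono-≤ (≤-reflexive (cong 𝟙 (placed-ψ u))) (*-mono-≤ (𝟙-mono (distinct-swap₁₂ (just u) (just w) nothing nothing))
                   (≤-reflexive (K-swap₁₂ (ψ u) (ψ w) nothing nothing))) ⟩
            𝟙 (X u) * (d′ * K (ψ w) (ψ u) nothing nothing)
              ≡⟨ lemma (𝟙 (X u)) d′ _ ⟩
            d′ * (1 * (𝟙 (X u) * 1) * K (ψ w) (ψ u) nothing nothing)
              ≡⟨ cong (λ z → d′ * (z * K (ψ w) (ψ u) nothing nothing))
                   (cong₂ (λ a b → 𝟙 a * (𝟙 (X u) * 𝟙 b)) (sym hw) (sym (not-both w u h))) ⟩
            val (τ₂ w u) f⋆ ∎
            where
            lemma : ∀ a b c → a * (b * c) ≡ b * (1 * (a * 1) * c)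
            lemma = solve-∀
          go : φ w ≡ nothing ⊎ Y w ≡ true → φ u ≡ nothing ⊎ Y u ≡ true →
               𝟙 (placed ψ u) * (d * K (ψ u) (ψ w) nothing nothing) ≤ 𝟙 (Y u) * (d * K (φ u) (φ w) nothing nothing) + val (τ₂ w u) f⋆
          go (inj₁ h) _ = ≤-trans (fresh (inj₁ h)) (m≤n+m _ _)
          go _ (inj₁ h) = ≤-trans (fresh (inj₂ h)) (m≤n+m _ _)
          go (inj₂ hw) (inj₂ hu) = ≤-trans (≤-reflexive (cong₂ _*_ (cong 𝟙 (trans (placed-ψ u) (trans (Y⊆X u hu) (sym hu))))
              (cong (d *_) (cong₂ (λ a b → K a b nothing nothing) (keep u hu) (keep w hw))))) (m≤m+n _ _)

      closeness-ψ : ∀ w → closeness ψ w ≤ r + β₂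
      closeness-ψ w = go (X w) refl
        where
        go : ∀ b → X w ≡ b → closeness ψ w ≤ r + β₂
        go true  h = ≤-trans (∑-mono Vs (close-step w h)) (≤-trans (≤-reflexive (∑-+ Vs _ _)) (+-mono-≤ (R≤ w) (ok₂ w)))
        -- Outside `X` the vertex `w` remains random, so each of the at most `t` placed vertices
        -- contributes at most `G₁`.
        go false h = ≤-trans (∑-mono Vs (λ u → *-mono-≤ (≤-reflexive (cong 𝟙 (placed-ψ u)))
            (≤-trans (𝟙* (distinct (just u) (just w) nothing nothing) _)
              (≤-trans (≤-reflexive (cong (λ z → K (ψ u) z nothing nothing) (proj₂ (outside w h)))) (K-one₁ (ψ u))))))
          (≤-trans (∑X≤ G₁) (≤-trans tG₁≤β₂ (m≤n+m β₂ r)))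

      private
        ψ-pl : ∀ o → pl o ≡ true → at ψ o ≡ at φ o
        ψ-pl nothing  h = refl
        ψ-pl (just w) h = keep w h

        -- The contribution to the potential of `o`, before the cost 64, of an edge whose one end
        -- `x` is newly placed while the other end remains random.
        Z : Label → Fin n → ℕ
        Z o x = 𝟙 (Free x) * (𝟙 (distinct o (just x) nothing nothing) * Kₗ ψ o (just x) nothing nothing)

        ifw : Bool → ℕ
        ifw b = if b then 1 else 64

        -- The accounting of costs. An edge completed now drops from 64 to 1 and frees exactly 64
        -- times its mean; an edge from a newly placed vertex to a vertex outside `X` keeps cost 64
        -- and is charged to `Z`; every other edge contributes what it did before.
        edge-step : ∀ o → pl o ≡ true → ∀ e →
          𝟙 (distinct o (srcᴸ e) (tgtᴸ e) nothing) * (cost ψ e * Kₗ ψ o (srcᴸ e) (tgtᴸ e) nothing) + 64 * mean (τ₃ o e) ≤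
          (𝟙 (distinct o (srcᴸ e) (tgtᴸ e) nothing) * (cost φ e * Kₗ φ o (srcᴸ e) (tgtᴸ e) nothing) + val (τ₃ o e) f⋆) + 64 * (Z o (src e) + Z o (tgt e))
        edge-step o ho e = go (within X e) (within Y e) refl refl
          where
          open ≤-Reasoning
          u = src e
          v = tgt e
          d = 𝟙 (distinct o (srcᴸ e) (tgtᴸ e) nothing)
          kψ = Kₗ ψ o (srcᴸ e) (tgtᴸ e) nothing
          kφ = Kₗ φ o (srcᴸ e) (tgtᴸ e) nothing
          LHS = d * (cost ψ e * kψ) + 64 * mean (τ₃ o e)
          RHS = (d * (cost φ e * kφ) + val (τ₃ o e) f⋆) + 64 * (Z o u + Z o v)
          costψ : ∀ {b} → within X e ≡ b → cost ψ e ≡ ifw b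
          costψ h = cong ifw (trans (within-ψ e) h)
          mean≡ : ∀ {a b} → within X e ≡ a → within Y e ≡ b → mean (τ₃ o e) ≡ d * (1 * (𝟙 a * 𝟙 (not b)) * kφ)
          mean≡ ha hb = cong₂ (λ x y → d * (x * y * kφ)) (cong 𝟙 ho) (cong₂ (λ a b → 𝟙 a * 𝟙 (not b)) ha hb)
          val≡ : ∀ {a b} → within X e ≡ a → within Y e ≡ b → val (τ₃ o e) f⋆ ≡ d * (1 * (𝟙 a * 𝟙 (not b)) * kψ)
          val≡ ha hb = cong₂ (λ x y → d * (x * y * kψ)) (cong 𝟙 ho) (cong₂ (λ a b → 𝟙 a * 𝟙 (not b)) ha hb)
          stay : d * (cost ψ e * kψ) ≡ d * (cost φ e * kφ) → 64 * mean (τ₃ o e) ≡ 0 → LHS ≤ RHS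
          stay p q = ≤-trans (≤-reflexive (trans (cong₂ _+_ p q) (+-identityʳ _))) (≤-trans (m≤m+n _ _) (m≤m+n _ _))
          mean0 : within X e ≡ false ⊎ within Y e ≡ true → 64 * mean (τ₃ o e) ≡ 0
          mean0 (inj₁ h) = cong (64 *_) (trans (mean≡ h refl) (*-zeroʳ d))
          mean0 (inj₂ h) = cong (64 *_) (trans (mean≡ refl h) (lemma d (𝟙 (within X e)) kφ))
            where
            lemma : ∀ d a k → d * (1 * (a * 0) * k) ≡ 0
            lemma = solve-∀
          costφ-out : within X e ≡ false → cost φ e ≡ 64
          costφ-out h = cong ifw (go′ (within Y e) refl)
            where
            go′ : ∀ b → within Y e ≡ b → b ≡ false
            go′ false _ = refl
            go′ true hy = trans (sym (cong₂ _∧_ (Y⊆X u (proj₁ (∧-true (Y u) hy))) (Y⊆X v (proj₂ (∧-true (Y u) hy))))) h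
          half : ∀ x → (D : 𝟙 (distinct o (srcᴸ e) (tgtᴸ e) nothing) ≤ 𝟙 (distinct o (just x) nothing nothing)) →
                 within X e ≡ false → kψ ≡ Kₗ ψ o (just x) nothing nothing → kφ ≡ Kₗ φ o (just x) nothing nothing →
                 Z o x ≤ Z o u + Z o v → LHS ≤ RHS
          half x D hX kψ≡ kφ≡ Z≤ = pick (Free x) refl (ψ-or x)
            where
            ψ-or : ∀ x → Free x ≡ true ⊎ ψ x ≡ φ x
            ψ-or x = go′ (X x) (Free x) refl refl
              where
              go′ : ∀ a b → X x ≡ a → Free x ≡ b → Free x ≡ true ⊎ ψ x ≡ φ x
              go′ _     true  _ h = inj₁ h
              go′ true  false a h = inj₂ (keep x (¬Free⇒ x h a))
              go′ false false a h = inj₂ (trans (proj₂ (outside x a)) (sym (proj₁ (outside x a))))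
            pick : ∀ b → Free x ≡ b → Free x ≡ true ⊎ ψ x ≡ φ x → LHS ≤ RHS
            pick _ _ (inj₂ same) = stay (cong (d *_) (cong₂ _*_ (trans (costψ hX) (sym (costφ-out hX)))
                (trans kψ≡ (trans (cong₂ (λ a b → K a b nothing nothing) (ψ-pl o ho) same) (sym kφ≡))))) (mean0 (inj₁ hX))
            pick _ _ (inj₁ fx) = begin
              d * (cost ψ e * kψ) + 64 * mean (τ₃ o e)
                ≡⟨ trans (cong₂ _+_ (cong (λ z → d * (z * kψ)) (costψ hX)) (mean0 (inj₁ hX))) (+-identityʳ _) ⟩
              d * (64 * kψ)
                ≤⟨ *-mono-≤ D (≤-reflexive (cong (64 *_) kψ≡)) ⟩
              𝟙 (distinct o (just x) nothing nothing) * (64 * Kₗ ψ o (just x) nothing nothing)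
                ≡⟨ lemma (𝟙 (distinct o (just x) nothing nothing)) (Kₗ ψ o (just x) nothing nothing) ⟩
              64 * (1 * (𝟙 (distinct o (just x) nothing nothing) * Kₗ ψ o (just x) nothing nothing))
                ≡⟨ cong (λ z → 64 * (𝟙 z * (𝟙 (distinct o (just x) nothing nothing) * Kₗ ψ o (just x) nothing nothing))) (sym fx) ⟩
              64 * Z o x
                ≤⟨ *-monoʳ-≤ 64 Z≤ ⟩
              64 * (Z o u + Z o v)
                ≤⟨ m≤n+m _ (d * (cost φ e * kφ) + val (τ₃ o e) f⋆) ⟩
              RHS ∎
              where
              lemma : ∀ a b → a * (64 * b) ≡ 64 * (1 * (a * b))
              lemma = solve-∀
          go : ∀ a b → within X e ≡ a → within Y e ≡ b → LHS ≤ RHS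
          go _ true _ hY = stay (cong (d *_) (cong₂ _*_
              (trans (costψ (cong₂ _∧_ (Y⊆X u (proj₁ (∧-true (Y u) hY))) (Y⊆X v (proj₂ (∧-true (Y u) hY))))) (cong ifw (sym hY)))
              (cong₃ (ψ-pl o ho) (keep u (proj₁ (∧-true (Y u) hY))) (keep v (proj₂ (∧-true (Y u) hY)))))) (mean0 (inj₂ hY))
            where
            cong₃ : ∀ {x x′ y y′ z z′} → x ≡ x′ → y ≡ y′ → z ≡ z′ → K x y z nothing ≡ K x′ y′ z′ nothing
            cong₃ refl refl refl = refl
          go true false hX hY = ≤-trans (≤-reflexive (begin-equality
              d * (cost ψ e * kψ) + 64 * mean (τ₃ o e)
                ≡⟨ cong₂ (λ a b → d * (a * kψ) + 64 * b) (costψ hX) (mean≡ hX hY) ⟩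
              d * (1 * kψ) + 64 * (d * (1 * (1 * 1) * kφ))
                ≡⟨ lemma d kψ kφ ⟩
              d * (64 * kφ) + d * (1 * (1 * 1) * kψ)
                ≡⟨ cong₂ (λ a b → d * (a * kφ) + b) cost≡ (sym (val≡ hX hY)) ⟩
              d * (cost φ e * kφ) + val (τ₃ o e) f⋆ ∎)) (m≤m+n _ _)
            where
            cost≡ : 64 ≡ cost φ e
            cost≡ = cong ifw (sym hY)
            lemma : ∀ d a b → d * (1 * a) + 64 * (d * (1 * (1 * 1) * b)) ≡ d * (64 * b) + d * (1 * (1 * 1) * a)
            lemma = solve-∀
          go false false hX hY = ends (X u) (X v) refl refl
            where
            ends : ∀ a b → X u ≡ a → X v ≡ b → LHS ≤ RHS
            ends true true a b = true≢false (trans (sym (cong₂ _∧_ a b)) hX)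
            ends false _ a _ = half v (𝟙-mono (distinct-tgt o (srcᴸ e) (tgtᴸ e))) hX
              (trans (cong (λ z → K (at ψ o) z (ψ v) nothing) (proj₂ (outside u a))) (K-swap₂₃ (at ψ o) nothing (ψ v) nothing))
              (trans (cong (λ z → K (at φ o) z (φ v) nothing) (proj₁ (outside u a))) (K-swap₂₃ (at φ o) nothing (φ v) nothing))
              (m≤n+m _ _)
            ends true false _ b = half u (𝟙-mono (distinct-src o (srcᴸ e) (tgtᴸ e))) hX
              (cong (λ z → K (at ψ o) (ψ u) z nothing) (proj₂ (outside v b)))
              (cong (λ z → K (at φ o) (φ u) z nothing) (proj₁ (outside v b)))
              (m≤m+n _ _)

        ∑Z≤ : ∀ o → pl o ≡ true → (∑[ x ∈ Vs ] Z o x) ≤ β₂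
        ∑Z≤ nothing  h = ≤-trans (∑-mono Vs (λ x → *-mono-≤ (𝟙-mono (λ fx → proj₁ (Free⇒ x fx)))
            (≤-trans (𝟙* (distinct nothing (just x) nothing nothing) _) (K-one₂ (ψ x))))) (≤-trans (∑X≤ G₁) tG₁≤β₂)
        ∑Z≤ (just w) h = ≤-trans (∑-mono Vs (λ x → 𝟙-cases (Free x) _ (λ fx → ≤-reflexive (one x fx)))) (ok₂ w)
          where
          lemma : ∀ a b → a * b ≡ a * (1 * (1 * 1) * b)
          lemma = solve-∀
          one : ∀ x → Free x ≡ true → 𝟙 (distinct (just w) (just x) nothing nothing) * Kₗ ψ (just w) (just x) nothing nothing ≡ val (τ₂ w x) f⋆
          one x fx = trans (lemma (𝟙 (distinct (just w) (just x) nothing nothing)) (Kₗ ψ (just w) (just x) nothing nothing))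
            (cong (λ z → 𝟙 (distinct (just w) (just x) nothing nothing) * (z * Kₗ ψ (just w) (just x) nothing nothing))
              (cong₂ (λ a b → 𝟙 a * b) (sym (Y⊆X w h)) (cong₂ (λ a b → 𝟙 a * 𝟙 b) (sym (proj₁ (Free⇒ x fx)))
                (sym (not-both w x (inj₂ (Free⇒nothing x fx)))))))

        ∑-ends : ∀ (F : Fin n → ℕ) → (∑[ e ∈ Es ] F (src e) + F (tgt e)) ≡ (∑[ x ∈ Vs ] deg x * F x)
        ∑-ends F = trans (∑-cong Es (λ e → sym (trans (∑-cong Vs (λ x → *-distribʳ-+ (F x) (𝟙 (src e == x)) (𝟙 (tgt e == x))))
            (trans (∑-+ Vs _ _) (cong₂ _+_ (pick (src e)) (pick (tgt e)))))))
          (trans (∑-swap Es Vs _) (∑-cong Vs (λ x → ∑-*ʳ Es (F x) _)))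
          where
          pick : ∀ u → (∑[ x ∈ Vs ] 𝟙 (u == x) * F x) ≡ F u
          pick u = trans (∑-cong Vs (λ x → cong (λ b → 𝟙 b * F x) (==-sym u x))) (∑-δ n u F)

        ∑ends≤ : ∀ o → pl o ≡ true → (∑[ e ∈ Es ] Z o (src e) + Z o (tgt e)) ≤ Δ * β₂
        ∑ends≤ o h = begin
          (∑[ e ∈ Es ] Z o (src e) + Z o (tgt e)) ≡⟨ ∑-ends (Z o) ⟩
          (∑[ x ∈ Vs ] deg x * Z o x) ≤⟨ ∑-mono Vs (λ x → each x) ⟩
          (∑[ x ∈ Vs ] Δ * Z o x) ≡⟨ ∑-*ˡ Vs Δ _ ⟩
          Δ * (∑[ x ∈ Vs ] Z o x) ≤⟨ *-monoʳ-≤ Δ (∑Z≤ o h) ⟩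
          Δ * β₂ ∎
          where
          open ≤-Reasoning
          each : ∀ x → deg x * Z o x ≤ Δ * Z o x
          each x = ≤-trans (≤-reflexive (*-left-comm (deg x) (𝟙 (Free x)) _)) (≤-trans (𝟙-mono-cases (Free x) (λ fx →
              *-monoˡ-≤ _ (deg≤ x (proj₁ (Free⇒ x fx)) (proj₂ (Free⇒ x fx))))) (≤-reflexive (*-left-comm (𝟙 (Free x)) Δ _)))

      -- `β₃` pays for the edges completed in this stage. The other part pays for half-placed edges:
      -- each newly placed vertex has at most `Δ` of them, and the second family bounds the sum of
      -- `Z` over these vertices by `β₂`.
      growth : ℕ
      growth = β₃ + 64 * (Δ * β₂)

      private
        potential-step : ∀ o → pl o ≡ true → o ∈ Os → potential ψ o ≤ potential φ o + growth
        potential-step o h o∈ = +-cancelʳ-≤ (64 * M) _ _ (begin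
          potential ψ o + 64 * M
            ≡⟨ trans (cong (potential ψ o +_) (sym (∑-*ˡ Es 64 _))) (sym (∑-+ Es _ _)) ⟩
          (∑[ e ∈ Es ] 𝟙 (distinct o (srcᴸ e) (tgtᴸ e) nothing) * (cost ψ e * Kₗ ψ o (srcᴸ e) (tgtᴸ e) nothing) + 64 * mean (τ₃ o e))
            ≤⟨ ∑-mono Es (edge-step o h) ⟩
          (∑[ e ∈ Es ] (𝟙 (distinct o (srcᴸ e) (tgtᴸ e) nothing) * (cost φ e * Kₗ φ o (srcᴸ e) (tgtᴸ e) nothing) + val (τ₃ o e) f⋆) + 64 * (Z o (src e) + Z o (tgt e)))
            ≡⟨ trans (∑-+ Es _ _) (cong₂ _+_ (∑-+ Es _ _) (∑-*ˡ Es 64 _)) ⟩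
          potential φ o + (∑[ e ∈ Es ] val (τ₃ o e) f⋆) + 64 * (∑[ e ∈ Es ] Z o (src e) + Z o (tgt e))
            ≤⟨ +-mono-≤ (+-monoʳ-≤ (potential φ o) (ok₃ o o∈)) (*-monoʳ-≤ 64 (∑ends≤ o h)) ⟩
          potential φ o + (64 * M + β₃) + 64 * (Δ * β₂)
            ≡⟨ lemma (potential φ o) (64 * M) β₃ (64 * (Δ * β₂)) ⟩
          potential φ o + growth + 64 * M ∎)
          where
          open ≤-Reasoning
          M = ∑[ e ∈ Es ] mean (τ₃ o e)
          lemma : ∀ a b c d → a + (b + c) + d ≡ a + (c + d) + b
          lemma = solve-∀

      potential-ψ-nothing : potential ψ nothing ≤ j⋆ + growth
      potential-ψ-nothing = ≤-trans (potential-step nothing refl (here refl)) (+-monoˡ-≤ growth J⋆≤)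

      -- A vertex placed now gets its bound from the fourth family, one placed earlier only grows,
      -- and one outside `X` is still a random point and has at most the potential of `nothing`.
      potential-ψ : β₄ ≤ j → j⋆ ≤ j → ∀ o → potential ψ o ≤ j + growth
      potential-ψ _ j⋆≤j nothing = ≤-trans potential-ψ-nothing (+-monoˡ-≤ growth j⋆≤j)
      potential-ψ β₄≤j j⋆≤j (just w) = go (X w) (Free w) refl refl
        where
        go : ∀ a b → X w ≡ a → Free w ≡ b → potential ψ (just w) ≤ j + growth
        go true false hX hF = ≤-trans (potential-step (just w) (¬Free⇒ w hF hX) (there (∈-map⁺ just (∈-allFin w))))
          (+-monoˡ-≤ growth (J≤ (just w)))
        go _ true hX hF = ≤-trans (≤-trans (≤-reflexive (∑-cong Es same)) (≤-trans (ok₄ w) β₄≤j)) (m≤m+n j growth)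
          where
          lemma : ∀ a b c → a * (b * c) ≡ a * (1 * b * c)
          lemma = solve-∀
          same : ∀ e → 𝟙 (distinct (just w) (srcᴸ e) (tgtᴸ e) nothing) * (cost ψ e * Kₗ ψ (just w) (srcᴸ e) (tgtᴸ e) nothing) ≡ val (τ₄ w e) f⋆
          same e = trans (lemma (𝟙 (distinct (just w) (srcᴸ e) (tgtᴸ e) nothing)) (cost ψ e) (Kₗ ψ (just w) (srcᴸ e) (tgtᴸ e) nothing))
            (cong (λ z → 𝟙 (distinct (just w) (srcᴸ e) (tgtᴸ e) nothing) * (z * Kₗ ψ (just w) (srcᴸ e) (tgtᴸ e) nothing))
              (cong₂ (λ a b → 𝟙 a * b) (sym hF) (cong ifw (within-ψ e))))
        go false false hX hF = ≤-trans (∑-mono Es (λ e → *-mono-≤ (𝟙-mono (distinct-forget (just w) (srcᴸ e) (tgtᴸ e)))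
            (*-monoʳ-≤ (cost ψ e) (≤-reflexive (cong (λ z → K z (ψ (src e)) (ψ (tgt e)) nothing) (proj₂ (outside w hX)))))))
          (≤-trans potential-ψ-nothing (+-monoˡ-≤ growth j⋆≤j))

    Improved : (Fin n → Maybe P) → Set
    Improved ψ =
      (∀ v → placed ψ v ≡ X v) × Valid ψ × (∀ w → closeness ψ w ≤ r + β₂) ×
      (potential ψ nothing ≤ j⋆ + (β₃ + 64 * (Δ * β₂))) ×
      (β₄ ≤ j → j⋆ ≤ j → ∀ o → potential ψ o ≤ j + (β₃ + 64 * (Δ * β₂)))

    private
      from-solution : Σ (Vec P n) (λ f → ∀ c → c ∈ system → (∑[ τ ∈ terms c ] val τ f) < bound c) →
                      Σ (Fin n → Maybe P) Improved
      from-solution (f , good) = ψ , placed-ψ , valid-ψ , closeness-ψ , potential-ψ-nothing , potential-ψ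
        where open Outcome f good

    abstract
      step : Σ (Fin n → Maybe P) Improved
      step = from-solution (solution system sparse)
 

-- Peeling

So⇒≡ : ∀ {p} → So p → p ≡ true
So⇒≡ {true} _ = refl

∧-trueʳ : ∀ p {q} → p ∧ q ≡ true → q ≡ true
∧-trueʳ true h = h

≤ᵇ-false : ∀ {a b} → (a ≤ᵇ b) ≡ false → b < a
≤ᵇ-false {a} {b} h = ≰⇒> (λ le → true≢false (trans (sym (So⇒≡ (≤⇒≤ᵇ le))) h))

𝟙-≤ᵇ : ∀ a b → 𝟙 (a ≤ᵇ b) * a ≤ b
𝟙-≤ᵇ a b = 𝟙-cases (a ≤ᵇ b) a (λ h → ≤ᵇ⇒≤ a b (subst So (sym h) _))

module Peeling {n m : ℕ} (src tgt : Fin m → Fin n) (D : ℕ) (1≤D : 1 ≤ D)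
  (sparse : ∀ X → (∑[ e ∈ allFin m ] 𝟙 (Incidence.within src tgt X e)) ≤ D * (∑[ v ∈ allFin n ] 𝟙 (X v))) where

  open Incidence src tgt

  -- The 16 makes the vertices of large internal degree at most an eighth of `X l`, so they still
  -- decay geometrically against the doubling of `2 ^ l`.
  X : ℕ → Fin n → Bool
  X zero    v = true
  X (suc l) v = X l v ∧ ((16 * D * 2 ^ l ≤ᵇ deg v) ∨ (16 * D ≤ᵇ degIn (X l) v))

  size : ℕ → ℕ
  size l = ∑[ v ∈ Vs ] 𝟙 (X l v)

  X-⊆ : ∀ l v → X (suc l) v ≡ true → X l v ≡ true
  X-⊆ l v h = proj₁ (∧-true (X l v) h)

  private
    ∨-false : ∀ {p q} → p ∨ q ≡ false → (p ≡ false) × (q ≡ false)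
    ∨-false {false} {false} _ = refl , refl

    ∧-false : ∀ {p q} → p ≡ true → p ∧ q ≡ false → q ≡ false
    ∧-false refl h = h

  layer-deg : ∀ l v → X l v ≡ true → X (suc l) v ≡ false → deg v ≤ 16 * D * 2 ^ l
  layer-deg l v h h′ = <⇒≤ (≤ᵇ-false (proj₁ (∨-false (∧-false h h′))))

  layer-degIn : ∀ l v → X l v ≡ true → X (suc l) v ≡ false → degIn (X l) v ≤ 16 * D
  layer-degIn l v h h′ = <⇒≤ (≤ᵇ-false (proj₂ (∨-false (∧-false h h′))))

  private
    H B : ℕ → ℕ
    H l = ∑[ v ∈ Vs ] 𝟙 (16 * D * 2 ^ l ≤ᵇ deg v)
    B l = ∑[ v ∈ Vs ] 𝟙 (16 * D ≤ᵇ degIn (X l) v)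

    ∑-inc : ∀ (w : Fin m → ℕ) → (∑[ v ∈ Vs ] ∑[ e ∈ Es ] inc e v * w e) ≡ 2 * (∑[ e ∈ Es ] w e)
    ∑-inc w = trans (∑-swap Vs Es (λ v e → inc e v * w e)) (trans (∑-cong Es two) (∑-*ˡ Es 2 w))
      where
      pick : ∀ u c → (∑[ v ∈ Vs ] 𝟙 (u == v) * c) ≡ c
      pick u c = trans (∑-cong Vs (λ x → cong (λ b → 𝟙 b * c) (==-sym u x))) (∑-δ n u (λ _ → c))
      two : ∀ e → (∑[ v ∈ Vs ] inc e v * w e) ≡ 2 * w e
      two e = trans (∑-cong Vs (λ v → *-distribʳ-+ (w e) (𝟙 (src e == v)) (𝟙 (tgt e == v))))
        (trans (∑-+ Vs _ _) (trans (cong₂ _+_ (pick (src e) (w e)) (pick (tgt e) (w e))) (double (w e))))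

    ∑deg : (∑[ v ∈ Vs ] deg v) ≡ 2 * m
    ∑deg = trans (∑-cong Vs (λ v → ∑-cong Es (λ e → sym (*-identityʳ (inc e v)))))
      (trans (∑-inc (λ _ → 1)) (cong (2 *_) (trans (∑-const Es 1) (trans (*-identityʳ _) (length-tabulate {n = m} (λ i → i))))))

    degIn≤deg : ∀ Z v → degIn Z v ≤ deg v
    degIn≤deg Z v = ∑-mono Es (λ e → ≤-trans (*-monoʳ-≤ (inc e v) (𝟙≤1 (within Z e))) (≤-reflexive (*-identityʳ _)))

    -- At level 0 the two thresholds agree and the internal degree is at most the degree. The
    -- recursion can thus start at layer 1 and avoid `size 0`, for which `D * size 0` may exceed the
    -- number of edges.
    size₁≤ : size 1 ≤ H 0
    size₁≤ = ∑-mono Vs (λ v → 𝟙-mono (go v))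
      where
      go : ∀ v → (16 * D * 2 ^ 0 ≤ᵇ deg v) ∨ (16 * D ≤ᵇ degIn (X 0) v) ≡ true → (16 * D * 2 ^ 0 ≤ᵇ deg v) ≡ true
      go v h = pick (16 * D * 2 ^ 0 ≤ᵇ deg v) (16 * D ≤ᵇ degIn (X 0) v) h
        (λ e → So⇒≡ (≤⇒≤ᵇ (≤-trans (≤-reflexive (*-identityʳ (16 * D)))
                   (≤-trans (≤ᵇ⇒≤ (16 * D) (degIn (X 0) v) (subst So (sym e) _)) (degIn≤deg (X 0) v)))))
        where
        pick : ∀ p q → p ∨ q ≡ true → (q ≡ true → p ≡ true) → p ≡ true
        pick true  _    _ _ = refl
        pick false true _ k = k refl

    size≤ : ∀ l → size (suc l) ≤ H l + B l
    size≤ l = ≤-trans (∑-mono Vs (λ v → split (X l v) (16 * D * 2 ^ l ≤ᵇ deg v) (16 * D ≤ᵇ degIn (X l) v))) (≤-reflexive (∑-+ Vs _ _))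
      where
      split : ∀ x p q → 𝟙 (x ∧ (p ∨ q)) ≤ 𝟙 p + 𝟙 q
      split false p q = z≤n
      split true  true  q = s≤s z≤n
      split true  false q = ≤-refl

    8B≤ : ∀ l → 8 * B l ≤ size l
    8B≤ l = *-cancelˡ-≤ (2 * D) ⦃ >-nonZero (*-mono-≤ (s≤s (z≤n {1})) 1≤D) ⦄ (begin
      2 * D * (8 * B l)
        ≡⟨ lemma D (B l) ⟩
      B l * (16 * D)
        ≡⟨ ∑-*ʳ Vs (16 * D) _ ⟨
      (∑[ v ∈ Vs ] 𝟙 (16 * D ≤ᵇ degIn (X l) v) * (16 * D))
        ≤⟨ ∑-mono Vs (λ v → 𝟙-≤ᵇ (16 * D) (degIn (X l) v)) ⟩
      (∑[ v ∈ Vs ] degIn (X l) v)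
        ≡⟨ ∑-inc (λ e → 𝟙 (within (X l) e)) ⟩
      2 * (∑[ e ∈ Es ] 𝟙 (within (X l) e))
        ≤⟨ *-monoʳ-≤ 2 (sparse (X l)) ⟩
      2 * (D * size l)
        ≡⟨ *-assoc 2 D (size l) ⟨
      2 * D * size l ∎)
      where
      open ≤-Reasoning
      lemma : ∀ d b → 2 * d * (8 * b) ≡ b * (16 * d)
      lemma = solve-∀

    A : ℕ → ℕ
    A zero    = 0
    A (suc q) = A q + 2 ^ suc q * H q

    T₁ : ℕ → ℕ
    T₁ zero    = 0
    T₁ (suc q) = T₁ q + 2 ^ suc q * size (suc q)

    pred₁ : ℕ → ℕ
    pred₁ zero    = 0
    pred₁ (suc q) = T₁ q

    -- Four times the weighted count of vertices of large internal degree is, by `8B≤`, at most the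
    -- same weighted sum of sizes one layer earlier, so this part of the recursion is absorbed with
    -- ratio 1/4.
    4T≤ : ∀ q → 4 * T₁ q ≤ 4 * A q + pred₁ q
    4T≤ zero          = z≤n
    4T≤ (suc zero)    = ≤-trans (*-monoʳ-≤ 4 (*-monoʳ-≤ 2 size₁≤)) (m≤m+n _ 0)
    4T≤ (suc (suc q)) = begin
      4 * (T₁ (suc q) + 2 ^ suc (suc q) * size (suc (suc q)))
        ≡⟨ *-distribˡ-+ 4 (T₁ (suc q)) _ ⟩
      4 * T₁ (suc q) + 4 * (2 ^ suc (suc q) * size (suc (suc q)))
        ≤⟨ +-mono-≤ (4T≤ (suc q)) (*-monoʳ-≤ 4 (*-monoʳ-≤ (2 ^ suc (suc q)) (size≤ (suc q)))) ⟩
      4 * A (suc q) + T₁ q + 4 * (2 ^ suc (suc q) * (H (suc q) + B (suc q)))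
        ≡⟨ lemma (A (suc q)) (T₁ q) (2 ^ suc q) (H (suc q)) (B (suc q)) ⟩
      4 * (A (suc q) + 2 ^ suc (suc q) * H (suc q)) + (T₁ q + 2 ^ suc q * (8 * B (suc q)))
        ≤⟨ +-monoʳ-≤ (4 * A (suc (suc q))) (+-monoʳ-≤ (T₁ q) (*-monoʳ-≤ (2 ^ suc q) (8B≤ (suc q)))) ⟩
      4 * A (suc (suc q)) + T₁ (suc q) ∎
      where
      open ≤-Reasoning
      lemma : ∀ a t p h b → 4 * a + t + 4 * (2 * p * (h + b)) ≡ 4 * (a + 2 * p * h) + (t + p * (8 * b))
      lemma = solve-∀

    pred≤ : ∀ q → pred₁ q ≤ T₁ q
    pred≤ zero    = z≤n
    pred≤ (suc q) = m≤m+n _ _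

    geom : ℕ → ℕ → ℕ
    geom d zero    = 0
    geom d (suc q) = geom d q + 2 ^ suc q * 𝟙 (16 * D * 2 ^ q ≤ᵇ d)

    geom≤2^ : ∀ d q → geom d q ≤ 2 * 2 ^ q
    geom≤2^ d zero    = z≤n
    geom≤2^ d (suc q) = ≤-trans (+-mono-≤ (geom≤2^ d q) (≤-trans (*-monoʳ-≤ (2 ^ suc q) (𝟙≤1 (16 * D * 2 ^ q ≤ᵇ d))) (≤-reflexive (*-identityʳ _))))
      (≤-reflexive (lemma (2 ^ q)))
      where
      lemma : ∀ a → 2 * a + 2 * a ≡ 2 * (2 * a)
      lemma = solve-∀

    -- The share of one vertex of degree `d` in `4 * D * A q`: a geometric sum, controlled by the
    -- largest threshold `16 * D * 2 ^ q` that `d` reaches.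
    geom≤ : ∀ d q → 4 * D * geom d q ≤ d
    geom≤ d zero    = ≤-trans (≤-reflexive (*-zeroʳ (4 * D))) z≤n
    geom≤ d (suc q) = go (16 * D * 2 ^ q ≤ᵇ d) refl
      where
      go : ∀ b → (16 * D * 2 ^ q ≤ᵇ d) ≡ b → 4 * D * (geom d q + 2 ^ suc q * 𝟙 b) ≤ d
      go false _ = ≤-trans (≤-reflexive (cong (4 * D *_) (trans (cong (geom d q +_) (*-zeroʳ (2 ^ suc q))) (+-identityʳ _)))) (geom≤ d q)
      go true  h = ≤-trans (*-monoʳ-≤ (4 * D) (+-monoˡ-≤ _ (geom≤2^ d q)))
        (≤-trans (≤-reflexive (lemma D (2 ^ q))) (≤ᵇ⇒≤ (16 * D * 2 ^ q) d (subst So (sym h) _)))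
        where
        lemma : ∀ d p → 4 * d * (2 * p + 2 * p * 1) ≡ 16 * d * p
        lemma = solve-∀

    A≡ : ∀ q → A q ≡ (∑[ v ∈ Vs ] geom (deg v) q)
    A≡ zero    = sym (∑-0 Vs)
    A≡ (suc q) = trans (cong₂ _+_ (A≡ q) (sym (∑-*ˡ Vs (2 ^ suc q) _))) (sym (∑-+ Vs _ _))

    DA≤ : ∀ q → 4 * D * A q ≤ 2 * m
    DA≤ q = begin
      4 * D * A q ≡⟨ cong (4 * D *_) (A≡ q) ⟩
      4 * D * (∑[ v ∈ Vs ] geom (deg v) q) ≡⟨ ∑-*ˡ Vs (4 * D) _ ⟨
      (∑[ v ∈ Vs ] 4 * D * geom (deg v) q) ≤⟨ ∑-mono Vs (λ v → geom≤ (deg v) q) ⟩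
      (∑[ v ∈ Vs ] deg v) ≡⟨ ∑deg ⟩
      2 * m ∎
      where open ≤-Reasoning

    DT≤ : ∀ q → D * T₁ q ≤ m
    DT≤ q = *-cancelˡ-≤ 2 (≤-trans (*-monoˡ-≤ (D * T₁ q) {2} {3} (s≤s (s≤s z≤n))) (begin
      3 * (D * T₁ q)            ≡⟨ lemma D (T₁ q) ⟩
      D * (3 * T₁ q)            ≤⟨ *-monoʳ-≤ D 3T≤ ⟩
      D * (4 * A q)             ≡⟨ lemma′ D (A q) ⟩
      4 * D * A q               ≤⟨ DA≤ q ⟩
      2 * m                     ∎))
      where
      open ≤-Reasoning
      lemma : ∀ d t → 3 * (d * t) ≡ d * (3 * t)
      lemma = solve-∀
      lemma′ : ∀ d a → d * (4 * a) ≡ 4 * d * a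
      lemma′ = solve-∀
      lemma″ : ∀ t → 3 * t + t ≡ 4 * t
      lemma″ = solve-∀
      3T≤ : 3 * T₁ q ≤ 4 * A q
      3T≤ = +-cancelʳ-≤ (T₁ q) _ _ (≤-trans (≤-reflexive (lemma″ (T₁ q))) (≤-trans (4T≤ q) (+-monoʳ-≤ (4 * A q) (pred≤ q))))

  -- Sums over the layers i with `l` ≤ i < `l + d`: of the sizes, of the sizes with weight 2 ^ i,
  -- and of the sizes with weight i - l + 1, the last obtained by summing the tails `σ`.
  σ τ υ : ℕ → ℕ → ℕ
  σ l zero    = 0
  σ l (suc d) = size l + σ (suc l) d
  τ l zero    = 0
  τ l (suc d) = 2 ^ l * size l + τ (suc l) d
  υ l zero    = 0
  υ l (suc d) = σ l (suc d) + υ (suc l) d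

  private
    T+τ : ∀ l d → T₁ l + τ (suc l) d ≡ T₁ (l + d)
    T+τ l zero    = trans (+-identityʳ _) (cong T₁ (sym (+-identityʳ l)))
    T+τ l (suc d) = trans (sym (+-assoc (T₁ l) _ _)) (trans (T+τ (suc l) d) (cong T₁ (sym (+-suc l d))))

  Dτ≤ : ∀ l d → D * τ (suc l) d ≤ m
  Dτ≤ l d = ≤-trans (*-monoʳ-≤ D (≤-trans (m≤n+m _ (T₁ l)) (≤-reflexive (T+τ l d)))) (DT≤ (l + d))

  -- Layer i counts i - l times on the left and 2 ^ i times on the right. The induction carries one
  -- more copy of `σ`, that is, i - l + 1 ≤ 2 ^ (i - l).
  υ≤τ : ∀ l d → υ (suc l) d ≤ τ (suc l) d
  υ≤τ l d = ≤-trans (m≤m+n _ (σ (suc l) d)) (≤-trans (m≤n*m _ (2 ^ l) ⦃ m^n≢0 2 l ⦄) (go l d))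
    where
    open ≤-Reasoning
    lemma : ∀ p s σ υ → p * (s + σ + υ + (s + σ)) + p * υ ≡ 2 * p * (υ + σ) + 2 * p * s
    lemma = solve-∀
    go : ∀ l d → 2 ^ l * (υ (suc l) d + σ (suc l) d) ≤ τ (suc l) d
    go l zero    = ≤-reflexive (*-zeroʳ (2 ^ l))
    go l (suc d) = begin
      2 ^ l * (size (suc l) + σ (2 + l) d + υ (2 + l) d + (size (suc l) + σ (2 + l) d))
        ≤⟨ m≤m+n _ (2 ^ l * υ (2 + l) d) ⟩
      2 ^ l * (size (suc l) + σ (2 + l) d + υ (2 + l) d + (size (suc l) + σ (2 + l) d)) + 2 ^ l * υ (2 + l) d
        ≡⟨ lemma (2 ^ l) (size (suc l)) (σ (2 + l) d) (υ (2 + l) d) ⟩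
      2 ^ suc l * (υ (2 + l) d + σ (2 + l) d) + 2 ^ suc l * size (suc l)
        ≤⟨ +-monoˡ-≤ _ (go (suc l) d) ⟩
      τ (2 + l) d + 2 ^ suc l * size (suc l)
        ≡⟨ +-comm (τ (2 + l) d) _ ⟩
      2 ^ suc l * size (suc l) + τ (2 + l) d ∎

  -- A single vertex surviving in this layer would make `T₁ (suc m)` at least `2 ^ suc m`, against
  -- the bound `m`.
  size-end : size (suc m) ≡ 0
  size-end = n<1⇒n≡0 (*-cancelˡ-< (2 ^ suc m) _ _ (≤-<-trans (begin
      2 ^ suc m * size (suc m)                ≤⟨ m≤n+m _ (T₁ m) ⟩
      T₁ (suc m)                              ≤⟨ m≤n*m (T₁ (suc m)) D ⦃ >-nonZero 1≤D ⦄ ⟩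
      D * T₁ (suc m)                          ≤⟨ DT≤ (suc m) ⟩
      m                                       ∎)
    (<-≤-trans (n<2^n m) (≤-trans (^-monoʳ-≤ 2 (n≤1+n m)) (≤-reflexive (sym (*-identityʳ (2 ^ suc m))))))))
    where
    open ≤-Reasoning
    n<2^n : ∀ n → n < 2 ^ n
    n<2^n zero    = s≤s z≤n
    n<2^n (suc n) = ≤-trans (+-mono-≤ (m^n>0 2 n) (n<2^n n)) (≤-reflexive (cong (2 ^ n +_) (sym (+-identityʳ (2 ^ n)))))

  X-end : ∀ v → X (suc m) v ≡ false
  X-end v = go (X (suc m) v) (≤-trans (∈⇒≤∑ (λ v → 𝟙 (X (suc m) v)) (∈-allFin v)) (≤-reflexive size-end))
    where
    go : ∀ b → 𝟙 b ≤ 0 → b ≡ false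
    go false _ = refl

-- General position of disjoint edges

just-of : ∀ {A : Set} (o : Maybe A) → is-just o ≡ true → Σ A λ p → o ≡ just p
just-of (just p) _ = p , refl

-- The left side of `h₁` at the largest potential `M + jmax`, divided by `D * (m * G₁)`. Here `a`
-- and `b` are the factors in `β₂` and `β₃`, kept symbolic.
coef : ℕ → ℕ → ℕ
coef a b = 4 * (64 * (2 * (16 * (4 * (64 * (64 + (b * a + 64 * 16 * a) + 64 * 16)) + (64 + (b * a + 64 * 16 * a))))))

module Assembly {P : Set} (ps : List P) (κ : P → P → P → P → ℕ)
                (κ-swap₁₂ : ∀ a b c d → κ a b c d ≡ κ b a c d)
                (κ-swap₂₃ : ∀ a b c d → κ a b c d ≡ κ a c b d)
                (κ-swap₃₄ : ∀ a b c d → κ a b c d ≡ κ a b d c)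
                (G₀ : ℕ) (κ-sum : ∀ a → (∑[ b ∈ ps ] ∑[ c ∈ ps ] ∑[ d ∈ ps ] κ a b c d) ≤ G₀)
                (N>0 : 0 < length ps)
                (n m : ℕ) (src tgt : Fin m → Fin n) (D : ℕ) (1≤D : 1 ≤ D)
                (sparse : ∀ X → (∑[ e ∈ allFin m ] 𝟙 (Incidence.within src tgt X e)) ≤ D * (∑[ v ∈ allFin n ] 𝟙 (X v)))
                (a b c : ℕ) (a≥ : 4 * (64 * 2) ≤ a) (b≥ : 4 * (64 * 16) ≤ b) (c≥ : coef a b ≤ c) where

  open Drawing ps κ κ-swap₁₂ κ-swap₂₃ κ-swap₃₄ G₀ κ-sum N>0 n m src tgt
  open Peeling src tgt D 1≤D sparse

  private
    Δ β₂ : ℕ → ℕ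
    Δ l = 16 * D * 2 ^ l
    β₂ l = a * (size l * G₁)

    -- The index `d` counts the layers placed from `l` inwards. The closeness bound `r` accumulates
    -- their `β₂`, and `j⋆` accumulates their `growth` on top of the potential of the empty drawing.
    r β₃ growth j⋆ : ℕ → ℕ → ℕ
    r l d = a * (σ l d * G₁)
    β₃ l d = b * (D * (r (suc l) d + size l * G₁))
    growth l d = β₃ l d + 64 * (Δ l * β₂ l)
    j⋆ l zero    = 64 * (m * G₁)
    j⋆ l (suc d) = j⋆ (suc l) d + growth l d

    -- `jmax` bounds the potential of a random point at every stage before the outermost layer is
    -- placed; `M` bounds the potential that a vertex of any other layer receives when it is placed.
    jmax M : ℕ
    jmax = 64 * (m * G₁) + (b * a + 64 * 16 * a) * (m * G₁)
    M = 4 * (64 * (jmax + 64 * (16 * (m * G₁))))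

    1≤a : 1 ≤ a
    1≤a = ≤-trans (s≤s z≤n) a≥

    growth≤ : ∀ l d → growth l d ≤ b * a * (D * σ l (suc d) * G₁) + 64 * 16 * a * (D * (2 ^ l * size l) * G₁)
    growth≤ l d = +-mono-≤
      (begin
        b * (D * (a * (σ (suc l) d * G₁) + size l * G₁))
          ≤⟨ *-monoʳ-≤ b (*-monoʳ-≤ D (+-monoʳ-≤ (a * (σ (suc l) d * G₁)) (m≤n*m (size l * G₁) a ⦃ >-nonZero 1≤a ⦄))) ⟩
        b * (D * (a * (σ (suc l) d * G₁) + a * (size l * G₁)))
          ≡⟨ lemma b D a (σ (suc l) d) G₁ (size l) ⟩
        b * a * (D * (size l + σ (suc l) d) * G₁) ∎)
      (≤-reflexive (lemma′ D (2 ^ l) a (size l) G₁))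
      where
      open ≤-Reasoning
      lemma : ∀ b d a s g t → b * (d * (a * (s * g) + a * (t * g))) ≡ b * a * (d * (t + s) * g)
      lemma = solve-∀
      lemma′ : ∀ d p a t g → 64 * (16 * d * p * (a * (t * g))) ≡ 64 * 16 * a * (d * (p * t) * g)
      lemma′ = solve-∀

    -- `β₃` of a layer contains, through `r`, the sizes of all layers inside it; summed over the
    -- layers this gives the double sum `υ`.
    j⋆-bound : ∀ l d → j⋆ l d ≤ 64 * (m * G₁) + (b * a * (D * υ l d * G₁) + 64 * 16 * a * (D * τ l d * G₁))
    j⋆-bound l zero    = m≤m+n _ _
    j⋆-bound l (suc d) = ≤-trans (+-mono-≤ (j⋆-bound (suc l) d) (growth≤ l d))
      (≤-reflexive (lemma (64 * (m * G₁)) (b * a) (64 * 16 * a) D (υ (suc l) d) (τ (suc l) d) (σ l (suc d)) (2 ^ l * size l) G₁))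
      where
      lemma : ∀ x y z d u t s p g → x + (y * (d * u * g) + z * (d * t * g)) + (y * (d * s * g) + z * (d * p * g)) ≡
              x + (y * (d * (s + u) * g) + z * (d * (p + t) * g))
      lemma = solve-∀

    j⋆≤jmax : ∀ l d → j⋆ (suc l) d ≤ jmax
    j⋆≤jmax l d = ≤-trans (j⋆-bound (suc l) d) (+-monoʳ-≤ (64 * (m * G₁)) (≤-trans
      (+-mono-≤ (*-monoʳ-≤ (b * a) (*-monoˡ-≤ G₁ (≤-trans (*-monoʳ-≤ D (υ≤τ l d)) (Dτ≤ l d))))
                (*-monoʳ-≤ (64 * 16 * a) (*-monoˡ-≤ G₁ (Dτ≤ l d))))
      (≤-reflexive (sym (*-distribʳ-+ (m * G₁) (b * a) (64 * 16 * a))))))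

    β₄ : ℕ → ℕ → ℕ
    β₄ l d = 4 * (64 * (j⋆ (suc l) d + 64 * (size l * (Δ l * G₁))))

    β₄≤M : ∀ l d → β₄ (suc l) d ≤ M
    β₄≤M l d = *-monoʳ-≤ 4 (*-monoʳ-≤ 64 (+-mono-≤ (j⋆≤jmax (suc l) d) (*-monoʳ-≤ 64 (begin
      size (suc l) * (16 * D * 2 ^ suc l * G₁) ≡⟨ lemma (size (suc l)) D (2 ^ suc l) G₁ ⟩
      16 * (D * (2 ^ suc l * size (suc l) + 0) * G₁) ≤⟨ *-monoʳ-≤ 16 (*-monoˡ-≤ G₁ (Dτ≤ l 1)) ⟩
      16 * (m * G₁) ∎))))
      where
      open ≤-Reasoning
      lemma : ∀ t d p g → t * (16 * d * p * g) ≡ 16 * (d * (p * t + 0) * g)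
      lemma = solve-∀

  private
    coefficient≡ : 4 * (64 * (2 * (16 * D * (M + jmax)))) ≡ coef a b * (D * (m * G₁))
    coefficient≡ = lemma 4 64 2 16 D (m * G₁) (b * a + 64 * 16 * a)
      where
      lemma : ∀ p q r s d g c → p * (q * (r * (s * d * (p * (q * (q * g + c * g + q * (s * g))) + (q * g + c * g))))) ≡
              p * (q * (r * (s * (p * (q * (q + c + q * s)) + (q + c))))) * (d * g)
      lemma = solve-∀

  -- In `pot`, the summand `M` covers the potential a vertex has when it is placed and `j⋆ l d` all
  -- growth afterwards.
  record State (l d : ℕ) : Set where
    field
      φ        : Fin n → Maybe P
      placed≡  : ∀ v → placed φ v ≡ X l v
      isValid  : Valid φ
      close    : ∀ w → closeness φ w ≤ r l d
      pot⋆     : potential φ nothing ≤ j⋆ l d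
      pot      : ∀ o → potential φ o ≤ M + j⋆ l d

  module _ (large : c * (D * (m * G₁)) ≤ N⁴) where

    private
      big : 4 * (64 * (2 * (16 * D * (M + jmax)))) ≤ N⁴
      big = ≤-trans (≤-reflexive coefficient≡) (≤-trans (*-monoˡ-≤ (D * (m * G₁)) c≥) large)

      module Next (l d : ℕ) (s : State (suc l) d) where
        open State s
        j : ℕ
        j = M + j⋆ (suc l) d
        h₁ : 4 * (64 * (2 * (16 * D * j))) ≤ N⁴
        h₁ = ≤-trans (*-monoʳ-≤ 4 (*-monoʳ-≤ 64 (*-monoʳ-≤ 2 (*-monoʳ-≤ (16 * D) (+-monoʳ-≤ M (j⋆≤jmax l d)))))) big
        h₁′ : 64 * j ≤ N⁴
        h₁′ = ≤-trans (≤-trans (m≤n*m (64 * j) 4) (*-monoʳ-≤ 4 (*-monoʳ-≤ 64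
          (≤-trans (m≤n*m j (16 * D) ⦃ >-nonZero (*-mono-≤ (s≤s (z≤n {15})) 1≤D) ⦄) (m≤n*m (16 * D * j) 2))))) h₁
        lemma₂ : ∀ x → 4 * (64 * (2 * x)) ≡ 4 * (64 * 2) * x
        lemma₂ = solve-∀
        lemma₃ : ∀ d x → 4 * (64 * (16 * d * x)) ≡ 4 * (64 * 16) * (d * x)
        lemma₃ = solve-∀
        unplaced : ∀ x → placed φ x ≡ false → X (suc l) x ≡ false
        unplaced x h = trans (sym (placed≡ x)) h
        partial : Partial
        partial = record
          { φ = φ ; X = X l ; dmax = 16 * D ; Δ = Δ l ; t = size l ; r = r (suc l) d ; j⋆ = j⋆ (suc l) d ; j = j
          ; β₂ = β₂ l ; β₃ = β₃ l d ; β₄ = β₄ l d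
          ; Y⊆X = λ v h → X-⊆ l v (trans (sym (placed≡ v)) h)
          ; valid = isValid ; R≤ = close ; J⋆≤ = pot⋆ ; J≤ = pot ; X≤t = ≤-refl
          ; degIn≤ = λ x h h′ → layer-degIn l x h (unplaced x h′)
          ; deg≤ = λ x h h′ → layer-deg l x h (unplaced x h′)
          ; h₁ = h₁ ; h₁′ = h₁′
          ; h₂ = ≤-trans (≤-reflexive (lemma₂ (size l * G₁))) (*-monoˡ-≤ (size l * G₁) a≥)
          ; h₃ = ≤-trans (≤-reflexive (lemma₃ D (r (suc l) d + size l * G₁))) (*-monoˡ-≤ (D * (r (suc l) d + size l * G₁)) b≥)
          ; h₄ = ≤-refl }
        open Stage partial public using (step)

      -- Only layers of positive index are placed here, since `β₄≤M` rests on `Dτ≤`, which does not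
      -- reach `size 0`.
      next : ∀ l d → State (2 + l) d → State (suc l) (suc d)
      next l d s = record
        { φ = proj₁ step
        ; placed≡ = proj₁ (proj₂ step)
        ; isValid = proj₁ (proj₂ (proj₂ step))
        ; close = λ w → ≤-trans (proj₁ (proj₂ (proj₂ (proj₂ step))) w)
                    (≤-reflexive (lemma a (σ (2 + l) d) (size (suc l)) G₁))
        ; pot⋆ = proj₁ (proj₂ (proj₂ (proj₂ (proj₂ step))))
        ; pot = λ o → ≤-trans (proj₂ (proj₂ (proj₂ (proj₂ (proj₂ step))))
                    (≤-trans (β₄≤M l d) (m≤m+n M _)) (m≤n+m _ M) o)
                    (≤-reflexive (+-assoc M (j⋆ (2 + l) d) (growth (suc l) d))) }
        where
        open Next (suc l) d s
        lemma : ∀ a s t g → a * (s * g) + a * (t * g) ≡ a * ((t + s) * g)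
        lemma = solve-∀

      start : State (suc m) 0
      start = record
        { φ = λ _ → nothing ; placed≡ = λ v → sym (X-end v) ; isValid = λ _ _ ()
        ; close = λ w → ≤-trans (≤-reflexive (∑-0 Vs)) z≤n
        ; pot⋆ = empty nothing ; pot = λ o → ≤-trans (empty o) (m≤n+m _ M) }
        where
        at-nothing : ∀ o → at (λ _ → nothing) o ≡ nothing
        at-nothing nothing  = refl
        at-nothing (just _) = refl
        empty : ∀ o → potential (λ _ → nothing) o ≤ 64 * (m * G₁)
        empty o = ≤-trans (∑-bound Es (64 * G₁) (λ e → ≤-trans (𝟙* (distinct o (srcᴸ e) (tgtᴸ e) nothing) _)
            (*-monoʳ-≤ 64 (≤-trans (≤-reflexive (cong (λ z → K z nothing nothing nothing) (at-nothing o))) (K-one₁ nothing)))))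
          (≤-reflexive (trans (cong (_* (64 * G₁)) (length-tabulate {n = m} (λ i → i))) (lemma m G₁)))
          where
          lemma : ∀ m g → m * (64 * g) ≡ 64 * (m * g)
          lemma = solve-∀

      descend : ∀ l d → l + d ≡ m → State (suc l) d
      descend l zero    h = subst (λ k → State (suc k) 0) (trans (sym h) (+-identityʳ l)) start
      descend l (suc d) h = next l d (descend (suc l) d (trans (sym (+-suc l d)) h))

    -- Of the outermost layer only validity is needed afterwards, so `size 0` need not be compared
    -- with `m`.
    open Next 0 m (descend 0 m refl)

    abstract
      generic-drawing : Σ (Fin n → P) λ f → ∀ g e → distinct (srcᴸ g) (tgtᴸ g) (srcᴸ e) (tgtᴸ e) ≡ true →
                        κ (f (src g)) (f (tgt g)) (f (src e)) (f (tgt e)) ≡ 0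
      generic-drawing = f , go
        where
        ψ : Fin n → Maybe P
        ψ = proj₁ step
        all : ∀ v → Σ P λ p → ψ v ≡ just p
        all v = just-of (ψ v) (proj₁ (proj₂ step) v)
        f : Fin n → P
        f v = proj₁ (all v)
        f≡ : ∀ v → ψ v ≡ just (f v)
        f≡ v = proj₂ (all v)
        here? : ∀ e → within (placed ψ) e ≡ true
        here? e = cong₂ _∧_ (proj₁ (proj₂ step) (src e)) (proj₁ (proj₂ step) (tgt e))
        N⁴>0 : 0 < N⁴
        N⁴>0 = *-mono-< N>0 (*-mono-< N>0 (*-mono-< N>0 N>0))
        cong₄ : ∀ {w w′ x x′ y y′ z z′} → w ≡ w′ → x ≡ x′ → y ≡ y′ → z ≡ z′ → K w x y z ≡ K w′ x′ y′ z′
        cong₄ refl refl refl refl = refl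
        go : ∀ g e → distinct (srcᴸ g) (tgtᴸ g) (srcᴸ e) (tgtᴸ e) ≡ true → κ (f (src g)) (f (tgt g)) (f (src e)) (f (tgt e)) ≡ 0
        go g e h = *-cancelˡ-≡ _ 0 N⁴ ⦃ >-nonZero N⁴>0 ⦄ (begin
          N⁴ * κ (f (src g)) (f (tgt g)) (f (src e)) (f (tgt e))
            ≡⟨ K-all (f (src g)) (f (tgt g)) (f (src e)) (f (tgt e)) ⟨
          K (just (f (src g))) (just (f (tgt g))) (just (f (src e))) (just (f (tgt e)))
            ≡⟨ cong₄ (sym (f≡ (src g))) (sym (f≡ (tgt g))) (sym (f≡ (src e))) (sym (f≡ (tgt e))) ⟩
          K (ψ (src g)) (ψ (tgt g)) (ψ (src e)) (ψ (tgt e))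
            ≡⟨ proj₁ (proj₂ (proj₂ step)) g e (here? g) (here? e) h ⟩
          0
            ≡⟨ *-zeroʳ N⁴ ⟨
          N⁴ * 0 ∎)
          where open ≡-Reasoning

-- Small kernel vectors of singular matrices

record ℤ³ : Set where
  constructor vec
  field x y z : ℤ
open ℤ³

dot : ℤ³ → ℤ³ → ℤ
dot u v = x u *ℤ x v +ℤ y u *ℤ y v +ℤ z u *ℤ z v

cross : ℤ³ → ℤ³ → ℤ³
cross u v = vec (y u *ℤ z v -ℤ z u *ℤ y v) (z u *ℤ x v -ℤ x u *ℤ z v) (x u *ℤ y v -ℤ y u *ℤ x v)

det : ℤ³ → ℤ³ → ℤ³ → ℤ
det u v w = dot u (cross v w)

_•_ : ℤ → ℤ³ → ℤ³
d • h = vec (d *ℤ x h) (d *ℤ y h) (d *ℤ z h)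

Bounded : ℕ → ℤ³ → Set
Bounded b h = (∣ x h ∣ ≤ b) × (∣ y h ∣ ≤ b) × (∣ z h ∣ ≤ b)

0³ : ℤ³
0³ = vec 0ℤ 0ℤ 0ℤ

-- Coprimality is stored as a Bezout identity, which is the form used by the later divisions and by
-- the lattice count. It also covers the zero pair, with d = 0 and cofactors 1 and 0.
record Primitive₂ (a b : ℤ) : Set where
  constructor prim₂
  field
    d a′ b′ α β : ℤ
    a≡ : a ≡ d *ℤ a′
    b≡ : b ≡ d *ℤ b′
    bezout : α *ℤ a′ +ℤ β *ℤ b′ ≡ 1ℤ

euclid : ∀ k a n → n < k → Primitive₂ a (⁺ n)
euclid (suc k) a zero    _ = prim₂ a 1ℤ 0ℤ 1ℤ 0ℤ (sym (ℤₚ.*-identityʳ a)) (sym (ℤₚ.*-zeroʳ a)) refl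
euclid (suc k) a (suc n) (s≤s n<k) with euclid k (⁺ suc n) (a %ℕ suc n) (≤-trans (n%ℕd<d a (suc n)) n<k)
... | prim₂ d b′ r′ α β b≡ r≡ bz = prim₂ d (r′ +ℤ q *ℤ b′) b′ β (α -ℤ β *ℤ q)
        (trans (a≡a%ℕn+[a/ℕn]*n a (suc n)) (trans (cong₂ (λ r b → r +ℤ q *ℤ b) r≡ b≡) (lemma d r′ q b′)))
        b≡ (trans (lemma′ α β r′ q b′) bz)
  where
  q = a /ℕ suc n
  lemma : ∀ d r q b → d *ℤ r +ℤ q *ℤ (d *ℤ b) ≡ d *ℤ (r +ℤ q *ℤ b)
  lemma = solveℤ
  lemma′ : ∀ α β r q b → β *ℤ (r +ℤ q *ℤ b) +ℤ (α -ℤ β *ℤ q) *ℤ b ≡ α *ℤ b +ℤ β *ℤ r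
  lemma′ = solveℤ

primitive₂ : ∀ a b → Primitive₂ a b
primitive₂ a (⁺ n) = euclid (suc n) a n ≤-refl
primitive₂ a -[1+ n ] with euclid (suc (suc n)) a (suc n) ≤-refl
... | prim₂ d a′ b′ α β a≡ b≡ bz = prim₂ d a′ (-ℤ b′) α (-ℤ β) a≡ (trans (cong -ℤ_ b≡) (lemma d b′)) (trans (lemma′ α a′ β b′) bz)
  where
  lemma : ∀ d b → -ℤ (d *ℤ b) ≡ d *ℤ (-ℤ b)
  lemma = solveℤ
  lemma′ : ∀ α a β b → α *ℤ a +ℤ (-ℤ β) *ℤ (-ℤ b) ≡ α *ℤ a +ℤ β *ℤ b
  lemma′ = solveℤ

record Primitive (n : ℤ³) : Set where
  constructor prim
  field
    d : ℤ
    h α : ℤ³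
    n≡ : n ≡ d • h
    bezout : dot α h ≡ 1ℤ

vec-≡ : ∀ {a a′ b b′ c c′} → a ≡ a′ → b ≡ b′ → c ≡ c′ → vec a b c ≡ vec a′ b′ c′
vec-≡ refl refl refl = refl

primitive₃ : ∀ n → Primitive n
primitive₃ (vec a b c) with primitive₂ a b
... | prim₂ d a′ b′ α β a≡ b≡ bz with primitive₂ d c
... | prim₂ e d′ c′ γ δ d≡ c≡ bz′ =
  prim e (vec (d′ *ℤ a′) (d′ *ℤ b′) c′) (vec (γ *ℤ α) (γ *ℤ β) δ)
    (vec-≡ (trans a≡ (trans (cong (_*ℤ a′) d≡) (ℤₚ.*-assoc e d′ a′)))
           (trans b≡ (trans (cong (_*ℤ b′) d≡) (ℤₚ.*-assoc e d′ b′))) c≡)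
    (trans (lemma γ α β δ d′ a′ b′ c′) (trans (cong (λ t → γ *ℤ d′ *ℤ t +ℤ δ *ℤ c′) bz)
      (trans (cong (_+ℤ δ *ℤ c′) (ℤₚ.*-identityʳ (γ *ℤ d′))) bz′)))
  where
  lemma : ∀ γ α β δ d a b c → γ *ℤ α *ℤ (d *ℤ a) +ℤ γ *ℤ β *ℤ (d *ℤ b) +ℤ δ *ℤ c ≡ γ *ℤ d *ℤ (α *ℤ a +ℤ β *ℤ b) +ℤ δ *ℤ c
  lemma = solveℤ

cancelℤ : ∀ d {a} → d ≢ 0ℤ → d *ℤ a ≡ 0ℤ → a ≡ 0ℤ
cancelℤ d d≢0 h with ℤₚ.i*j≡0⇒i≡0∨j≡0 d h
... | inj₁ d≡0 = ⊥-elim (d≢0 d≡0)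
... | inj₂ a≡0 = a≡0

0•≡0 : ∀ d h → d ≡ 0ℤ → d • h ≡ 0³
0•≡0 d h refl = vec-≡ (ℤₚ.*-zeroˡ (x h)) (ℤₚ.*-zeroˡ (y h)) (ℤₚ.*-zeroˡ (z h))

dot-• : ∀ u d h → dot u (d • h) ≡ d *ℤ dot u h
dot-• u d h = lemma (x u) (y u) (z u) d (x h) (y h) (z h)
  where
  lemma : ∀ a b c d p q r → a *ℤ (d *ℤ p) +ℤ b *ℤ (d *ℤ q) +ℤ c *ℤ (d *ℤ r) ≡ d *ℤ (a *ℤ p +ℤ b *ℤ q +ℤ c *ℤ r)
  lemma = solveℤ

dot-prim : ∀ u {n} (p : Primitive n) → n ≢ 0³ → dot u n ≡ 0ℤ → dot u (Primitive.h p) ≡ 0ℤ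
dot-prim u (prim d h α refl bz) n≢0 e = cancelℤ d (λ d≡0 → n≢0 (0•≡0 d h d≡0)) (trans (sym (dot-• u d h)) e)

∣factor∣ : ∀ d a → d ≢ 0ℤ → ∣ a ∣ ≤ ∣ d *ℤ a ∣
∣factor∣ d a d≢0 = ≤-trans (m≤n*m ∣ a ∣ ∣ d ∣ ⦃ ≢-nonZeroℤ d≢0 ⦄) (≤-reflexive (sym (ℤₚ.abs-* d a)))

Bounded-prim : ∀ {b n} (p : Primitive n) → n ≢ 0³ → Bounded b n → Bounded b (Primitive.h p)
Bounded-prim (prim d h α refl bz) n≢0 (b₁ , b₂ , b₃) =
  ≤-trans (∣factor∣ d (x h) d≢0) b₁ , ≤-trans (∣factor∣ d (y h) d≢0) b₂ , ≤-trans (∣factor∣ d (z h) d≢0) b₃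
  where
  d≢0 : d ≢ 0ℤ
  d≢0 d≡0 = n≢0 (0•≡0 d h d≡0)

Orthogonal : ℤ³ → ℤ³ → ℤ³ → ℤ³ → Set
Orthogonal u v w h = (dot u h ≡ 0ℤ) × (dot v h ≡ 0ℤ) × (dot w h ≡ 0ℤ)

column : (ℤ³ → ℤ) → ℤ³ → ℤ³ → ℤ³ → ℤ³
column p u v w = vec (p u) (p v) (p w)

record SmallKernel (m : ℕ) (u v w : ℤ³) : Set where
  constructor small
  field
    h α    : ℤ³
    bezout : dot α h ≡ 1ℤ
    bounded : Bounded (2 * m) h
    kernel : Orthogonal u v w h ⊎ Orthogonal (column x u v w) (column y u v w) (column z u v w) h

-- Proportionality gives a_i h_j = a_j h_i for the entries of `A`. Expanding a_i = a_i (α · h)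
-- therefore yields (α · A) h_i.
parallel : ∀ A {B} (p : Primitive B) → B ≢ 0³ →
           x A *ℤ y B ≡ y A *ℤ x B → y A *ℤ z B ≡ z A *ℤ y B → x A *ℤ z B ≡ z A *ℤ x B →
           A ≡ dot (Primitive.α p) A • Primitive.h p
parallel A (prim d h α refl bz) B≢0 xy yz xz =
  vec-≡ (entry (x A) (x h) refl xy′ xz′) (entry (y A) (y h) (sym xy′) refl yz′) (entry (z A) (z h) (sym xz′) (sym yz′) refl)
  where
  d≢0 : d ≢ 0ℤ
  d≢0 d≡0 = B≢0 (0•≡0 d h d≡0)
  swap : ∀ a d b → a *ℤ (d *ℤ b) ≡ d *ℤ (a *ℤ b)
  swap = solveℤ
  strip : ∀ a b p q → a *ℤ (d *ℤ p) ≡ b *ℤ (d *ℤ q) → a *ℤ p ≡ b *ℤ q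
  strip a b p q e = ℤₚ.*-cancelˡ-≡ d (a *ℤ p) (b *ℤ q) ⦃ ≢-nonZeroℤ d≢0 ⦄ (trans (sym (swap a d p)) (trans e (swap b d q)))
  xy′ : x A *ℤ y h ≡ y A *ℤ x h
  xy′ = strip (x A) (y A) (y h) (x h) xy
  yz′ : y A *ℤ z h ≡ z A *ℤ y h
  yz′ = strip (y A) (z A) (z h) (y h) yz
  xz′ : x A *ℤ z h ≡ z A *ℤ x h
  xz′ = strip (x A) (z A) (z h) (x h) xz
  expand : ∀ a α β γ p q r → a *ℤ (α *ℤ p +ℤ β *ℤ q +ℤ γ *ℤ r) ≡ α *ℤ (a *ℤ p) +ℤ β *ℤ (a *ℤ q) +ℤ γ *ℤ (a *ℤ r)
  expand = solveℤ
  collect : ∀ a b c α β γ p → α *ℤ (a *ℤ p) +ℤ β *ℤ (b *ℤ p) +ℤ γ *ℤ (c *ℤ p) ≡ (α *ℤ a +ℤ β *ℤ b +ℤ γ *ℤ c) *ℤ p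
  collect = solveℤ
  cong₃ : ∀ {p q r p′ q′ r′} → p ≡ p′ → q ≡ q′ → r ≡ r′ →
          x α *ℤ p +ℤ y α *ℤ q +ℤ z α *ℤ r ≡ x α *ℤ p′ +ℤ y α *ℤ q′ +ℤ z α *ℤ r′
  cong₃ refl refl refl = refl
  entry : ∀ a p → a *ℤ x h ≡ x A *ℤ p → a *ℤ y h ≡ y A *ℤ p → a *ℤ z h ≡ z A *ℤ p → a ≡ dot α A *ℤ p
  entry a p ex ey ez = trans (sym (ℤₚ.*-identityʳ a)) (trans (cong (a *ℤ_) (sym bz))
    (trans (expand a (x α) (y α) (z α) (x h) (y h) (z h)) (trans (cong₃ ex ey ez) (collect (x A) (y A) (z A) (x α) (y α) (z α) p))))

Bounded-mono : ∀ {b c n} → b ≤ c → Bounded b n → Bounded c n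
Bounded-mono le (a , b , c) = ≤-trans a le , ≤-trans b le , ≤-trans c le

cross-bound : ∀ {m v w} → Bounded m v → Bounded m w → Bounded (m * m + m * m) (cross v w)
cross-bound {m} {v} {w} (v₁ , v₂ , v₃) (w₁ , w₂ , w₃) =
  minor (y v) (z w) (z v) (y w) v₂ w₃ v₃ w₂ , minor (z v) (x w) (x v) (z w) v₃ w₁ v₁ w₃ , minor (x v) (y w) (y v) (x w) v₁ w₂ v₂ w₁
  where
  minor : ∀ a b c d → ∣ a ∣ ≤ m → ∣ b ∣ ≤ m → ∣ c ∣ ≤ m → ∣ d ∣ ≤ m → ∣ a *ℤ b -ℤ c *ℤ d ∣ ≤ m * m + m * m
  minor a b c d la lb lc ld = ≤-trans (ℤₚ.∣i-j∣≤∣i∣+∣j∣ (a *ℤ b) (c *ℤ d))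
    (+-mono-≤ (≤-trans (≤-reflexive (ℤₚ.abs-* a b)) (*-mono-≤ la lb)) (≤-trans (≤-reflexive (ℤₚ.abs-* c d)) (*-mono-≤ lc ld)))

-- The cofactor rows of a singular matrix are parallel, so they are multiples g_i h of one
-- primitive vector h; then h lies in the right kernel and g in the left kernel, and
-- |g_i h_j| ≤ 2m² makes one of the two small.
module Cofactor (m : ℕ) (u v w : ℤ³) (1≤m : 1 ≤ m) (bu : Bounded m u) (bv : Bounded m v) (bw : Bounded m w)
                (det≡0 : det u v w ≡ 0ℤ) (A≢0 : cross v w ≢ 0³) where
  private
    A B C : ℤ³
    A = cross v w
    B = cross w u
    C = cross u v

    p : Primitive A
    p = primitive₃ A

    open Primitive p

    d≢0 : d ≢ 0ℤ
    d≢0 d≡0 = A≢0 (trans n≡ (0•≡0 d h d≡0))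

    drop : ∀ {a b} c → a ≡ b +ℤ det u v w *ℤ c → a ≡ b
    drop {a} {b} c e = trans e (trans (cong (λ t → b +ℤ t *ℤ c) det≡0) (trans (cong (b +ℤ_) (ℤₚ.*-zeroˡ c)) (ℤₚ.+-identityʳ b)))

    -- Each 2 × 2 minor of the cofactor rows `A` and `B` is, up to sign, `det u v w` times an entry
    -- of the matrix; `drop` removes this multiple.
    B≡ : B ≡ dot α B • h
    B≡ = parallel B p A≢0
      (drop (-ℤ z w) (i₁ (x u) (y u) (z u) (x v) (y v) (z v) (x w) (y w) (z w)))
      (drop (-ℤ x w) (i₂ (x u) (y u) (z u) (x v) (y v) (z v) (x w) (y w) (z w)))
      (drop (y w) (i₃ (x u) (y u) (z u) (x v) (y v) (z v) (x w) (y w) (z w)))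
      where
      i₁ : ∀ u₁ u₂ u₃ v₁ v₂ v₃ w₁ w₂ w₃ →
           (w₂ *ℤ u₃ -ℤ w₃ *ℤ u₂) *ℤ (v₃ *ℤ w₁ -ℤ v₁ *ℤ w₃) ≡ (w₃ *ℤ u₁ -ℤ w₁ *ℤ u₃) *ℤ (v₂ *ℤ w₃ -ℤ v₃ *ℤ w₂) +ℤ
           (u₁ *ℤ (v₂ *ℤ w₃ -ℤ v₃ *ℤ w₂) +ℤ u₂ *ℤ (v₃ *ℤ w₁ -ℤ v₁ *ℤ w₃) +ℤ u₃ *ℤ (v₁ *ℤ w₂ -ℤ v₂ *ℤ w₁)) *ℤ (-ℤ w₃)
      i₁ = solveℤ
      i₂ : ∀ u₁ u₂ u₃ v₁ v₂ v₃ w₁ w₂ w₃ →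
           (w₃ *ℤ u₁ -ℤ w₁ *ℤ u₃) *ℤ (v₁ *ℤ w₂ -ℤ v₂ *ℤ w₁) ≡ (w₁ *ℤ u₂ -ℤ w₂ *ℤ u₁) *ℤ (v₃ *ℤ w₁ -ℤ v₁ *ℤ w₃) +ℤ
           (u₁ *ℤ (v₂ *ℤ w₃ -ℤ v₃ *ℤ w₂) +ℤ u₂ *ℤ (v₃ *ℤ w₁ -ℤ v₁ *ℤ w₃) +ℤ u₃ *ℤ (v₁ *ℤ w₂ -ℤ v₂ *ℤ w₁)) *ℤ (-ℤ w₁)
      i₂ = solveℤ
      i₃ : ∀ u₁ u₂ u₃ v₁ v₂ v₃ w₁ w₂ w₃ →
           (w₂ *ℤ u₃ -ℤ w₃ *ℤ u₂) *ℤ (v₁ *ℤ w₂ -ℤ v₂ *ℤ w₁) ≡ (w₁ *ℤ u₂ -ℤ w₂ *ℤ u₁) *ℤ (v₂ *ℤ w₃ -ℤ v₃ *ℤ w₂) +ℤ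
           (u₁ *ℤ (v₂ *ℤ w₃ -ℤ v₃ *ℤ w₂) +ℤ u₂ *ℤ (v₃ *ℤ w₁ -ℤ v₁ *ℤ w₃) +ℤ u₃ *ℤ (v₁ *ℤ w₂ -ℤ v₂ *ℤ w₁)) *ℤ w₂
      i₃ = solveℤ

    C≡ : C ≡ dot α C • h
    C≡ = parallel C p A≢0
      (drop (z v) (i₁ (x u) (y u) (z u) (x v) (y v) (z v) (x w) (y w) (z w)))
      (drop (x v) (i₂ (x u) (y u) (z u) (x v) (y v) (z v) (x w) (y w) (z w)))
      (drop (-ℤ y v) (i₃ (x u) (y u) (z u) (x v) (y v) (z v) (x w) (y w) (z w)))
      where
      i₁ : ∀ u₁ u₂ u₃ v₁ v₂ v₃ w₁ w₂ w₃ →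
           (u₂ *ℤ v₃ -ℤ u₃ *ℤ v₂) *ℤ (v₃ *ℤ w₁ -ℤ v₁ *ℤ w₃) ≡ (u₃ *ℤ v₁ -ℤ u₁ *ℤ v₃) *ℤ (v₂ *ℤ w₃ -ℤ v₃ *ℤ w₂) +ℤ
           (u₁ *ℤ (v₂ *ℤ w₃ -ℤ v₃ *ℤ w₂) +ℤ u₂ *ℤ (v₃ *ℤ w₁ -ℤ v₁ *ℤ w₃) +ℤ u₃ *ℤ (v₁ *ℤ w₂ -ℤ v₂ *ℤ w₁)) *ℤ v₃
      i₁ = solveℤ
      i₂ : ∀ u₁ u₂ u₃ v₁ v₂ v₃ w₁ w₂ w₃ →
           (u₃ *ℤ v₁ -ℤ u₁ *ℤ v₃) *ℤ (v₁ *ℤ w₂ -ℤ v₂ *ℤ w₁) ≡ (u₁ *ℤ v₂ -ℤ u₂ *ℤ v₁) *ℤ (v₃ *ℤ w₁ -ℤ v₁ *ℤ w₃) +ℤ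
           (u₁ *ℤ (v₂ *ℤ w₃ -ℤ v₃ *ℤ w₂) +ℤ u₂ *ℤ (v₃ *ℤ w₁ -ℤ v₁ *ℤ w₃) +ℤ u₃ *ℤ (v₁ *ℤ w₂ -ℤ v₂ *ℤ w₁)) *ℤ v₁
      i₂ = solveℤ
      i₃ : ∀ u₁ u₂ u₃ v₁ v₂ v₃ w₁ w₂ w₃ →
           (u₂ *ℤ v₃ -ℤ u₃ *ℤ v₂) *ℤ (v₁ *ℤ w₂ -ℤ v₂ *ℤ w₁) ≡ (u₁ *ℤ v₂ -ℤ u₂ *ℤ v₁) *ℤ (v₂ *ℤ w₃ -ℤ v₃ *ℤ w₂) +ℤ
           (u₁ *ℤ (v₂ *ℤ w₃ -ℤ v₃ *ℤ w₂) +ℤ u₂ *ℤ (v₃ *ℤ w₁ -ℤ v₁ *ℤ w₃) +ℤ u₃ *ℤ (v₁ *ℤ w₂ -ℤ v₂ *ℤ w₁)) *ℤ (-ℤ v₂)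
      i₃ = solveℤ

    g : ℤ³
    g = vec d (dot α B) (dot α C)

    right : Orthogonal u v w h
    right = dot-prim u p A≢0 det≡0
          , dot-prim v p A≢0 (iv (x v) (y v) (z v) (x w) (y w) (z w))
          , dot-prim w p A≢0 (iw (x v) (y v) (z v) (x w) (y w) (z w))
      where
      iv : ∀ v₁ v₂ v₃ w₁ w₂ w₃ → v₁ *ℤ (v₂ *ℤ w₃ -ℤ v₃ *ℤ w₂) +ℤ v₂ *ℤ (v₃ *ℤ w₁ -ℤ v₁ *ℤ w₃) +ℤ v₃ *ℤ (v₁ *ℤ w₂ -ℤ v₂ *ℤ w₁) ≡ 0ℤ
      iv = solveℤ
      iw : ∀ v₁ v₂ v₃ w₁ w₂ w₃ → w₁ *ℤ (v₂ *ℤ w₃ -ℤ v₃ *ℤ w₂) +ℤ w₂ *ℤ (v₃ *ℤ w₁ -ℤ v₁ *ℤ w₃) +ℤ w₃ *ℤ (v₁ *ℤ w₂ -ℤ v₂ *ℤ w₁) ≡ 0ℤ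
      iw = solveℤ

    -- The products of entries of `g` and `h` are the cofactors, so `dot c g` times every entry of
    -- `h` vanishes. The Bezout identity for `h` leaves `dot c g` itself.
    annihilate : ∀ c → dot c (vec (x A) (x B) (x C)) ≡ 0ℤ → dot c (vec (y A) (y B) (y C)) ≡ 0ℤ →
                 dot c (vec (z A) (z B) (z C)) ≡ 0ℤ → dot c g ≡ 0ℤ
    annihilate c ex ey ez = trans (sym (ℤₚ.*-identityʳ (dot c g))) (trans (cong (dot c g *ℤ_) (sym bezout))
        (trans (expand (x α) (y α) (z α) (x h) (y h) (z h) (dot c g))
          (trans (cong₃ (scale x (λ d h → refl) ex) (scale y (λ d h → refl) ey) (scale z (λ d h → refl) ez)) (zeros (x α) (y α) (z α)))))
      where
      expand : ∀ α β γ p q r s → s *ℤ (α *ℤ p +ℤ β *ℤ q +ℤ γ *ℤ r) ≡ α *ℤ (s *ℤ p) +ℤ β *ℤ (s *ℤ q) +ℤ γ *ℤ (s *ℤ r)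
      expand = solveℤ
      zeros : ∀ α β γ → α *ℤ 0ℤ +ℤ β *ℤ 0ℤ +ℤ γ *ℤ 0ℤ ≡ 0ℤ
      zeros = solveℤ
      cong₃ : ∀ {p q r p′ q′ r′} → p ≡ p′ → q ≡ q′ → r ≡ r′ →
              x α *ℤ p +ℤ y α *ℤ q +ℤ z α *ℤ r ≡ x α *ℤ p′ +ℤ y α *ℤ q′ +ℤ z α *ℤ r′
      cong₃ refl refl refl = refl
      pull : ∀ a b c d e f p → (a *ℤ d +ℤ b *ℤ e +ℤ c *ℤ f) *ℤ p ≡ a *ℤ (d *ℤ p) +ℤ b *ℤ (e *ℤ p) +ℤ c *ℤ (f *ℤ p)
      pull = solveℤ
      scale : ∀ (π : ℤ³ → ℤ) → (∀ d h → π (d • h) ≡ d *ℤ π h) → dot c (vec (π A) (π B) (π C)) ≡ 0ℤ → dot c g *ℤ π h ≡ 0ℤ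
      scale π lin e = trans (pull (x c) (y c) (z c) d (dot α B) (dot α C) (π h)) (trans (cong₃′
          (trans (sym (lin d h)) (cong π (sym n≡))) (trans (sym (lin (dot α B) h)) (cong π (sym B≡))) (trans (sym (lin (dot α C) h)) (cong π (sym C≡)))) e)
        where
        cong₃′ : ∀ {p q r p′ q′ r′} → p ≡ p′ → q ≡ q′ → r ≡ r′ →
                 x c *ℤ p +ℤ y c *ℤ q +ℤ z c *ℤ r ≡ x c *ℤ p′ +ℤ y c *ℤ q′ +ℤ z c *ℤ r′
        cong₃′ refl refl refl = refl

    left : Orthogonal (column x u v w) (column y u v w) (column z u v w) g
    left = annihilate (column x u v w) (trans (d₁ (x u) (y u) (z u) (x v) (y v) (z v) (x w) (y w) (z w)) det≡0)
                                       (o₁ (x u) (y u) (z u) (x v) (y v) (z v) (x w) (y w) (z w))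
                                       (o₂ (x u) (y u) (z u) (x v) (y v) (z v) (x w) (y w) (z w))
         , annihilate (column y u v w) (o₃ (x u) (y u) (z u) (x v) (y v) (z v) (x w) (y w) (z w))
                                       (trans (d₂ (x u) (y u) (z u) (x v) (y v) (z v) (x w) (y w) (z w)) det≡0)
                                       (o₄ (x u) (y u) (z u) (x v) (y v) (z v) (x w) (y w) (z w))
         , annihilate (column z u v w) (o₅ (x u) (y u) (z u) (x v) (y v) (z v) (x w) (y w) (z w))
                                       (o₆ (x u) (y u) (z u) (x v) (y v) (z v) (x w) (y w) (z w))
                                       (trans (d₃ (x u) (y u) (z u) (x v) (y v) (z v) (x w) (y w) (z w)) det≡0)
      where
      d₁ : ∀ u₁ u₂ u₃ v₁ v₂ v₃ w₁ w₂ w₃ → u₁ *ℤ (v₂ *ℤ w₃ -ℤ v₃ *ℤ w₂) +ℤ v₁ *ℤ (w₂ *ℤ u₃ -ℤ w₃ *ℤ u₂) +ℤ w₁ *ℤ (u₂ *ℤ v₃ -ℤ u₃ *ℤ v₂) ≡ u₁ *ℤ (v₂ *ℤ w₃ -ℤ v₃ *ℤ w₂) +ℤ u₂ *ℤ (v₃ *ℤ w₁ -ℤ v₁ *ℤ w₃) +ℤ u₃ *ℤ (v₁ *ℤ w₂ -ℤ v₂ *ℤ w₁)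
      d₁ = solveℤ
      o₁ : ∀ u₁ u₂ u₃ v₁ v₂ v₃ w₁ w₂ w₃ → u₁ *ℤ (v₃ *ℤ w₁ -ℤ v₁ *ℤ w₃) +ℤ v₁ *ℤ (w₃ *ℤ u₁ -ℤ w₁ *ℤ u₃) +ℤ w₁ *ℤ (u₃ *ℤ v₁ -ℤ u₁ *ℤ v₃) ≡ 0ℤ
      o₁ = solveℤ
      o₂ : ∀ u₁ u₂ u₃ v₁ v₂ v₃ w₁ w₂ w₃ → u₁ *ℤ (v₁ *ℤ w₂ -ℤ v₂ *ℤ w₁) +ℤ v₁ *ℤ (w₁ *ℤ u₂ -ℤ w₂ *ℤ u₁) +ℤ w₁ *ℤ (u₁ *ℤ v₂ -ℤ u₂ *ℤ v₁) ≡ 0ℤ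
      o₂ = solveℤ
      o₃ : ∀ u₁ u₂ u₃ v₁ v₂ v₃ w₁ w₂ w₃ → u₂ *ℤ (v₂ *ℤ w₃ -ℤ v₃ *ℤ w₂) +ℤ v₂ *ℤ (w₂ *ℤ u₃ -ℤ w₃ *ℤ u₂) +ℤ w₂ *ℤ (u₂ *ℤ v₃ -ℤ u₃ *ℤ v₂) ≡ 0ℤ
      o₃ = solveℤ
      d₂ : ∀ u₁ u₂ u₃ v₁ v₂ v₃ w₁ w₂ w₃ → u₂ *ℤ (v₃ *ℤ w₁ -ℤ v₁ *ℤ w₃) +ℤ v₂ *ℤ (w₃ *ℤ u₁ -ℤ w₁ *ℤ u₃) +ℤ w₂ *ℤ (u₃ *ℤ v₁ -ℤ u₁ *ℤ v₃) ≡ u₁ *ℤ (v₂ *ℤ w₃ -ℤ v₃ *ℤ w₂) +ℤ u₂ *ℤ (v₃ *ℤ w₁ -ℤ v₁ *ℤ w₃) +ℤ u₃ *ℤ (v₁ *ℤ w₂ -ℤ v₂ *ℤ w₁)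
      d₂ = solveℤ
      o₄ : ∀ u₁ u₂ u₃ v₁ v₂ v₃ w₁ w₂ w₃ → u₂ *ℤ (v₁ *ℤ w₂ -ℤ v₂ *ℤ w₁) +ℤ v₂ *ℤ (w₁ *ℤ u₂ -ℤ w₂ *ℤ u₁) +ℤ w₂ *ℤ (u₁ *ℤ v₂ -ℤ u₂ *ℤ v₁) ≡ 0ℤ
      o₄ = solveℤ
      o₅ : ∀ u₁ u₂ u₃ v₁ v₂ v₃ w₁ w₂ w₃ → u₃ *ℤ (v₂ *ℤ w₃ -ℤ v₃ *ℤ w₂) +ℤ v₃ *ℤ (w₂ *ℤ u₃ -ℤ w₃ *ℤ u₂) +ℤ w₃ *ℤ (u₂ *ℤ v₃ -ℤ u₃ *ℤ v₂) ≡ 0ℤ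
      o₅ = solveℤ
      o₆ : ∀ u₁ u₂ u₃ v₁ v₂ v₃ w₁ w₂ w₃ → u₃ *ℤ (v₃ *ℤ w₁ -ℤ v₁ *ℤ w₃) +ℤ v₃ *ℤ (w₃ *ℤ u₁ -ℤ w₁ *ℤ u₃) +ℤ w₃ *ℤ (u₃ *ℤ v₁ -ℤ u₁ *ℤ v₃) ≡ 0ℤ
      o₆ = solveℤ
      d₃ : ∀ u₁ u₂ u₃ v₁ v₂ v₃ w₁ w₂ w₃ → u₃ *ℤ (v₁ *ℤ w₂ -ℤ v₂ *ℤ w₁) +ℤ v₃ *ℤ (w₁ *ℤ u₂ -ℤ w₂ *ℤ u₁) +ℤ w₃ *ℤ (u₁ *ℤ v₂ -ℤ u₂ *ℤ v₁) ≡ u₁ *ℤ (v₂ *ℤ w₃ -ℤ v₃ *ℤ w₂) +ℤ u₂ *ℤ (v₃ *ℤ w₁ -ℤ v₁ *ℤ w₃) +ℤ u₃ *ℤ (v₁ *ℤ w₂ -ℤ v₂ *ℤ w₁)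
      d₃ = solveℤ

    size-A : Bounded (m * m + m * m) A
    size-A = cross-bound {v = v} {w} bv bw
    size-B : Bounded (m * m + m * m) B
    size-B = cross-bound {v = w} {u} bw bu
    size-C : Bounded (m * m + m * m) C
    size-C = cross-bound {v = u} {v} bu bv

    shrink : ∀ e k → 2 * m < ∣ k ∣ → ∣ e *ℤ k ∣ ≤ m * m + m * m → ∣ e ∣ ≤ m
    shrink e k big le = *-cancelʳ-≤ ∣ e ∣ m (2 * m) ⦃ >-nonZero (*-mono-≤ (s≤s (z≤n {1})) 1≤m) ⦄
      (≤-trans (*-monoʳ-≤ ∣ e ∣ (<⇒≤ big)) (≤-trans (≤-reflexive (sym (ℤₚ.abs-* e k))) (≤-trans le (≤-reflexive (lemma m)))))
      where
      lemma : ∀ m → m * m + m * m ≡ m * (2 * m)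
      lemma = solve-∀

    g≢0 : g ≢ 0³
    g≢0 e = d≢0 (cong x e)

    left-small : Bounded m g → SmallKernel m u v w
    left-small bg = small (Primitive.h q) (Primitive.α q) (Primitive.bezout q)
        (Bounded-mono {n = Primitive.h q} (m≤n*m m 2) (Bounded-prim q g≢0 bg))
        (inj₂ (dot-prim (column x u v w) q g≢0 (proj₁ left) , dot-prim (column y u v w) q g≢0 (proj₁ (proj₂ left))
             , dot-prim (column z u v w) q g≢0 (proj₂ (proj₂ left))))
      where
      q : Primitive g
      q = primitive₃ g

    via : ∀ (π : ℤ³ → ℤ) → (∀ d h → π (d • h) ≡ d *ℤ π h) → (∀ {b} n → Bounded b n → ∣ π n ∣ ≤ b) → 2 * m < ∣ π h ∣ → SmallKernel m u v w
    via π lin le big = left-small (go d n≡ size-A , go (dot α B) B≡ size-B , go (dot α C) C≡ size-C)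
      where
      go : ∀ e {N} → N ≡ e • h → Bounded (m * m + m * m) N → ∣ e ∣ ≤ m
      go e {N} N≡ bN = shrink e (π h) big (≤-trans (≤-reflexive (cong ∣_∣ (trans (sym (lin e h)) (cong π (sym N≡))))) (le N bN))

  smallKernel : SmallKernel m u v w
  smallKernel with 2 * m <? ∣ x h ∣ | 2 * m <? ∣ y h ∣ | 2 * m <? ∣ z h ∣
  ... | yes b | _ | _ = via x (λ _ _ → refl) (λ _ → proj₁) b
  ... | no _ | yes b | _ = via y (λ _ _ → refl) (λ _ b → proj₁ (proj₂ b)) b
  ... | no _ | no _ | yes b = via z (λ _ _ → refl) (λ _ b → proj₂ (proj₂ b)) b
  ... | no a | no b | no c = small h α bezout (≮⇒≥ a , ≮⇒≥ b , ≮⇒≥ c) (inj₁ right)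

-- In rank one all rows are parallel to `r`, so a vector orthogonal to `r` is enough: `(y, -x, 0)`,
-- or the first axis when that vanishes.
flat : ∀ m r s t → 1 ≤ m → Bounded m r → cross r s ≡ 0³ → cross r t ≡ 0³ → r ≢ 0³ →
       Σ ℤ³ λ k → Bounded m k × (k ≢ 0³) × Orthogonal r s t k
flat m r s t 1≤m (b₁ , b₂ , b₃) rs rt r≢0 = choose (x r ℤₚ.≟ 0ℤ) (y r ℤₚ.≟ 0ℤ)
  where
  Result : Set
  Result = Σ ℤ³ λ k → Bounded m k × (k ≢ 0³) × Orthogonal r s t k
  axis : x r ≡ 0ℤ → y r ≡ 0ℤ → Result
  axis x≡0 y≡0 = vec 1ℤ 0ℤ 0ℤ , (1≤m , z≤n , z≤n) , (λ ()) ,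
    (trans (first r) x≡0 , trans (first s) (kill (x s) (z s) (cong y rs)) , trans (first t) (kill (x t) (z t) (cong y rt)))
    where
    first : ∀ u → dot u (vec 1ℤ 0ℤ 0ℤ) ≡ x u
    first u = lemma (x u) (y u) (z u)
      where
      lemma : ∀ a b c → a *ℤ 1ℤ +ℤ b *ℤ 0ℤ +ℤ c *ℤ 0ℤ ≡ a
      lemma = solveℤ
    kill : ∀ a c → z r *ℤ a -ℤ x r *ℤ c ≡ 0ℤ → a ≡ 0ℤ
    kill a c e = cancelℤ (z r) (λ z≡0 → r≢0 (vec-≡ x≡0 y≡0 z≡0))
        (trans (sym (trans (cong (λ t → z r *ℤ a -ℤ t *ℤ c) x≡0) (lemma (z r *ℤ a) c))) e)
      where
      lemma : ∀ a c → a -ℤ 0ℤ *ℤ c ≡ a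
      lemma = solveℤ
  turn : vec (y r) (-ℤ x r) 0ℤ ≢ 0³ → Result
  turn ne = vec (y r) (-ℤ x r) 0ℤ , (b₂ , ≤-trans (≤-reflexive (ℤₚ.∣-i∣≡∣i∣ (x r))) b₁ , z≤n) , ne ,
    (self (x r) (y r) (z r) , other s (cong z rs) , other t (cong z rt))
    where
    self : ∀ a b c → a *ℤ b +ℤ b *ℤ (-ℤ a) +ℤ c *ℤ 0ℤ ≡ 0ℤ
    self = solveℤ
    other : ∀ s → x r *ℤ y s -ℤ y r *ℤ x s ≡ 0ℤ → dot s (vec (y r) (-ℤ x r) 0ℤ) ≡ 0ℤ
    other s e = trans (lemma (x r) (y r) (x s) (y s) (z s)) (cong -ℤ_ e)
      where
      lemma : ∀ a b p q k → p *ℤ b +ℤ q *ℤ (-ℤ a) +ℤ k *ℤ 0ℤ ≡ -ℤ (a *ℤ q -ℤ b *ℤ p)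
      lemma = solveℤ
  choose : Dec (x r ≡ 0ℤ) → Dec (y r ≡ 0ℤ) → Result
  choose (yes x≡0) (yes y≡0) = axis x≡0 y≡0
  choose _         (no y≢0)  = turn (λ e → y≢0 (cong x e))
  choose (no x≢0)  _         = turn (λ e → x≢0 (trans (sym (ℤₚ.neg-involutive (x r))) (cong -ℤ_ (cong y e))))

rotate : ∀ {m u v w} → SmallKernel m v w u → SmallKernel m u v w
rotate (small h α bz b (inj₁ (v⊥ , w⊥ , u⊥))) = small h α bz b (inj₁ (u⊥ , v⊥ , w⊥))
rotate {u = u} {v} {w} (small (vec h₁ h₂ h₃) (vec α₁ α₂ α₃) bz (b₁ , b₂ , b₃) (inj₂ (c₁ , c₂ , c₃))) =
  small (vec h₃ h₁ h₂) (vec α₃ α₁ α₂) (trans (turn α₃ h₃ α₁ h₁ α₂ h₂) bz) (b₃ , b₁ , b₂)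
    (inj₂ (trans (turn (x u) h₃ (x v) h₁ (x w) h₂) c₁ , trans (turn (y u) h₃ (y v) h₁ (y w) h₂) c₂
          , trans (turn (z u) h₃ (z v) h₁ (z w) h₂) c₃))
  where
  turn : ∀ a b c d e f → a *ℤ b +ℤ c *ℤ d +ℤ e *ℤ f ≡ c *ℤ d +ℤ e *ℤ f +ℤ a *ℤ b
  turn = solveℤ

flat-kernel : ∀ {m r s t} → 1 ≤ m → Bounded m r → cross r s ≡ 0³ → cross r t ≡ 0³ → r ≢ 0³ → SmallKernel m r s t
flat-kernel {m} {r} {s} {t} 1≤m br rs rt r≢0 with flat m r s t 1≤m br rs rt r≢0
... | k , bk , k≢0 , (o₁ , o₂ , o₃) =
  small (Primitive.h q) (Primitive.α q) (Primitive.bezout q) (Bounded-mono {n = Primitive.h q} (m≤n*m m 2) (Bounded-prim q k≢0 bk))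
    (inj₁ (dot-prim r q k≢0 o₁ , dot-prim s q k≢0 o₂ , dot-prim t q k≢0 o₃))
  where
  q : Primitive k
  q = primitive₃ k

0³? : ∀ u → Dec (u ≡ 0³)
0³? (vec a b c) with a ℤₚ.≟ 0ℤ | b ℤₚ.≟ 0ℤ | c ℤₚ.≟ 0ℤ
... | yes refl | yes refl | yes refl = yes refl
... | no ne | _ | _ = no (λ e → ne (cong x e))
... | _ | no ne | _ = no (λ e → ne (cong y e))
... | _ | _ | no ne = no (λ e → ne (cong z e))

cross-anti : ∀ u v → cross u v ≡ 0³ → cross v u ≡ 0³
cross-anti u v e = vec-≡ (go (y u) (z v) (z u) (y v) (cong x e)) (go (z u) (x v) (x u) (z v) (cong y e)) (go (x u) (y v) (y u) (x v) (cong z e))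
  where
  lemma : ∀ a b c d → d *ℤ c -ℤ b *ℤ a ≡ -ℤ (a *ℤ b -ℤ c *ℤ d)
  lemma = solveℤ
  go : ∀ a b c d → a *ℤ b -ℤ c *ℤ d ≡ 0ℤ → d *ℤ c -ℤ b *ℤ a ≡ 0ℤ
  go a b c d e = trans (lemma a b c d) (cong -ℤ_ e)

det-rotate : ∀ u v w → det v w u ≡ det u v w
det-rotate u v w = lemma (x u) (y u) (z u) (x v) (y v) (z v) (x w) (y w) (z w)
  where
  lemma : ∀ u₁ u₂ u₃ v₁ v₂ v₃ w₁ w₂ w₃ →
    v₁ *ℤ (w₂ *ℤ u₃ -ℤ w₃ *ℤ u₂) +ℤ v₂ *ℤ (w₃ *ℤ u₁ -ℤ w₁ *ℤ u₃) +ℤ v₃ *ℤ (w₁ *ℤ u₂ -ℤ w₂ *ℤ u₁) ≡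
    u₁ *ℤ (v₂ *ℤ w₃ -ℤ v₃ *ℤ w₂) +ℤ u₂ *ℤ (v₃ *ℤ w₁ -ℤ v₁ *ℤ w₃) +ℤ u₃ *ℤ (v₁ *ℤ w₂ -ℤ v₂ *ℤ w₁)
  lemma = solveℤ

-- Split by rank: a nonzero cofactor row means rank two, vanishing cofactors with a nonzero row mean
-- rank one. Rotating the rows brings the nonzero one to the front.
small-kernel : ∀ m u v w → 1 ≤ m → Bounded m u → Bounded m v → Bounded m w → det u v w ≡ 0ℤ → SmallKernel m u v w
small-kernel m u v w 1≤m bu bv bw det≡0 with 0³? (cross v w) | 0³? (cross w u) | 0³? (cross u v)
... | no A≢0 | _ | _ = Cofactor.smallKernel m u v w 1≤m bu bv bw det≡0 A≢0
... | yes _ | no B≢0 | _ = rotate (Cofactor.smallKernel m v w u 1≤m bv bw bu (trans (det-rotate u v w) det≡0) B≢0)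
... | yes _ | yes _ | no C≢0 = rotate (rotate (Cofactor.smallKernel m w u v 1≤m bw bu bv
        (trans (det-rotate v w u) (trans (det-rotate u v w) det≡0)) C≢0))
... | yes A≡0 | yes B≡0 | yes C≡0 with 0³? u | 0³? v | 0³? w
...   | no u≢0 | _ | _ = flat-kernel 1≤m bu C≡0 (cross-anti w u B≡0) u≢0
...   | yes _ | no v≢0 | _ = rotate (flat-kernel 1≤m bv A≡0 (cross-anti u v C≡0) v≢0)
...   | yes _ | yes _ | no w≢0 = rotate (rotate (flat-kernel 1≤m bw B≡0 (cross-anti v w A≡0) w≢0))
...   | yes refl | yes refl | yes refl =
        small (vec 1ℤ 0ℤ 0ℤ) (vec 1ℤ 0ℤ 0ℤ) refl (≤-trans 1≤m (m≤n*m m 2) , z≤n , z≤n) (inj₁ (refl , refl , refl))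

-- Lattice points in planes

range : ℕ → List ℕ
range zero    = []
range (suc n) = n ∷ range n

length-range : ∀ n → length (range n) ≡ n
length-range zero    = refl
length-range (suc n) = cong suc (length-range n)

∈-range : ∀ {i n} → i < n → i ∈ range n
∈-range {i} {suc n} (s≤s i≤n) with m≤n⇒m<n∨m≡n i≤n
... | inj₁ i<n  = there (∈-range i<n)
... | inj₂ refl = here refl

∑-range-mono : ∀ {a b} F → a ≤ b → ∑ (range a) F ≤ ∑ (range b) F
∑-range-mono {a} {b} F a≤b with m≤n⇒m<n∨m≡n a≤b
... | inj₂ refl = ≤-refl
∑-range-mono {a} {suc b} F a≤b | inj₁ (s≤s a≤b′) = ≤-trans (∑-range-mono F a≤b′) (m≤n+m _ (F b))

∑-range-shift : ∀ n c F → (∑[ i ∈ range n ] F (i + c)) ≤ ∑ (range (n + c)) F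
∑-range-shift zero    c F = z≤n
∑-range-shift (suc n) c F = +-monoʳ-≤ (F (n + c)) (∑-range-shift n c F)

∑-range-suc : ∀ n F → ∑ (range (suc n)) F ≡ F 0 + ∑ (range n) (λ i → F (suc i))
∑-range-suc zero    F = refl
∑-range-suc (suc n) F = trans (cong (F (suc n) +_) (∑-range-suc n F)) (+-left-comm (F (suc n)) (F 0) _)

∑-allFin : ∀ n F → (∑[ i ∈ allFin n ] F (toℕ i)) ≡ ∑ (range n) F
∑-allFin zero    F = refl
∑-allFin (suc n) F = trans (∑-allFin-suc n (λ i → F (toℕ i)))
  (trans (cong (F 0 +_) (∑-allFin n (λ i → F (suc i)))) (sym (∑-range-suc n F)))

∑-unique : ∀ n (p : ℕ → Bool) b → (∀ i → i < n → p i ≡ true → b ≡ true) →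
           (∀ i j → i < n → j < n → p i ≡ true → p j ≡ true → i ≡ j) → (∑[ i ∈ range n ] 𝟙 (p i)) ≤ 𝟙 b
∑-unique zero    p b h uniq = z≤n
∑-unique (suc n) p b h uniq with p n in eq
... | false = ∑-unique n p b (λ i i<n → h i (m<n⇒m<1+n i<n)) (λ i j i<n j<n → uniq i j (m<n⇒m<1+n i<n) (m<n⇒m<1+n j<n))
... | true rewrite h n ≤-refl eq = s≤s (≤-trans (∑-unique n p false (λ i i<n pi → ⊥-elim (<-irrefl (uniq i n (m<n⇒m<1+n i<n) ≤-refl pi eq) i<n))
        (λ i j i<n j<n → uniq i j (m<n⇒m<1+n i<n) (m<n⇒m<1+n j<n))) z≤n)

zero? : ℤ → Bool
zero? i = does (i ℤₚ.≟ 0ℤ)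

zero?⇒ : ∀ i → zero? i ≡ true → i ≡ 0ℤ
zero?⇒ i h with i ℤₚ.≟ 0ℤ
... | yes e = e

zero?⇐ : ∀ {i} → i ≡ 0ℤ → zero? i ≡ true
zero?⇐ refl = refl

ζ : ℤ → ℕ
ζ i = 𝟙 (zero? i)

div? : ℕ → ℤ → Bool
div? R a = does (R ∣? ∣ a ∣)

div?⇒ : ∀ {R a} → div? R a ≡ true → Σ ℤ λ k → a ≡ k *ℤ ⁺ R
div?⇒ {R} {a} h with R ∣? ∣ a ∣
... | yes d with ∣ᵤ⇒∣ {⁺ R} {a} d
...   | divides k e = k , e

div?⇐ : ∀ {R a} k → a ≡ k *ℤ ⁺ R → div? R a ≡ true
div?⇐ {R} {a} k e with R ∣? ∣ a ∣
... | yes _ = refl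
... | no ¬d = ⊥-elim (¬d (∣⇒∣ᵤ {⁺ R} {a} (divides k e)))

module Box (m : ℕ) where

  w : ℕ
  w = suc (2 * m)

  I : ℕ → ℤ
  I i = ⁺ i -ℤ ⁺ m

  I-injective : ∀ {i j} → I i ≡ I j → i ≡ j
  I-injective {i} {j} e = ℤₚ.+-injective (trans (sym (lemma (⁺ i) (⁺ m))) (trans (cong (_+ℤ ⁺ m) e) (lemma (⁺ j) (⁺ m))))
    where
    lemma : ∀ a b → a -ℤ b +ℤ b ≡ a
    lemma = solveℤ

  ∣I∣≤ : ∀ i → i < w → ∣ I i ∣ ≤ m
  ∣I∣≤ i i<w with i ≤? m
  ... | yes i≤m = ≤-trans (≤-reflexive (trans (cong ∣_∣ (ℤₚ.m-n≡m⊖n i m)) (ℤₚ.∣⊖∣-≤ i≤m))) (m∸n≤m m i)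
  ... | no i≰m = ≤-trans (≤-reflexive (trans (cong ∣_∣ (trans (ℤₚ.m-n≡m⊖n i m) (ℤₚ.⊖-≥ (<⇒≤ (≰⇒> i≰m))))) refl))
                   (≤-trans (∸-monoˡ-≤ m (≤-pred i<w)) (≤-reflexive (trans (cong (_∸ m) (cong (m +_) (+-identityʳ m))) (m+n∸n≡m m m))))

  I-surjective : ∀ a → ∣ a ∣ ≤ m → Σ ℕ λ i → (i < w) × (I i ≡ a)
  I-surjective (⁺ n) le = n + m , s≤s (≤-trans (+-monoˡ-≤ m le) (≤-reflexive (cong (m +_) (sym (+-identityʳ m))))) , lemma (⁺ n) (⁺ m)
    where
    lemma : ∀ a b → a +ℤ b -ℤ b ≡ a
    lemma = solveℤ
  I-surjective a@(-[1+ n ]) le = m ∸ suc n , s≤s (≤-trans (m∸n≤m m (suc n)) (m≤m+n m _)) ,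
    trans (ℤₚ.m-n≡m⊖n (m ∸ suc n) m) (trans (ℤₚ.⊖-≤ (m∸n≤m m (suc n))) (cong (λ t → -ℤ (⁺ t)) (m∸[m∸n]≡n le)))

  solutions : ℤ → ℤ → ℤ → ℕ
  solutions a b c = ∑[ i ∈ range w ] ∑[ j ∈ range w ] ∑[ k ∈ range w ] ζ (I i *ℤ a +ℤ I j *ℤ b +ℤ I k *ℤ c)

  solutions-rotate : ∀ a b c → solutions a b c ≡ solutions b c a
  solutions-rotate a b c = trans (∑-swap (range w) (range w) _) (∑-cong (range w) λ j →
    trans (∑-swap (range w) (range w) _) (∑-cong (range w) λ k → ∑-cong (range w) λ i → cong ζ (lemma (I i *ℤ a) (I j *ℤ b) (I k *ℤ c))))
    where
    lemma : ∀ p q r → p +ℤ q +ℤ r ≡ q +ℤ r +ℤ p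
    lemma = solveℤ

  -- The solutions lie in a sublattice of index R, whose translates by (sα mod R, sβ mod R) for s < R are disjoint.
  solutions-bound : ∀ a b c α β γ → α *ℤ a +ℤ β *ℤ b +ℤ γ *ℤ c ≡ 1ℤ → c ≢ 0ℤ → solutions a b c * ∣ c ∣ ≤ (w + ∣ c ∣) * (w + ∣ c ∣)
  solutions-bound a b c α β γ bz c≢0 = begin
    solutions a b c * R
      ≡⟨ *-comm (solutions a b c) R ⟩
    R * solutions a b c
      ≡⟨ cong (_* solutions a b c) (length-range R) ⟨
    length (range R) * solutions a b c
      ≡⟨ ∑-const (range R) (solutions a b c) ⟨
    (∑[ s ∈ range R ] solutions a b c)
      ≤⟨ ∑-mono (range R) translate ⟩
    (∑[ s ∈ range R ] ∑[ i ∈ range (w + R) ] ∑[ j ∈ range (w + R) ] 𝟙 (G s i j))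
      ≡⟨ trans (∑-swap (range R) (range (w + R)) _) (∑-cong (range (w + R)) (λ i → ∑-swap (range R) (range (w + R)) _)) ⟩
    (∑[ i ∈ range (w + R) ] ∑[ j ∈ range (w + R) ] ∑[ s ∈ range R ] 𝟙 (G s i j))
      ≤⟨ ∑-mono (range (w + R)) (λ i → ∑-mono (range (w + R)) (λ j → ∑-unique R (λ s → G s i j) true (λ _ _ _ → refl) (disjoint i j))) ⟩
    (∑[ i ∈ range (w + R) ] ∑[ j ∈ range (w + R) ] 1)
      ≡⟨ trans (∑-cong (range (w + R)) (λ _ → trans (∑-const (range (w + R)) 1) (*-identityʳ _))) (∑-const (range (w + R)) _) ⟩
    length (range (w + R)) * length (range (w + R))
      ≡⟨ cong₂ _*_ (length-range (w + R)) (length-range (w + R)) ⟩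
    (w + R) * (w + R) ∎
    where
    open ≤-Reasoning
    R : ℕ
    R = ∣ c ∣
    instance
      R≢0 : NonZero R
      R≢0 = ≢-nonZeroℤ c≢0
    G : ℕ → ℕ → ℕ → Bool
    G s i j = div? R (I i *ℤ a +ℤ I j *ℤ b -ℤ ⁺ s)
    c-div : Σ ℤ λ k → c ≡ k *ℤ ⁺ R
    c-div = div?⇒ {R} {c} (div-self (R ∣? R))
      where
      open import Data.Nat.Divisibility using (∣-refl; _∣_)
      div-self : (d : Dec (R ∣ R)) → does d ≡ true
      div-self (yes _) = refl
      div-self (no ¬d) = ⊥-elim (¬d ∣-refl)
    -- As `c` is nonzero, `i` and `j` determine the third coordinate, and it exists only if `R`
    -- divides the rest of the equation.
    line : ∀ i j → (∑[ k ∈ range w ] ζ (I i *ℤ a +ℤ I j *ℤ b +ℤ I k *ℤ c)) ≤ 𝟙 (div? R (I i *ℤ a +ℤ I j *ℤ b))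
    line i j = ∑-unique w (λ k → zero? (A +ℤ I k *ℤ c)) (div? R A) hit
        (λ k k′ _ _ h h′ → I-injective (ℤₚ.*-cancelʳ-≡ (I k) (I k′) c ⦃ ≢-nonZeroℤ c≢0 ⦄
           (trans (sym (lemma (I k *ℤ c) A)) (trans (cong (_-ℤ A) (trans (zero?⇒ (A +ℤ I k *ℤ c) h) (sym (zero?⇒ (A +ℤ I k′ *ℤ c) h′)))) (lemma (I k′ *ℤ c) A)))))
      where
      A : ℤ
      A = I i *ℤ a +ℤ I j *ℤ b
      lemma : ∀ p q → q +ℤ p -ℤ q ≡ p
      lemma = solveℤ
      hit : ∀ k → k < w → zero? (A +ℤ I k *ℤ c) ≡ true → div? R A ≡ true
      hit k _ h = div?⇐ (-ℤ (I k *ℤ proj₁ c-div)) (trans (lemma″ A (I k *ℤ c)) (trans (cong (_-ℤ I k *ℤ c) (zero?⇒ (A +ℤ I k *ℤ c) h))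
          (trans (cong (λ t → 0ℤ -ℤ I k *ℤ t) (proj₂ c-div)) (lemma′ (I k) (proj₁ c-div) (⁺ R)))))
        where
        lemma″ : ∀ p q → p ≡ p +ℤ q -ℤ q
        lemma″ = solveℤ
        lemma′ : ∀ p q r → 0ℤ -ℤ p *ℤ (q *ℤ r) ≡ -ℤ (p *ℤ q) *ℤ r
        lemma′ = solveℤ
    disjoint : ∀ i j s s′ → s < R → s′ < R → G s i j ≡ true → G s′ i j ≡ true → s ≡ s′
    disjoint i j s s′ s<R s′<R h h′ with div?⇒ {R} {I i *ℤ a +ℤ I j *ℤ b -ℤ ⁺ s} h | div?⇒ {R} {I i *ℤ a +ℤ I j *ℤ b -ℤ ⁺ s′} h′
    ... | k , e | k′ , e′ = ℤₚ.+-injective (ℤₚ.i-j≡0⇒i≡j (⁺ s) (⁺ s′) (trans diff (trans (cong (_*ℤ ⁺ R) k≡) (ℤₚ.*-zeroˡ (⁺ R)))))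
      where
      A : ℤ
      A = I i *ℤ a +ℤ I j *ℤ b
      lemma : ∀ A s s′ → s -ℤ s′ ≡ (A -ℤ s′) -ℤ (A -ℤ s)
      lemma = solveℤ
      lemma′ : ∀ p q r → q *ℤ r -ℤ p *ℤ r ≡ (q -ℤ p) *ℤ r
      lemma′ = solveℤ
      diff : ⁺ s -ℤ ⁺ s′ ≡ (k′ -ℤ k) *ℤ ⁺ R
      diff = trans (lemma A (⁺ s) (⁺ s′)) (trans (cong₂ _-ℤ_ e′ e) (lemma′ k k′ (⁺ R)))
      tiny : ∣ k′ -ℤ k ∣ * R < 1 * R
      tiny = ≤-<-trans (≤-reflexive (trans (sym (ℤₚ.abs-* (k′ -ℤ k) (⁺ R))) (cong ∣_∣ (sym diff))))
        (<-≤-trans (≤-<-trans (≤-trans (≤-reflexive (cong ∣_∣ (ℤₚ.m-n≡m⊖n s s′))) (ℤₚ.∣m⊝n∣≤m⊔n s s′)) (⊔-lub s<R s′<R)) (≤-reflexive (sym (*-identityˡ R))))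
      k≡ : k′ -ℤ k ≡ 0ℤ
      k≡ = ℤₚ.∣i∣≡0⇒i≡0 (n<1⇒n≡0 (*-cancelʳ-< R ∣ k′ -ℤ k ∣ 1 tiny))
    translate : ∀ s → solutions a b c ≤ (∑[ i ∈ range (w + R) ] ∑[ j ∈ range (w + R) ] 𝟙 (G s i j))
    translate s = begin
      solutions a b c
        ≤⟨ ∑-mono (range w) (λ i → ∑-mono (range w) (λ j → ≤-trans (line i j) (𝟙-mono (move i j)))) ⟩
      (∑[ i ∈ range w ] ∑[ j ∈ range w ] 𝟙 (G s (i + q₁) (j + q₂)))
        ≤⟨ ∑-mono (range w) (λ i → ≤-trans (∑-range-shift w q₂ (λ j → 𝟙 (G s (i + q₁) j))) (∑-range-mono _ (+-monoʳ-≤ w (<⇒≤ (n%ℕd<d (⁺ s *ℤ β) R))))) ⟩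
      (∑[ i ∈ range w ] ∑[ j ∈ range (w + R) ] 𝟙 (G s (i + q₁) j))
        ≤⟨ ≤-trans (∑-range-shift w q₁ (λ i → ∑[ j ∈ range (w + R) ] 𝟙 (G s i j))) (∑-range-mono _ (+-monoʳ-≤ w (<⇒≤ (n%ℕd<d (⁺ s *ℤ α) R)))) ⟩
      (∑[ i ∈ range (w + R) ] ∑[ j ∈ range (w + R) ] 𝟙 (G s i j)) ∎
      where
      q₁ q₂ : ℕ
      q₁ = (⁺ s *ℤ α) %ℕ R
      q₂ = (⁺ s *ℤ β) %ℕ R
      k₁ k₂ : ℤ
      k₁ = (⁺ s *ℤ α) /ℕ R
      k₂ = (⁺ s *ℤ β) /ℕ R
      -- Modulo `R` the shift adds s (α a + β b) = s (1 - γ c), which is s because `R` divides `c`.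
      move : ∀ i j → div? R (I i *ℤ a +ℤ I j *ℤ b) ≡ true → G s (i + q₁) (j + q₂) ≡ true
      move i j h with div?⇒ {R} {I i *ℤ a +ℤ I j *ℤ b} h
      ... | k , e = div?⇐ (k -ℤ ⁺ s *ℤ γ *ℤ proj₁ c-div -ℤ k₁ *ℤ a -ℤ k₂ *ℤ b) (trans (r₁ (⁺ i) (⁺ q₁) (⁺ m) a (⁺ j) (⁺ q₂) b (⁺ s) k₁ k₂ (⁺ R))
        (trans (cong (λ t → A +ℤ (⁺ q₁ +ℤ k₁ *ℤ ⁺ R) *ℤ a +ℤ (⁺ q₂ +ℤ k₂ *ℤ ⁺ R) *ℤ b -ℤ k₁ *ℤ ⁺ R *ℤ a -ℤ k₂ *ℤ ⁺ R *ℤ b -ℤ ⁺ s *ℤ t) (sym bz))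
        (trans (cong₂ (λ p q → A +ℤ p *ℤ a +ℤ q *ℤ b -ℤ k₁ *ℤ ⁺ R *ℤ a -ℤ k₂ *ℤ ⁺ R *ℤ b -ℤ ⁺ s *ℤ (α *ℤ a +ℤ β *ℤ b +ℤ γ *ℤ c))
                 (sym (a≡a%ℕn+[a/ℕn]*n (⁺ s *ℤ α) R)) (sym (a≡a%ℕn+[a/ℕn]*n (⁺ s *ℤ β) R)))
        (trans (r₂ A (⁺ s) α a β b γ c k₁ k₂ (⁺ R))
        (trans (cong₂ (λ p q → p -ℤ k₁ *ℤ ⁺ R *ℤ a -ℤ k₂ *ℤ ⁺ R *ℤ b -ℤ ⁺ s *ℤ γ *ℤ q) e (proj₂ c-div))
               (r₃ k k₁ a k₂ b (⁺ s) γ (proj₁ c-div) (⁺ R)))))))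
        where
        A : ℤ
        A = I i *ℤ a +ℤ I j *ℤ b
        r₁ : ∀ i q m a j q′ b s k k′ R → (i +ℤ q -ℤ m) *ℤ a +ℤ (j +ℤ q′ -ℤ m) *ℤ b -ℤ s ≡
             ((i -ℤ m) *ℤ a +ℤ (j -ℤ m) *ℤ b) +ℤ (q +ℤ k *ℤ R) *ℤ a +ℤ (q′ +ℤ k′ *ℤ R) *ℤ b -ℤ k *ℤ R *ℤ a -ℤ k′ *ℤ R *ℤ b -ℤ s *ℤ 1ℤ
        r₁ = solveℤ
        r₂ : ∀ A s α a β b γ c k k′ R → A +ℤ s *ℤ α *ℤ a +ℤ s *ℤ β *ℤ b -ℤ k *ℤ R *ℤ a -ℤ k′ *ℤ R *ℤ b -ℤ s *ℤ (α *ℤ a +ℤ β *ℤ b +ℤ γ *ℤ c) ≡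
             A -ℤ k *ℤ R *ℤ a -ℤ k′ *ℤ R *ℤ b -ℤ s *ℤ γ *ℤ c
        r₂ = solveℤ
        r₃ : ∀ k k₁ a k₂ b s γ l R → k *ℤ R -ℤ k₁ *ℤ R *ℤ a -ℤ k₂ *ℤ R *ℤ b -ℤ s *ℤ γ *ℤ (l *ℤ R) ≡ (k -ℤ s *ℤ γ *ℤ l -ℤ k₁ *ℤ a -ℤ k₂ *ℤ b) *ℤ R
        r₃ = solveℤ

-- Singular matrices with small entries

abstract
  box : ℕ → List ℤ³
  box m = concatMap (λ i → concatMap (λ j → map (λ k → vec (I i) (I j) (I k)) (range w)) (range w)) (range w)
    where open Box m

  ∑-box : ∀ m F → ∑ (box m) F ≡ (∑[ i ∈ range (Box.w m) ] ∑[ j ∈ range (Box.w m) ] ∑[ k ∈ range (Box.w m) ]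
                                  F (vec (Box.I m i) (Box.I m j) (Box.I m k)))
  ∑-box m F = trans (∑-concatMap slice r F) (∑-cong r λ i → trans (∑-concatMap (row i) r F) (∑-cong r λ j → ∑-map (point i j) r F))
    where
    open Box m
    r : List ℕ
    r = range w
    point : ℕ → ℕ → ℕ → ℤ³
    point i j k = vec (I i) (I j) (I k)
    row : ℕ → ℕ → List ℤ³
    row i j = map (point i j) r
    slice : ℕ → List ℤ³
    slice i = concatMap (row i) r

∈-range⁻ : ∀ {i n} → i ∈ range n → i < n
∈-range⁻ {n = suc n} (here refl) = ≤-refl
∈-range⁻ {n = suc n} (there i∈)  = m<n⇒m<1+n (∈-range⁻ i∈)

∑-box-mono : ∀ m {F G} → (∀ u → Bounded m u → F u ≤ G u) → ∑ (box m) F ≤ ∑ (box m) G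
∑-box-mono m {F} {G} h = ≤-trans (≤-reflexive (∑-box m F)) (≤-trans
  (∑-mono-∈ (range w) λ i i∈ → ∑-mono-∈ (range w) λ j j∈ → ∑-mono-∈ (range w) λ k k∈ →
    h _ (∣I∣≤ i (∈-range⁻ i∈) , ∣I∣≤ j (∈-range⁻ j∈) , ∣I∣≤ k (∈-range⁻ k∈)))
  (≤-reflexive (sym (∑-box m G))))
  where open Box m

≤∑-box : ∀ m F u → Bounded m u → F u ≤ ∑ (box m) F
≤∑-box m F (vec a b c) (ba , bb , bc) = go (I-surjective a ba) (I-surjective b bb) (I-surjective c bc)
  where
  open Box m
  go : (Σ ℕ λ i → (i < w) × (I i ≡ a)) → (Σ ℕ λ i → (i < w) × (I i ≡ b)) → (Σ ℕ λ i → (i < w) × (I i ≡ c)) →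
       F (vec a b c) ≤ ∑ (box m) F
  go (i , i< , ea) (j , j< , eb) (k , k< , ec) =
    ≤-trans (≤-reflexive (cong F (vec-≡ (sym ea) (sym eb) (sym ec))))
    (≤-trans (∈⇒≤∑ (λ k → F (vec (I i) (I j) (I k))) (∈-range k<))
    (≤-trans (∈⇒≤∑ (λ j → ∑[ k ∈ range w ] F (vec (I i) (I j) (I k))) (∈-range j<))
    (≤-trans (∈⇒≤∑ (λ i → ∑[ j ∈ range w ] ∑[ k ∈ range w ] F (vec (I i) (I j) (I k))) (∈-range i<))
             (≤-reflexive (sym (∑-box m F))))))

∑-box-product : ∀ m (F G H : ℤ → ℕ) → (∑[ u ∈ box m ] F (x u) * (G (y u) * H (z u))) ≡
  (∑[ i ∈ range (Box.w m) ] F (Box.I m i)) * ((∑[ i ∈ range (Box.w m) ] G (Box.I m i)) * (∑[ i ∈ range (Box.w m) ] H (Box.I m i)))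
∑-box-product m F G H = trans (∑-box m (λ u → F (x u) * (G (y u) * H (z u)))) (trans (∑-cong (range w) λ i →
    trans (∑-cong (range w) λ j → trans (∑-*ˡ (range w) (F (I i)) (λ k → G (I j) * H (I k))) (cong (F (I i) *_) (∑-*ˡ (range w) (G (I j)) (λ k → H (I k)))))
      (trans (∑-*ˡ (range w) (F (I i)) (λ j → G (I j) * hs)) (cong (F (I i) *_) (∑-*ʳ (range w) hs (λ j → G (I j))))))
  (∑-*ʳ (range w) ((∑[ j ∈ range w ] G (I j)) * hs) (λ i → F (I i))))
  where
  open Box m
  hs : ℕ
  hs = ∑[ k ∈ range w ] H (I k)

∑-box-1 : ∀ m → (∑[ _ ∈ box m ] 1) ≡ Box.w m * (Box.w m * Box.w m)
∑-box-1 m = trans (∑-box-product m (λ _ → 1) (λ _ → 1) (λ _ → 1)) (cong₂ _*_ one (cong₂ _*_ one one))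
  where
  open Box m
  one : (∑[ _ ∈ range w ] 1) ≡ w
  one = trans (∑-const (range w) 1) (trans (*-identityʳ _) (length-range w))

hyperplane : ℕ → ℤ³ → ℕ
hyperplane m h = ∑[ u ∈ box m ] ζ (dot u h)

hyperplane-bound : ∀ m h α R → dot α h ≡ 1ℤ → 1 ≤ R → (R ≡ ∣ x h ∣ ⊎ R ≡ ∣ y h ∣) ⊎ R ≡ ∣ z h ∣ →
                   hyperplane m h * R ≤ (Box.w m + R) * (Box.w m + R)
hyperplane-bound m (vec a b c) (vec α β γ) R bz 1≤R h = ≤-trans (≤-reflexive (cong (_* R) (∑-box m (λ u → ζ (dot u (vec a b c)))))) (go R 1≤R h)
  where
  open Box m
  nz : ∀ {i} → 1 ≤ ∣ i ∣ → i ≢ 0ℤ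
  nz () refl
  turn : ∀ p q r → q +ℤ r +ℤ p ≡ p +ℤ q +ℤ r
  turn = solveℤ
  go : ∀ R → 1 ≤ R → (R ≡ ∣ a ∣ ⊎ R ≡ ∣ b ∣) ⊎ R ≡ ∣ c ∣ → solutions a b c * R ≤ (w + R) * (w + R)
  go R 1≤R (inj₂ refl) = solutions-bound a b c α β γ bz (nz 1≤R)
  go R 1≤R (inj₁ (inj₁ refl)) = ≤-trans (≤-reflexive (cong (_* R) (solutions-rotate a b c)))
    (solutions-bound b c a β γ α (trans (turn (α *ℤ a) (β *ℤ b) (γ *ℤ c)) bz) (nz 1≤R))
  go R 1≤R (inj₁ (inj₂ refl)) = ≤-trans (≤-reflexive (cong (_* R) (trans (solutions-rotate a b c) (solutions-rotate b c a))))
    (solutions-bound c a b γ α β (trans (turn (β *ℤ b) (γ *ℤ c) (α *ℤ a)) (trans (turn (α *ℤ a) (β *ℤ b) (γ *ℤ c)) bz)) (nz 1≤R))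

sup-norm : ∀ h → Σ ℕ λ R → ((R ≡ ∣ x h ∣ ⊎ R ≡ ∣ y h ∣) ⊎ R ≡ ∣ z h ∣) × Bounded R h
sup-norm (vec a b c) with ≤-total ∣ a ∣ ∣ b ∣ | ≤-total ∣ b ∣ ∣ c ∣ | ≤-total ∣ a ∣ ∣ c ∣
... | inj₁ ab | inj₁ bc | _ = ∣ c ∣ , inj₂ refl , (≤-trans ab bc , bc , ≤-refl)
... | inj₁ ab | inj₂ cb | _ = ∣ b ∣ , inj₁ (inj₂ refl) , (ab , ≤-refl , cb)
... | inj₂ ba | _ | inj₁ ac = ∣ c ∣ , inj₂ refl , (ac , ≤-trans ba ac , ≤-refl)
... | inj₂ ba | _ | inj₂ ca = ∣ a ∣ , inj₁ (inj₁ refl) , (≤-refl , ba , ca)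

norm≤ : ∀ {b R} h → (R ≡ ∣ x h ∣ ⊎ R ≡ ∣ y h ∣) ⊎ R ≡ ∣ z h ∣ → Bounded b h → R ≤ b
norm≤ h (inj₁ (inj₁ refl)) b = proj₁ b
norm≤ h (inj₁ (inj₂ refl)) b = proj₁ (proj₂ b)
norm≤ h (inj₂ refl) b = proj₂ (proj₂ b)

log-floor : ∀ J R → 1 ≤ R → R < 2 ^ J → Σ ℕ λ j → (j < J) × (2 ^ j ≤ R) × (R ≤ 2 ^ suc j)
log-floor zero    R 1≤R R<1 = ⊥-elim (<-irrefl refl (≤-<-trans 1≤R R<1))
log-floor (suc J) R 1≤R R<  with R <? 2 ^ J
... | no R≮ = J , ≤-refl , ≮⇒≥ R≮ , <⇒≤ R<
... | yes R<J with log-floor J R 1≤R R<J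
...   | j , j<J , lo , hi = j , m<n⇒m<1+n j<J , lo , hi

singular : ℕ → ℕ
singular m = ∑[ u ∈ box m ] ∑[ v ∈ box m ] ∑[ w ∈ box m ] ζ (det u v w)

∑-swap₃ : ∀ {A B : Set} (us : List A) (xs : List B) (F : A → A → A → B → ℕ) →
          (∑[ u ∈ us ] ∑[ v ∈ us ] ∑[ w ∈ us ] ∑[ i ∈ xs ] F u v w i) ≡ (∑[ i ∈ xs ] ∑[ u ∈ us ] ∑[ v ∈ us ] ∑[ w ∈ us ] F u v w i)
∑-swap₃ us xs F = trans (∑-cong us λ u → trans (∑-cong us λ v → ∑-swap us xs (λ w i → F u v w i)) (∑-swap us xs _)) (∑-swap us xs _)

module Singular (m J : ℕ) (1≤m : 1 ≤ m) (2m<2^J : 2 * m < 2 ^ J) where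

  -- The value of `(w + R) * (w + R)` at the largest norm `R = 2 * m` of a small kernel vector,
  -- hence a bound on `hyperplane m h * R` for all of them.
  Bd : ℕ
  Bd = (Box.w m + 2 * m) * (Box.w m + 2 * m)

  private
    T : ℤ³ → ℕ
    T = hyperplane m

    -- Replaces the conditions that `h` is primitive and has norm at least `2 ^ j`: only their
    -- consequence for the plane matters, so the sum may run over the whole box at level `j`.
    c : ℕ → ℤ³ → ℕ
    c j h = 𝟙 (T h * 2 ^ j ≤ᵇ Bd)

    rows cols : ℤ³ → ℤ³ → ℤ³ → ℤ³ → ℕ
    rows u v w h = ζ (dot u h) * (ζ (dot v h) * ζ (dot w h))
    cols u v w h = ζ (dot (column x u v w) h) * (ζ (dot (column y u v w) h) * ζ (dot (column z u v w) h))

    ones : ∀ {a b c} → a ≡ 0ℤ → b ≡ 0ℤ → c ≡ 0ℤ → ζ a * (ζ b * ζ c) ≡ 1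
    ones refl refl refl = refl

    covered : ∀ u v w → Bounded m u → Bounded m v → Bounded m w → zero? (det u v w) ≡ true →
              1 ≤ (∑[ j ∈ range J ] ∑[ h ∈ box (2 ^ suc j) ] c j h * (rows u v w h + cols u v w h))
    covered u v w bu bv bw hz with small-kernel m u v w 1≤m bu bv bw (zero?⇒ (det u v w) hz)
    ... | small h α bz bh ker with sup-norm h
    ... | R , R≡ , bR with log-floor J R 1≤R (≤-<-trans (norm≤ h R≡ bh) 2m<2^J)
      where
      1≤R : 1 ≤ R
      1≤R = pos R bR
        where
        pos : ∀ R → Bounded R h → 1 ≤ R
        pos (suc _) _ = s≤s z≤n
        pos zero (a , b , e) = ⊥-elim (1≢0 (trans (sym bz) (trans (cong₃ (zeroed a) (zeroed b) (zeroed e)) (lemma (x α) (y α) (z α)))))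
          where
          1≢0 : 1ℤ ≢ 0ℤ
          1≢0 ()
          zeroed : ∀ {i} → ∣ i ∣ ≤ 0 → i ≡ 0ℤ
          zeroed le = ℤₚ.∣i∣≡0⇒i≡0 (n≤0⇒n≡0 le)
          cong₃ : ∀ {p q r p′ q′ r′} → p ≡ p′ → q ≡ q′ → r ≡ r′ →
                  x α *ℤ p +ℤ y α *ℤ q +ℤ z α *ℤ r ≡ x α *ℤ p′ +ℤ y α *ℤ q′ +ℤ z α *ℤ r′
          cong₃ refl refl refl = refl
          lemma : ∀ a b c → a *ℤ 0ℤ +ℤ b *ℤ 0ℤ +ℤ c *ℤ 0ℤ ≡ 0ℤ
          lemma = solveℤ
    ... | j , j<J , lo , hi = ≤-trans (≤-reflexive (sym (*-identityˡ 1))) (≤-trans (*-mono-≤ one (kernel ker))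
        (≤-trans (≤∑-box (2 ^ suc j) (λ h → c j h * (rows u v w h + cols u v w h)) h (Bounded-mono {n = h} hi bR))
                 (∈⇒≤∑ (λ j → ∑[ h ∈ box (2 ^ suc j) ] c j h * (rows u v w h + cols u v w h)) (∈-range j<J))))
      where
      kernel : Orthogonal u v w h ⊎ Orthogonal (column x u v w) (column y u v w) (column z u v w) h → 1 ≤ rows u v w h + cols u v w h
      kernel (inj₁ (p , q , r)) = ≤-trans (≤-reflexive (sym (ones p q r))) (m≤m+n _ _)
      kernel (inj₂ (p , q , r)) = ≤-trans (≤-reflexive (sym (ones p q r))) (m≤n+m _ (rows u v w h))
      T≤ : T h * 2 ^ j ≤ Bd
      T≤ = ≤-trans (*-monoʳ-≤ (T h) lo) (≤-trans (hyperplane-bound m h α R bz (≤-trans (m^n>0 2 j) lo) R≡)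
             (*-mono-≤ (+-monoʳ-≤ (Box.w m) (norm≤ h R≡ bh)) (+-monoʳ-≤ (Box.w m) (norm≤ h R≡ bh))))
      one : 1 ≤ c j h
      one = ≤-reflexive (cong 𝟙 (sym (So⇒≡ (≤⇒≤ᵇ T≤))))

    ∑rows : ∀ h → (∑[ u ∈ box m ] ∑[ v ∈ box m ] ∑[ w ∈ box m ] rows u v w h) ≡ T h * (T h * T h)
    ∑rows h = trans (∑-cong (box m) λ u → trans (∑-cong (box m) λ v → trans (∑-*ˡ (box m) (ζ (dot u h)) _) (cong (ζ (dot u h) *_) (∑-*ˡ (box m) (ζ (dot v h)) _)))
        (trans (∑-*ˡ (box m) (ζ (dot u h)) _) (cong (ζ (dot u h) *_) (∑-*ʳ (box m) (T h) _)))) (∑-*ʳ (box m) (T h * T h) _)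

    -- The sum over three rows is a sum over nine independent entries, which can be regrouped by
    -- columns.
    ∑cols : ∀ h → (∑[ u ∈ box m ] ∑[ v ∈ box m ] ∑[ w ∈ box m ] cols u v w h) ≡ T h * (T h * T h)
    ∑cols h = trans (∑-cong (box m) λ u → trans (∑-cong (box m) λ v →
          ∑-box-product m (λ t → f (x u) (x v) t) (λ t → f (y u) (y v) t) (λ t → f (z u) (z v) t))
        (∑-box-product m (λ t → ∑[ k ∈ range w ] f (x u) t (I k)) (λ t → ∑[ k ∈ range w ] f (y u) t (I k)) (λ t → ∑[ k ∈ range w ] f (z u) t (I k))))
      (trans (∑-box-product m g g g) (cong (λ t → t * (t * t)) (sym (∑-box m (λ u → ζ (dot u h))))))
      where
      open Box m
      f : ℤ → ℤ → ℤ → ℕ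
      f p q r = ζ (dot (vec p q r) h)
      g : ℤ → ℕ
      g p = ∑[ j ∈ range w ] ∑[ k ∈ range w ] f p (I j) (I k)

    -- 1024 = 8³ · 2: the box at level `j` has at most (8 · 2 ^ j)³ vectors, and each contributes at
    -- most 2 (`Bd` / 2 ^ j)³, one cube per kernel side.
    dyadic : ∀ j → (∑[ h ∈ box (2 ^ suc j) ] c j h * (T h * (T h * T h) + T h * (T h * T h))) ≤ 1024 * (Bd * (Bd * Bd))
    dyadic j = *-cancelˡ-≤ q³ ⦃ >-nonZero (*-mono-< (m^n>0 2 j) (*-mono-< (m^n>0 2 j) (m^n>0 2 j))) ⦄ (begin
      q³ * (∑[ h ∈ box (2 ^ suc j) ] c j h * (T h * (T h * T h) + T h * (T h * T h)))
        ≡⟨ ∑-*ˡ (box (2 ^ suc j)) q³ _ ⟨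
      (∑[ h ∈ box (2 ^ suc j) ] q³ * (c j h * (T h * (T h * T h) + T h * (T h * T h))))
        ≤⟨ ∑-mono (box (2 ^ suc j)) each ⟩
      (∑[ h ∈ box (2 ^ suc j) ] 1 * (2 * B³))
        ≡⟨ ∑-*ʳ (box (2 ^ suc j)) (2 * B³) (λ _ → 1) ⟩
      (∑[ h ∈ box (2 ^ suc j) ] 1) * (2 * B³)
        ≡⟨ cong (_* (2 * B³)) (∑-box-1 (2 ^ suc j)) ⟩
      wj * (wj * wj) * (2 * B³)
        ≤⟨ *-monoˡ-≤ (2 * B³) (*-mono-≤ wj≤ (*-mono-≤ wj≤ wj≤)) ⟩
      8 * q * (8 * q * (8 * q)) * (2 * B³)
        ≡⟨ lemma q B³ ⟩
      q³ * (1024 * B³) ∎)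
      where
      open ≤-Reasoning
      q q³ B³ wj : ℕ
      q = 2 ^ j
      q³ = q * (q * q)
      B³ = Bd * (Bd * Bd)
      wj = Box.w (2 ^ suc j)
      lemma : ∀ q b → 8 * q * (8 * q * (8 * q)) * (2 * b) ≡ q * (q * q) * (1024 * b)
      lemma = solve-∀
      wj≤ : wj ≤ 8 * q
      wj≤ = ≤-trans (+-monoˡ-≤ (2 * (2 * q)) (≤-trans (m^n>0 2 j) (m≤n*m q 4))) (≤-reflexive (lemma′ q))
        where
        lemma′ : ∀ q → 4 * q + 2 * (2 * q) ≡ 8 * q
        lemma′ = solve-∀
      each : ∀ h → q³ * (c j h * (T h * (T h * T h) + T h * (T h * T h))) ≤ 1 * (2 * B³)
      each h = ≤-trans (≤-reflexive (*-left-comm q³ (c j h) _)) (≤-trans (𝟙-cases (T h * 2 ^ j ≤ᵇ Bd) _ (λ e →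
          ≤-trans (≤-reflexive (cube q (T h))) (*-monoʳ-≤ 2 (*-mono-≤ (le e) (*-mono-≤ (le e) (le e)))))) (≤-reflexive (sym (+-identityʳ _))))
        where
        cube : ∀ q t → q * (q * q) * (t * (t * t) + t * (t * t)) ≡ 2 * (t * q * (t * q * (t * q)))
        cube = solve-∀
        le : (T h * 2 ^ j ≤ᵇ Bd) ≡ true → T h * 2 ^ j ≤ Bd
        le e = ≤ᵇ⇒≤ (T h * 2 ^ j) Bd (subst So (sym e) _)

  singular≤ : singular m ≤ J * (1024 * (Bd * (Bd * Bd)))
  singular≤ = begin
    singular m
      ≤⟨ ∑-box-mono m (λ u bu → ∑-box-mono m (λ v bv → ∑-box-mono m (λ w bw → ≤-trans (≤-reflexive (sym (*-identityʳ _)))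
           (𝟙-cases (zero? (det u v w)) 1 (covered u v w bu bv bw))))) ⟩
    (∑[ u ∈ box m ] ∑[ v ∈ box m ] ∑[ w ∈ box m ] ∑[ j ∈ range J ] ∑[ h ∈ box (2 ^ suc j) ] c j h * (rows u v w h + cols u v w h))
      ≡⟨ ∑-swap₃ (box m) (range J) _ ⟩
    (∑[ j ∈ range J ] ∑[ u ∈ box m ] ∑[ v ∈ box m ] ∑[ w ∈ box m ] ∑[ h ∈ box (2 ^ suc j) ] c j h * (rows u v w h + cols u v w h))
      ≡⟨ ∑-cong (range J) (λ j → ∑-swap₃ (box m) (box (2 ^ suc j)) _) ⟩
    (∑[ j ∈ range J ] ∑[ h ∈ box (2 ^ suc j) ] ∑[ u ∈ box m ] ∑[ v ∈ box m ] ∑[ w ∈ box m ] c j h * (rows u v w h + cols u v w h))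
      ≡⟨ ∑-cong (range J) (λ j → ∑-cong (box (2 ^ suc j)) (λ h → collect j h)) ⟩
    (∑[ j ∈ range J ] ∑[ h ∈ box (2 ^ suc j) ] c j h * (T h * (T h * T h) + T h * (T h * T h)))
      ≤⟨ ∑-bound (range J) _ dyadic ⟩
    length (range J) * (1024 * (Bd * (Bd * Bd)))
      ≡⟨ cong (_* (1024 * (Bd * (Bd * Bd)))) (length-range J) ⟩
    J * (1024 * (Bd * (Bd * Bd))) ∎
    where
    open ≤-Reasoning
    collect : ∀ j h → (∑[ u ∈ box m ] ∑[ v ∈ box m ] ∑[ w ∈ box m ] c j h * (rows u v w h + cols u v w h)) ≡
                      c j h * (T h * (T h * T h) + T h * (T h * T h))
    collect j h = trans (∑-cong (box m) λ u → trans (∑-cong (box m) λ v → ∑-*ˡ (box m) (c j h) _) (∑-*ˡ (box m) (c j h) _))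
      (trans (∑-*ˡ (box m) (c j h) _) (cong (c j h *_) (trans (trans (∑-cong (box m) λ u →
        trans (∑-cong (box m) λ v → ∑-+ (box m) _ _) (∑-+ (box m) _ _)) (∑-+ (box m) _ _)) (cong₂ _+_ (∑rows h) (∑cols h)))))

-- Coplanarity of grid points

ζ-neg : ∀ {i j} → i ≡ -ℤ j → ζ i ≡ ζ j
ζ-neg {i} {j} e = cong 𝟙 (bool-ext
  (λ h → zero?⇐ {j} (trans (sym (ℤₚ.neg-involutive j)) (cong -ℤ_ (trans (sym e) (zero?⇒ i h)))))
  (λ h → zero?⇐ {i} (trans e (cong -ℤ_ (zero?⇒ j h)))))

module Grid (M : ℕ) where

  P : Set
  P = Fin M × Fin M × Fin M

  co : Fin M → ℤ
  co i = ⁺ toℕ i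

  place : P → ℤ³
  place (a , b , c) = vec (co a) (co b) (co c)

  _⊝_ : ℤ³ → ℤ³ → ℤ³
  q ⊝ p = vec (x q -ℤ x p) (y q -ℤ y p) (z q -ℤ z p)

  volume : ℤ³ → ℤ³ → ℤ³ → ℤ³ → ℤ
  volume p q r s = det (q ⊝ p) (r ⊝ p) (s ⊝ p)

  -- Coincident and collinear points count as coplanar, which is what lets general position exclude
  -- them as well.
  κ : P → P → P → P → ℕ
  κ p q r s = ζ (volume (place p) (place q) (place r) (place s))

  volume-swap₁₂ : ∀ p q r s → volume p q r s ≡ -ℤ volume q p r s
  volume-swap₁₂ p q r s = trans (cong₃ det (vec-≡ (l₁ (x p) (x q)) (l₁ (y p) (y q)) (l₁ (z p) (z q)))
      (vec-≡ (l₂ (x p) (x q) (x r)) (l₂ (y p) (y q) (y r)) (l₂ (z p) (z q) (z r)))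
      (vec-≡ (l₂ (x p) (x q) (x s)) (l₂ (y p) (y q) (y s)) (l₂ (z p) (z q) (z s))))
    (lemma (x p -ℤ x q) (y p -ℤ y q) (z p -ℤ z q) (x r -ℤ x q) (y r -ℤ y q) (z r -ℤ z q) (x s -ℤ x q) (y s -ℤ y q) (z s -ℤ z q))
    where
    cong₃ : ∀ {A B : Set} (f : A → A → A → B) {a a′ b b′ c c′} → a ≡ a′ → b ≡ b′ → c ≡ c′ → f a b c ≡ f a′ b′ c′
    cong₃ f refl refl refl = refl
    l₁ : ∀ p q → q -ℤ p ≡ -ℤ (p -ℤ q)
    l₁ = solveℤ
    l₂ : ∀ p q r → r -ℤ p ≡ (r -ℤ q) -ℤ (p -ℤ q)
    l₂ = solveℤ
    lemma : ∀ u₁ u₂ u₃ v₁ v₂ v₃ w₁ w₂ w₃ →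
      det (vec (-ℤ u₁) (-ℤ u₂) (-ℤ u₃)) (vec (v₁ -ℤ u₁) (v₂ -ℤ u₂) (v₃ -ℤ u₃)) (vec (w₁ -ℤ u₁) (w₂ -ℤ u₂) (w₃ -ℤ u₃)) ≡
      -ℤ det (vec u₁ u₂ u₃) (vec v₁ v₂ v₃) (vec w₁ w₂ w₃)
    lemma = expanded
      where
      expanded : ∀ u₁ u₂ u₃ v₁ v₂ v₃ w₁ w₂ w₃ →
        -ℤ u₁ *ℤ ((v₂ -ℤ u₂) *ℤ (w₃ -ℤ u₃) -ℤ (v₃ -ℤ u₃) *ℤ (w₂ -ℤ u₂)) +ℤ -ℤ u₂ *ℤ ((v₃ -ℤ u₃) *ℤ (w₁ -ℤ u₁) -ℤ (v₁ -ℤ u₁) *ℤ (w₃ -ℤ u₃)) +ℤ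
        -ℤ u₃ *ℤ ((v₁ -ℤ u₁) *ℤ (w₂ -ℤ u₂) -ℤ (v₂ -ℤ u₂) *ℤ (w₁ -ℤ u₁)) ≡
        -ℤ (u₁ *ℤ (v₂ *ℤ w₃ -ℤ v₃ *ℤ w₂) +ℤ u₂ *ℤ (v₃ *ℤ w₁ -ℤ v₁ *ℤ w₃) +ℤ u₃ *ℤ (v₁ *ℤ w₂ -ℤ v₂ *ℤ w₁))
      expanded = solveℤ

  det-swap₁₂ : ∀ u v w → det u v w ≡ -ℤ det v u w
  det-swap₁₂ u v w = lemma (x u) (y u) (z u) (x v) (y v) (z v) (x w) (y w) (z w)
    where
    lemma : ∀ u₁ u₂ u₃ v₁ v₂ v₃ w₁ w₂ w₃ →
      u₁ *ℤ (v₂ *ℤ w₃ -ℤ v₃ *ℤ w₂) +ℤ u₂ *ℤ (v₃ *ℤ w₁ -ℤ v₁ *ℤ w₃) +ℤ u₃ *ℤ (v₁ *ℤ w₂ -ℤ v₂ *ℤ w₁) ≡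
      -ℤ (v₁ *ℤ (u₂ *ℤ w₃ -ℤ u₃ *ℤ w₂) +ℤ v₂ *ℤ (u₃ *ℤ w₁ -ℤ u₁ *ℤ w₃) +ℤ v₃ *ℤ (u₁ *ℤ w₂ -ℤ u₂ *ℤ w₁))
    lemma = solveℤ

  det-swap₂₃ : ∀ u v w → det u v w ≡ -ℤ det u w v
  det-swap₂₃ u v w = lemma (x u) (y u) (z u) (x v) (y v) (z v) (x w) (y w) (z w)
    where
    lemma : ∀ u₁ u₂ u₃ v₁ v₂ v₃ w₁ w₂ w₃ →
      u₁ *ℤ (v₂ *ℤ w₃ -ℤ v₃ *ℤ w₂) +ℤ u₂ *ℤ (v₃ *ℤ w₁ -ℤ v₁ *ℤ w₃) +ℤ u₃ *ℤ (v₁ *ℤ w₂ -ℤ v₂ *ℤ w₁) ≡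
      -ℤ (u₁ *ℤ (w₂ *ℤ v₃ -ℤ w₃ *ℤ v₂) +ℤ u₂ *ℤ (w₃ *ℤ v₁ -ℤ w₁ *ℤ v₃) +ℤ u₃ *ℤ (w₁ *ℤ v₂ -ℤ w₂ *ℤ v₁))
    lemma = solveℤ

  abstract
    grid : List P
    grid = concatMap (λ a → concatMap (λ b → map (λ c → a , b , c) (allFin M)) (allFin M)) (allFin M)

    ∑-grid : ∀ F → ∑ grid F ≡ (∑[ a ∈ allFin M ] ∑[ b ∈ allFin M ] ∑[ c ∈ allFin M ] F (a , b , c))
    ∑-grid F = trans (∑-concatMap slice r F) (∑-cong r λ a → trans (∑-concatMap (row a) r F) (∑-cong r λ b → ∑-map (point a b) r F))
      where
      r : List (Fin M)
      r = allFin M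
      point : Fin M → Fin M → Fin M → P
      point a b c = a , b , c
      row : Fin M → Fin M → List P
      row a b = map (point a b) r
      slice : Fin M → List P
      slice a = concatMap (row a) r

  length-allFin : length (allFin M) ≡ M
  length-allFin = length-tabulate {n = M} (λ i → i)

  length-grid : length grid ≡ M * (M * M)
  length-grid = trans (sym (*-identityʳ _)) (trans (sym (∑-const grid 1)) (trans (∑-grid (λ _ → 1))
    (trans (∑-cong (allFin M) λ _ → trans (∑-cong (allFin M) λ _ → trans (∑-const (allFin M) 1) (trans (*-identityʳ _) length-allFin))
        (trans (∑-const (allFin M) M) (cong (_* M) length-allFin)))
      (trans (∑-const (allFin M) (M * M)) (cong (_* (M * M)) length-allFin)))))

  -- Subtracting `a` maps the grid coordinates injectively into the interval from -M to M, indexed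
  -- with offset `M ∸ toℕ a`.
  ∑-shift : ∀ (a : Fin M) (F : ℤ → ℕ) → (∑[ i ∈ allFin M ] F (co i -ℤ co a)) ≤ (∑[ i ∈ range (Box.w M) ] F (Box.I M i))
  ∑-shift a F = begin
    (∑[ i ∈ allFin M ] F (co i -ℤ co a))
      ≡⟨ ∑-cong (allFin M) (λ i → cong F (eq (toℕ i))) ⟩
    (∑[ i ∈ allFin M ] F (I (toℕ i + c)))
      ≡⟨ ∑-allFin M (λ i → F (I (i + c))) ⟩
    (∑[ i ∈ range M ] F (I (i + c)))
      ≤⟨ ∑-range-shift M c (λ i → F (I i)) ⟩
    (∑[ i ∈ range (M + c) ] F (I i))
      ≤⟨ ∑-range-mono (λ i → F (I i)) (≤-trans (+-monoʳ-≤ M (≤-trans (m∸n≤m M (toℕ a)) (≤-reflexive (sym (+-identityʳ M))))) (n≤1+n _)) ⟩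
    (∑[ i ∈ range w ] F (I i)) ∎
    where
    open ≤-Reasoning
    open Box M
    c : ℕ
    c = M ∸ toℕ a
    M≡ : ⁺ M ≡ ⁺ c +ℤ co a
    M≡ = cong ⁺_ (sym (m∸n+n≡m (<⇒≤ (toℕ<n a))))
    lemma : ∀ i a c → i -ℤ a ≡ i +ℤ c -ℤ (c +ℤ a)
    lemma = solveℤ
    eq : ∀ i → ⁺ i -ℤ co a ≡ I (i + c)
    eq i = trans (lemma (⁺ i) (co a) (⁺ c)) (cong (λ t → ⁺ i +ℤ ⁺ c -ℤ t) (sym M≡))

  ∑-shift³ : ∀ p F → (∑[ q ∈ grid ] F (place q ⊝ place p)) ≤ ∑ (box M) F
  ∑-shift³ (a₁ , a₂ , a₃) F = ≤-trans (≤-reflexive (∑-grid (λ q → F (place q ⊝ place (a₁ , a₂ , a₃))))) (≤-trans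
    (∑-mono (allFin M) λ i → ∑-mono (allFin M) λ j → ∑-shift a₃ (λ t → F (vec (co i -ℤ co a₁) (co j -ℤ co a₂) t)))
    (≤-trans (∑-mono (allFin M) λ i → ∑-shift a₂ (λ s → ∑[ k ∈ range w ] F (vec (co i -ℤ co a₁) s (I k))))
    (≤-trans (∑-shift a₁ (λ r → ∑[ j ∈ range w ] ∑[ k ∈ range w ] F (vec r (I j) (I k)))) (≤-reflexive (sym (∑-box M F))))))
    where open Box M

  κ-sum : ∀ a → (∑[ b ∈ grid ] ∑[ c ∈ grid ] ∑[ d ∈ grid ] κ a b c d) ≤ singular M
  κ-sum a = ≤-trans (∑-mono grid λ b → ∑-mono grid λ c → ∑-shift³ a (λ w → ζ (det (place b ⊝ place a) (place c ⊝ place a) w)))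
    (≤-trans (∑-mono grid λ b → ∑-shift³ a (λ v → ∑[ w ∈ box M ] ζ (det (place b ⊝ place a) v w)))
             (∑-shift³ a (λ u → ∑[ v ∈ box M ] ∑[ w ∈ box M ] ζ (det u v w))))

  κ-swap₁₂ : ∀ a b c d → κ a b c d ≡ κ b a c d
  κ-swap₁₂ a b c d = ζ-neg (volume-swap₁₂ (place a) (place b) (place c) (place d))

  κ-swap₂₃ : ∀ a b c d → κ a b c d ≡ κ a c b d
  κ-swap₂₃ a b c d = ζ-neg (det-swap₁₂ (place b ⊝ place a) (place c ⊝ place a) (place d ⊝ place a))

  κ-swap₃₄ : ∀ a b c d → κ a b c d ≡ κ a b d c
  κ-swap₃₄ a b c d = ζ-neg (det-swap₂₃ (place b ⊝ place a) (place c ⊝ place a) (place d ⊝ place a))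

  κ≡0⇒ : ∀ a b c d → κ a b c d ≡ 0 → volume (place a) (place b) (place c) (place d) ≢ 0ℤ
  κ≡0⇒ a b c d h e = 1≢0 (trans (sym (cong 𝟙 (zero?⇐ e))) h)
    where
    1≢0 : 1 ≢ 0
    1≢0 ()

-- Graphs

∑-lookup : ∀ {A : Set} (xs : List A) (F : A → ℕ) → (∑[ i ∈ allFin (length xs) ] F (lookupˡ xs i)) ≡ ∑ xs F
∑-lookup []       F = refl
∑-lookup (x ∷ xs) F = trans (∑-allFin-suc (length xs) (λ i → F (lookupˡ (x ∷ xs) i))) (cong (F x +_) (∑-lookup xs F))

∑-allFin-+ : ∀ n k (F : Fin (n + k) → ℕ) →
             ∑ (allFin (n + k)) F ≡ (∑[ i ∈ allFin n ] F (i ↑ˡ k)) + (∑[ j ∈ allFin k ] F (n ↑ʳ j))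
∑-allFin-+ zero    k F = refl
∑-allFin-+ (suc n) k F = trans (∑-allFin-suc (n + k) F) (trans (cong (F Fin.zero +_) (∑-allFin-+ n k (λ i → F (Fin.suc i))))
  (trans (sym (+-assoc (F Fin.zero) _ _)) (cong (_+ (∑[ j ∈ allFin k ] F (suc n ↑ʳ j))) (sym (∑-allFin-suc n (λ i → F (i ↑ˡ k)))))))

count≡∑ : ∀ {n} (p : Fin n → Bool) → count p ≡ (∑[ i ∈ allFin n ] 𝟙 (p i))
count≡∑ {zero}  p = refl
count≡∑ {suc n} p = trans (cong₂ _+_ (if≡𝟙 (p Fin.zero)) (count≡∑ (λ i → p (Fin.suc i)))) (sym (∑-allFin-suc n (λ i → 𝟙 (p i))))
  where
  if≡𝟙 : ∀ b → (if b then 1 else 0) ≡ 𝟙 b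
  if≡𝟙 true  = refl
  if≡𝟙 false = refl

sumFin≡∑ : ∀ {n} (f : Fin n → ℕ) → sumFin f ≡ ∑ (allFin n) f
sumFin≡∑ {zero}  f = refl
sumFin≡∑ {suc n} f = trans (cong (f Fin.zero +_) (sumFin≡∑ (λ i → f (Fin.suc i)))) (sym (∑-allFin-suc n f))

module _ {n : ℕ} (G : Graph n) where

  arc : Fin n → Fin n → Bool
  arc i j = adj G i j ∧ (toℕ i <ᵇ toℕ j)

  edgeCount≡∑ : edgeCount G ≡ (∑[ i ∈ allFin n ] ∑[ j ∈ allFin n ] 𝟙 (arc i j))
  edgeCount≡∑ = trans (sumFin≡∑ (λ i → count (arc i))) (∑-cong (allFin n) (λ i → count≡∑ (arc i)))

  card edgesIn : (Fin n → Bool) → ℕ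
  card X = ∑[ v ∈ allFin n ] 𝟙 (X v)
  edgesIn X = ∑[ i ∈ allFin n ] ∑[ j ∈ allFin n ] 𝟙 (arc i j) * 𝟙 (X i ∧ X j)

  edgesIn≤n : ∀ X → edgesIn X ≤ n * card X
  edgesIn≤n X = ≤-trans (∑-mono (allFin n) λ i → ≤-trans (∑-bound (allFin n) (𝟙 (X i)) (λ j →
      ≤-trans (𝟙* (arc i j) _) (𝟙-mono (λ h → proj₁ (∧-true (X i) h)))))
      (≤-reflexive (cong (_* 𝟙 (X i)) (length-tabulate {n = n} (λ i → i)))))
    (≤-reflexive (∑-*ˡ (allFin n) n _))

  private
    induced : (Fin n → Bool) → Subgraph G
    induced X = record
      { S = X
      ; F = λ u v → adj G u v ∧ (X u ∧ X v)
      ; F-sym = λ u v → cong₂ _∧_ (adj-sym G u v) (bool-ext (flip∧ (X u)) (flip∧ (X v)))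
      ; F⊆G = λ u v h → proj₁ (∧-true (adj G u v) h)
      ; F-S = λ u v h → proj₁ (∧-true (X u) (∧-trueʳ (adj G u v) h)) }
      where
      flip∧ : ∀ a {b} → a ∧ b ≡ true → b ∧ a ≡ true
      flip∧ true {true} _ = refl

    without : (Fin n → Bool) → Fin n → Fin n → Bool
    without X v u = X u ∧ not (u == v)

    card-without : ∀ X v → X v ≡ true → card X ≡ suc (card (without X v))
    card-without X v Xv = trans (∑-cong (allFin n) split) (trans (∑-+ (allFin n) _ _)
        (cong (_+ card (without X v)) (trans (∑-cong (allFin n) (λ u → sym (*-identityʳ (𝟙 (u == v))))) (∑-δ n v (λ _ → 1)))))
      where
      split : ∀ u → 𝟙 (X u) ≡ 𝟙 (u == v) + 𝟙 (without X v u)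
      split u with u ≟ v
      ... | yes refl rewrite Xv = refl
      ... | no _ = cong 𝟙 (sym (∧-identityʳ (X u)))
        where open import Data.Bool.Properties using (∧-identityʳ)

    arc-split : ∀ v j → 𝟙 (arc v j) + 𝟙 (arc j v) ≤ 𝟙 (adj G v j)
    arc-split v j rewrite adj-sym G j v with adj G v j | toℕ v <ᵇ toℕ j in e₁ | toℕ j <ᵇ toℕ v in e₂
    ... | false | _ | _ = z≤n
    ... | true | false | b = 𝟙≤1 b
    ... | true | true | false = ≤-refl
    ... | true | true | true = ⊥-elim (<-asym (<ᵇ⇒< (toℕ v) (toℕ j) (subst So (sym e₁) _)) (<ᵇ⇒< (toℕ j) (toℕ v) (subst So (sym e₂) _)))

    edgesIn-without : ∀ X v → X v ≡ true → edgesIn X ≤ edgesIn (without X v) + degreeIn (induced X) v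
    edgesIn-without X v Xv = begin
      edgesIn X
        ≤⟨ ∑-mono Vs (λ i → ∑-mono Vs (λ j → split i j)) ⟩
      (∑[ i ∈ Vs ] ∑[ j ∈ Vs ] a i j * 𝟙 (X′ i ∧ X′ j) + (𝟙 (i == v) * (a i j * 𝟙 (X j)) + 𝟙 (j == v) * (a i j * 𝟙 (X i))))
        ≡⟨ trans (∑-cong Vs inner) (∑-+ Vs _ _) ⟩
      edgesIn X′ + (∑[ i ∈ Vs ] 𝟙 (i == v) * (∑[ j ∈ Vs ] a i j * 𝟙 (X j)) + a i v * 𝟙 (X i))
        ≡⟨ cong (edgesIn X′ +_) (trans (∑-+ Vs _ _) (cong (_+ (∑[ i ∈ Vs ] a i v * 𝟙 (X i))) (∑-δ n v (λ i → ∑[ j ∈ Vs ] a i j * 𝟙 (X j))))) ⟩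
      edgesIn X′ + ((∑[ j ∈ Vs ] a v j * 𝟙 (X j)) + (∑[ i ∈ Vs ] a i v * 𝟙 (X i)))
        ≡⟨ cong (edgesIn X′ +_) (∑-+ Vs _ _) ⟨
      edgesIn X′ + (∑[ j ∈ Vs ] a v j * 𝟙 (X j) + a j v * 𝟙 (X j))
        ≤⟨ +-monoʳ-≤ (edgesIn X′) (∑-mono Vs join) ⟩
      edgesIn X′ + (∑[ j ∈ Vs ] 𝟙 (adj G v j ∧ (X v ∧ X j)))
        ≡⟨ cong (edgesIn X′ +_) (count≡∑ (F (induced X) v)) ⟨
      edgesIn X′ + degreeIn (induced X) v ∎
      where
      open ≤-Reasoning
      Vs = allFin n
      a : Fin n → Fin n → ℕ
      a i j = 𝟙 (arc i j)
      X′ = without X v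
      inner : ∀ i → (∑[ j ∈ Vs ] a i j * 𝟙 (X′ i ∧ X′ j) + (𝟙 (i == v) * (a i j * 𝟙 (X j)) + 𝟙 (j == v) * (a i j * 𝟙 (X i)))) ≡
              (∑[ j ∈ Vs ] a i j * 𝟙 (X′ i ∧ X′ j)) + (𝟙 (i == v) * (∑[ j ∈ Vs ] a i j * 𝟙 (X j)) + a i v * 𝟙 (X i))
      inner i = trans (∑-+ Vs A₁ (λ j → A₂ j + A₃ j)) (cong (∑ Vs A₁ +_) (trans (∑-+ Vs A₂ A₃)
          (cong₂ _+_ (∑-*ˡ Vs (𝟙 (i == v)) (λ j → a i j * 𝟙 (X j))) (∑-δ n v (λ j → a i j * 𝟙 (X i))))))
        where
        A₁ A₂ A₃ : Fin n → ℕ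
        A₁ j = a i j * 𝟙 (X′ i ∧ X′ j)
        A₂ j = 𝟙 (i == v) * (a i j * 𝟙 (X j))
        A₃ j = 𝟙 (j == v) * (a i j * 𝟙 (X i))
      join : ∀ j → a v j * 𝟙 (X j) + a j v * 𝟙 (X j) ≤ 𝟙 (adj G v j ∧ (X v ∧ X j))
      join j = ≤-trans (≤-reflexive (sym (*-distribʳ-+ (𝟙 (X j)) (a v j) (a j v)))) (≤-trans (*-monoˡ-≤ (𝟙 (X j)) (arc-split v j))
        (≤-reflexive (trans (sym (𝟙-∧ (adj G v j) (X j))) (cong (λ b → 𝟙 (adj G v j ∧ (b ∧ X j))) (sym Xv)))))
      split : ∀ i j → a i j * 𝟙 (X i ∧ X j) ≤ a i j * 𝟙 (X′ i ∧ X′ j) + (𝟙 (i == v) * (a i j * 𝟙 (X j)) + 𝟙 (j == v) * (a i j * 𝟙 (X i)))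
      split i j = go (X i) (X j) (i == v) (j == v)
        where
        go : ∀ p q r s → a i j * 𝟙 (p ∧ q) ≤ a i j * 𝟙 ((p ∧ not r) ∧ (q ∧ not s)) + (𝟙 r * (a i j * 𝟙 q) + 𝟙 s * (a i j * 𝟙 p))
        go false q r s = ≤-trans (≤-reflexive (*-zeroʳ (a i j))) z≤n
        go true false r s = ≤-trans (≤-reflexive (*-zeroʳ (a i j))) z≤n
        go true true false false = m≤m+n _ _
        go true true true s = ≤-trans (≤-trans (m≤m+n (a i j * 1) 0) (m≤m+n (a i j * 1 + 0) (𝟙 s * (a i j * 1)))) (m≤n+m _ (a i j * 0))
        go true true false true = ≤-trans (m≤m+n (a i j * 1) 0) (m≤n+m (a i j * 1 + 0) (a i j * 0))

  edgesIn-empty : ∀ X → card X ≡ 0 → edgesIn X ≡ 0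
  edgesIn-empty X h = n≤0⇒n≡0 (≤-trans (edgesIn≤n X) (≤-reflexive (trans (cong (n *_) h) (*-zeroʳ n))))

  -- A vertex of degree at most `D` in the induced subgraph is removed from `X`; at most `D` edges
  -- disappear with it.
  degenerate⇒sparse : ∀ D → Degenerate D G → ∀ X → edgesIn X ≤ D * card X
  degenerate⇒sparse D deg X = go (card X) X refl
    where
    go : ∀ c X → card X ≡ c → edgesIn X ≤ D * c
    go zero    X h = ≤-trans (≤-reflexive (edgesIn-empty X h)) z≤n
    go (suc c) X h with ∑-pos⇒∃ (allFin n) (subst (0 <_) (sym h) (s≤s z≤n))
    ... | u , Xu with deg (induced X) (u , 𝟙-pos (X u) Xu)
      where
      𝟙-pos : ∀ b → 0 < 𝟙 b → b ≡ true
      𝟙-pos true _ = refl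
    ... | v , Xv , dv = ≤-trans (edgesIn-without X v Xv)
        (≤-trans (+-mono-≤ (go c (without X v) (suc-injective (trans (sym (card-without X v Xv)) h))) dv)
          (≤-reflexive (trans (+-comm (D * c) D) (sym (*-suc D c)))))

-- Drawings

_⊕_ : ℤ³ → ℤ³ → ℤ³
u ⊕ v = vec (x u +ℤ x v) (y u +ℤ y v) (z u +ℤ z v)

•-dot : ∀ d u v → dot (d • u) v ≡ d *ℤ dot u v
•-dot d u v = lemma d (x u) (y u) (z u) (x v) (y v) (z v)
  where
  lemma : ∀ d a b c p q r → d *ℤ a *ℤ p +ℤ d *ℤ b *ℤ q +ℤ d *ℤ c *ℤ r ≡ d *ℤ (a *ℤ p +ℤ b *ℤ q +ℤ c *ℤ r)
  lemma = solveℤ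

det-combination : ∀ B C v w → det ((B • v) ⊕ (C • w)) v w ≡ 0ℤ
det-combination B C v w = lemma B C (x v) (y v) (z v) (x w) (y w) (z w)
  where
  lemma : ∀ B C v₁ v₂ v₃ w₁ w₂ w₃ →
    (B *ℤ v₁ +ℤ C *ℤ w₁) *ℤ (v₂ *ℤ w₃ -ℤ v₃ *ℤ w₂) +ℤ (B *ℤ v₂ +ℤ C *ℤ w₂) *ℤ (v₃ *ℤ w₁ -ℤ v₁ *ℤ w₃) +ℤ
    (B *ℤ v₃ +ℤ C *ℤ w₃) *ℤ (v₁ *ℤ w₂ -ℤ v₂ *ℤ w₁) ≡ 0ℤ
  lemma = solveℤ

coplanar⇒det : ∀ A B C u v w → A ≢ 0ℤ → A • u ≡ (B • v) ⊕ (C • w) → det u v w ≡ 0ℤ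
coplanar⇒det A B C u v w A≢0 e = cancelℤ A A≢0 (trans (sym (•-dot A u (cross v w)))
  (trans (cong (λ t → det t v w) e) (det-combination B C v w)))

parallel⇒det : ∀ A B u v w → A ≢ 0ℤ → A • u ≡ B • v → det u v w ≡ 0ℤ
parallel⇒det A B u v w A≢0 e = coplanar⇒det A B 0ℤ u v w A≢0 (trans e (vec-≡ (pad (x v) (x w)) (pad (y v) (y w)) (pad (z v) (z w))))
  where
  pad : ∀ p q → B *ℤ p ≡ B *ℤ p +ℤ 0ℤ *ℤ q
  pad p q = lemma (B *ℤ p) q
    where
    lemma : ∀ a q → a ≡ a +ℤ 0ℤ *ℤ q
    lemma = solveℤ

⁺≢0 : ∀ {n} → 0 < n → ⁺ n ≢ 0ℤ
⁺≢0 (s≤s _) ()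

*≢0 : ∀ {i j} → i ≢ 0ℤ → j ≢ 0ℤ → i *ℤ j ≢ 0ℤ
*≢0 {i} i≢0 j≢0 e = j≢0 (cancelℤ i i≢0 e)

segment-ℤ : ∀ a b p q w → a ≤ b → b * w ≡ (b ∸ a) * p + a * q → ⁺ b *ℤ (⁺ w -ℤ ⁺ p) ≡ ⁺ a *ℤ (⁺ q -ℤ ⁺ p)
segment-ℤ a b p q w a≤b e = trans (l₁ (⁺ b) (⁺ w) (⁺ p)) (trans (cong₂ (λ s t → s -ℤ t *ℤ ⁺ p) e′ b≡) (l₂ (⁺ (b ∸ a)) (⁺ a) (⁺ p) (⁺ q)))
  where
  b≡ : ⁺ b ≡ ⁺ (b ∸ a) +ℤ ⁺ a
  b≡ = cong ⁺_ (sym (m∸n+n≡m a≤b))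
  e′ : ⁺ b *ℤ ⁺ w ≡ ⁺ (b ∸ a) *ℤ ⁺ p +ℤ ⁺ a *ℤ ⁺ q
  e′ = trans (sym (ℤₚ.pos-* b w)) (trans (cong ⁺_ e) (cong₂ _+ℤ_ (ℤₚ.pos-* (b ∸ a) p) (ℤₚ.pos-* a q)))
  l₁ : ∀ b w p → b *ℤ (w -ℤ p) ≡ b *ℤ w -ℤ b *ℤ p
  l₁ = solveℤ
  l₂ : ∀ e a p q → e *ℤ p +ℤ a *ℤ q -ℤ (e +ℤ a) *ℤ p ≡ a *ℤ (q -ℤ p)
  l₂ = solveℤ

-- The crossing equation with `p` moved to the origin, so that it becomes a linear relation between
-- three edge vectors.
crossing-ℤ : ∀ a b c d p q r t → a ≤ b → c ≤ d → d * ((b ∸ a) * p + a * q) ≡ b * ((d ∸ c) * r + c * t) →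
             ⁺ d *ℤ ⁺ a *ℤ (⁺ q -ℤ ⁺ p) ≡ ⁺ b *ℤ ⁺ (d ∸ c) *ℤ (⁺ r -ℤ ⁺ p) +ℤ ⁺ b *ℤ ⁺ c *ℤ (⁺ t -ℤ ⁺ p)
crossing-ℤ a b c d p q r t a≤b c≤d e =
  trans (l₁ (⁺ d) (⁺ (b ∸ a)) (⁺ a) (⁺ p) (⁺ q)) (trans (cong₂ (λ s u → s -ℤ ⁺ d *ℤ u *ℤ ⁺ p) e′ (sym b≡))
  (trans (cong (λ u → ⁺ b *ℤ (⁺ (d ∸ c) *ℤ ⁺ r +ℤ ⁺ c *ℤ ⁺ t) -ℤ u *ℤ ⁺ b *ℤ ⁺ p) d≡) (l₂ (⁺ b) (⁺ (d ∸ c)) (⁺ c) (⁺ p) (⁺ r) (⁺ t))))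
  where
  b≡ : ⁺ b ≡ ⁺ (b ∸ a) +ℤ ⁺ a
  b≡ = cong ⁺_ (sym (m∸n+n≡m a≤b))
  d≡ : ⁺ d ≡ ⁺ (d ∸ c) +ℤ ⁺ c
  d≡ = cong ⁺_ (sym (m∸n+n≡m c≤d))
  push : ∀ k m p n q → ⁺ (k * (m * p + n * q)) ≡ ⁺ k *ℤ (⁺ m *ℤ ⁺ p +ℤ ⁺ n *ℤ ⁺ q)
  push k m p n q = trans (ℤₚ.pos-* k _) (cong (⁺ k *ℤ_) (cong₂ _+ℤ_ (ℤₚ.pos-* m p) (ℤₚ.pos-* n q)))
  e′ : ⁺ d *ℤ (⁺ (b ∸ a) *ℤ ⁺ p +ℤ ⁺ a *ℤ ⁺ q) ≡ ⁺ b *ℤ (⁺ (d ∸ c) *ℤ ⁺ r +ℤ ⁺ c *ℤ ⁺ t)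
  e′ = trans (sym (push d (b ∸ a) p a q)) (trans (cong ⁺_ e) (push b (d ∸ c) r c t))
  l₁ : ∀ d e a p q → d *ℤ a *ℤ (q -ℤ p) ≡ d *ℤ (e *ℤ p +ℤ a *ℤ q) -ℤ d *ℤ (e +ℤ a) *ℤ p
  l₁ = solveℤ
  l₂ : ∀ b g c p r t → b *ℤ (g *ℤ r +ℤ c *ℤ t) -ℤ (g +ℤ c) *ℤ b *ℤ p ≡ b *ℤ g *ℤ (r -ℤ p) +ℤ b *ℤ c *ℤ (t -ℤ p)
  l₂ = solveℤ

module Geometry {n : ℕ} (G : Graph n) (M : ℕ) (pt pt′ : Fin n → Grid.P M) where
  open Grid M

  private
    at : Fin n → ℤ³
    at v = place (pt v)

    at′ : Fin n → ℤ³
    at′ v = place (pt′ v)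

    coord : P → Point
    coord (a , b , c) 0F                       = toℕ a
    coord (a , b , c) 1F             = toℕ b
    coord (a , b , c) 2F   = toℕ c

    coord< : ∀ p i → coord p i < M
    coord< (a , b , c) 0F                     = toℕ<n a
    coord< (a , b , c) 1F           = toℕ<n b
    coord< (a , b , c) 2F = toℕ<n c

    Position : Fin n → Point
    Position v = coord (pt v)

    place-coord : ∀ p → place p ≡ vec (⁺ coord p 0F) (⁺ coord p 1F) (⁺ coord p 2F)
    place-coord (a , b , c) = refl

  module _ (triples : ∀ u v w → adj G u v ≡ true → w ≢ u → w ≢ v → volume (at u) (at v) (at w) (at′ w) ≢ 0ℤ)
           (quadruples : ∀ u v r s → adj G u v ≡ true → adj G r s ≡ true → u ≢ r → u ≢ s → v ≢ r → v ≢ s →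
                         volume (at u) (at v) (at r) (at s) ≢ 0ℤ)
           (pairs : ∀ u v → u ≢ v → volume (at u) (at′ u) (at v) (at′ v) ≢ 0ℤ) where

    private
      irreflexive : ∀ {u v} → adj G u v ≡ true → u ≢ v
      irreflexive {u} h refl with trans (sym h) (irrefl G u)
      ... | ()

      det-zero₂ : ∀ u w → det u 0³ w ≡ 0ℤ
      det-zero₂ u w = lemma (x u) (y u) (z u) (x w) (y w) (z w)
        where
        lemma : ∀ a b c p q r → a *ℤ (0ℤ *ℤ r -ℤ 0ℤ *ℤ q) +ℤ b *ℤ (0ℤ *ℤ p -ℤ 0ℤ *ℤ r) +ℤ c *ℤ (0ℤ *ℤ q -ℤ 0ℤ *ℤ p) ≡ 0ℤ
        lemma = solveℤ

      at-≡ : ∀ u v → (∀ i → Position u i ≡ Position v i) → at u ≡ at v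
      at-≡ u v h = trans (place-coord (pt u)) (trans (vec-≡ (cong ⁺_ (h 0F)) (cong ⁺_ (h 1F)) (cong ⁺_ (h 2F))) (sym (place-coord (pt v))))

      ⊝-self : ∀ p → p ⊝ p ≡ 0³
      ⊝-self p = vec-≡ (ℤₚ.+-inverseʳ (x p)) (ℤₚ.+-inverseʳ (y p)) (ℤₚ.+-inverseʳ (z p))

      different : ∀ u v → u ≢ v → ¬ (∀ i → Position u i ≡ Position v i)
      different u v u≢v h = pairs u v u≢v (trans (cong (λ t → det (at′ u ⊝ at u) t (at′ v ⊝ at u))
          (trans (cong (_⊝ at u) (sym (at-≡ u v h))) (⊝-self (at u)))) (det-zero₂ (at′ u ⊝ at u) (at′ v ⊝ at u)))

      find : ∀ u v → u ≢ v → Σ (Fin 3) λ i → Position u i ≢ Position v i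
      find u v u≢v with Position u 0F ≟ℕ Position v 0F | Position u 1F ≟ℕ Position v 1F
                      | Position u 2F ≟ℕ Position v 2F
      ... | no ne | _ | _ = 0F , ne
      ... | yes _ | no ne | _ = 1F , ne
      ... | yes _ | yes _ | no ne = 2F , ne
      ... | yes a | yes b | yes c = ⊥-elim (different u v u≢v (λ { 0F → a ; 1F → b ; 2F → c }))

      on-segment : ∀ u v w a b → 0 < b → a ≤ b → (∀ i → b * Position w i ≡ (b ∸ a) * Position u i + a * Position v i) →
                   det (at v ⊝ at u) (at w ⊝ at u) (at′ w ⊝ at u) ≡ 0ℤ
      on-segment u v w a b 0<b a≤b h = trans (det-swap₁₂ (at v ⊝ at u) (at w ⊝ at u) (at′ w ⊝ at u)) (cong -ℤ_
          (parallel⇒det (⁺ b) (⁺ a) (at w ⊝ at u) (at v ⊝ at u) (at′ w ⊝ at u) (⁺≢0 0<b)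
            (vec-≡ (segment-ℤ a b _ _ _ a≤b (h 0F)) (segment-ℤ a b _ _ _ a≤b (h 1F))
                   (segment-ℤ a b _ _ _ a≤b (h 2F)))))

      relation : ∀ u v r s a b c d → a < b → c < d →
        (∀ i → d * ((b ∸ a) * Position u i + a * Position v i) ≡ b * ((d ∸ c) * Position r i + c * Position s i)) →
        (⁺ d *ℤ ⁺ a) • (at v ⊝ at u) ≡ ((⁺ b *ℤ ⁺ (d ∸ c)) • (at r ⊝ at u)) ⊕ ((⁺ b *ℤ ⁺ c) • (at s ⊝ at u))
      relation u v r s a b c d a<b c<d h = vec-≡ (go 0F) (go 1F) (go 2F)
        where
        go : ∀ i → ⁺ d *ℤ ⁺ a *ℤ (⁺ Position v i -ℤ ⁺ Position u i) ≡
                   ⁺ b *ℤ ⁺ (d ∸ c) *ℤ (⁺ Position r i -ℤ ⁺ Position u i) +ℤ ⁺ b *ℤ ⁺ c *ℤ (⁺ Position s i -ℤ ⁺ Position u i)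
        go i = crossing-ℤ a b c d (Position u i) (Position v i) (Position r i) (Position s i) (<⇒≤ a<b) (<⇒≤ c<d) (h i)

      drop-first : ∀ B p w {u} → u ≡ (B • (p ⊝ p)) ⊕ w → u ≡ w
      drop-first B p w e = trans e (vec-≡ (lemma B (x p) (x w)) (lemma B (y p) (y w)) (lemma B (z p) (z w)))
        where
        lemma : ∀ B p w → B *ℤ (p -ℤ p) +ℤ w ≡ w
        lemma = solveℤ

      ⊕-comm : ∀ u v → u ⊕ v ≡ v ⊕ u
      ⊕-comm u v = vec-≡ (ℤₚ.+-comm (x u) (x v)) (ℤₚ.+-comm (y u) (y v)) (ℤₚ.+-comm (z u) (z v))

      move : ∀ A B C v w → A • v ≡ (B • v) ⊕ (C • w) → C • w ≡ (A -ℤ B) • v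
      move A B C v w e = vec-≡ (one (x v) (x w) (cong x e)) (one (y v) (y w) (cong y e)) (one (z v) (z w) (cong z e))
        where
        l₁ : ∀ B C p q → C *ℤ q ≡ (B *ℤ p +ℤ C *ℤ q) -ℤ B *ℤ p
        l₁ = solveℤ
        l₂ : ∀ A B p → A *ℤ p -ℤ B *ℤ p ≡ (A -ℤ B) *ℤ p
        l₂ = solveℤ
        one : ∀ p q → A *ℤ p ≡ B *ℤ p +ℤ C *ℤ q → C *ℤ q ≡ (A -ℤ B) *ℤ p
        one p q e = trans (l₁ B C p q) (trans (cong (_-ℤ B *ℤ p) (sym e)) (l₂ A B p))

      collinear : ∀ A B v w t → A ≢ 0ℤ → A • w ≡ B • v → det v w t ≡ 0ℤ
      collinear A B v w t A≢0 e = trans (det-swap₁₂ v w t) (cong -ℤ_ (parallel⇒det A B w v t A≢0 e))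

      -- For edges with a common end an interior crossing makes the three ends collinear, hence
      -- coplanar with the pendant of the third end, against `triples`. For disjoint edges it makes
      -- the four ends coplanar, against `quadruples`.
      crossing : ∀ u v r s a b c d → 0 < a → a < b → 0 < c → c < d → adj G u v ≡ true → adj G r s ≡ true →
        ¬ (u ≡ r × v ≡ s) → ¬ (u ≡ s × v ≡ r) →
        (⁺ d *ℤ ⁺ a) • (at v ⊝ at u) ≡ ((⁺ b *ℤ ⁺ (d ∸ c)) • (at r ⊝ at u)) ⊕ ((⁺ b *ℤ ⁺ c) • (at s ⊝ at u)) → ⊥
      crossing u v r s a b c d 0<a a<b 0<c c<d uv rs ne₁ ne₂ e = cases (u ≟ r) (u ≟ s) (v ≟ r) (v ≟ s)
        where
        A B C : ℤ
        A = ⁺ d *ℤ ⁺ a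
        B = ⁺ b *ℤ ⁺ (d ∸ c)
        C = ⁺ b *ℤ ⁺ c
        A≢0 : A ≢ 0ℤ
        A≢0 = *≢0 (⁺≢0 (<-trans 0<c c<d)) (⁺≢0 0<a)
        B≢0 : B ≢ 0ℤ
        B≢0 = *≢0 (⁺≢0 (<-trans 0<a a<b)) (⁺≢0 (m<n⇒0<n∸m c<d))
        C≢0 : C ≢ 0ℤ
        C≢0 = *≢0 (⁺≢0 (<-trans 0<a a<b)) (⁺≢0 0<c)
        cases : Dec (u ≡ r) → Dec (u ≡ s) → Dec (v ≡ r) → Dec (v ≡ s) → ⊥
        cases (yes refl) _ _ _ = triples u v s uv (λ { refl → irreflexive rs refl }) (λ { refl → ne₁ (refl , refl) })
          (parallel⇒det A C (at v ⊝ at u) (at s ⊝ at u) (at′ s ⊝ at u) A≢0 (drop-first B (at u) (C • (at s ⊝ at u)) e))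
        cases (no _) (yes refl) _ _ = triples u v r uv (λ { refl → irreflexive rs refl }) (λ { refl → ne₂ (refl , refl) })
          (parallel⇒det A B (at v ⊝ at u) (at r ⊝ at u) (at′ r ⊝ at u) A≢0
            (drop-first C (at u) (B • (at r ⊝ at u)) (trans e (⊕-comm (B • (at r ⊝ at u)) (C • (at u ⊝ at u))))))
        cases (no u≢r) (no u≢s) (yes refl) _ = triples u v s uv (λ { refl → u≢s refl }) (λ { refl → irreflexive rs refl })
          (collinear C (A -ℤ B) (at v ⊝ at u) (at s ⊝ at u) (at′ s ⊝ at u) C≢0 (move A B C (at v ⊝ at u) (at s ⊝ at u) e))
        cases (no u≢r) (no u≢s) (no _) (yes refl) = triples u v r uv (λ { refl → u≢r refl }) (λ { refl → irreflexive rs refl })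
          (collinear B (A -ℤ C) (at v ⊝ at u) (at r ⊝ at u) (at′ r ⊝ at u) B≢0
            (move A C B (at v ⊝ at u) (at r ⊝ at u) (trans e (⊕-comm (B • (at r ⊝ at u)) (C • (at v ⊝ at u))))))
        cases (no u≢r) (no u≢s) (no v≢r) (no v≢s) = quadruples u v r s uv rs u≢r u≢s v≢r v≢s
          (coplanar⇒det A B C (at v ⊝ at u) (at r ⊝ at u) (at s ⊝ at u) A≢0 e)

    drawing : GridDrawing G M
    drawing = record
      { pos = Position
      ; inGrid = λ v i → coord< (pt v) i
      ; distinct = find
      ; noVertexOnEdge = λ { u v w uv w≢u w≢v (a , b , 0<b , a≤b , h) → triples u v w uv w≢u w≢v (on-segment u v w a b 0<b a≤b h) }
      ; noCrossing = λ { u v r s uv rs ne₁ ne₂ (a , b , c , d , 0<a , a<b , 0<c , c<d , h) →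
          crossing u v r s a b c d 0<a a<b 0<c c<d uv rs ne₁ ne₂ (relation u v r s a b c d a<b c<d h) } }

-- A pendant vertex is attached to every vertex.  Then general position of disjoint edges
-- already excludes coincident vertices and vertices on edges.
module Pendants {n : ℕ} (G : Graph n) where

  inl inr : Fin n → Fin (n + n)
  inl i = i ↑ˡ n
  inr i = n ↑ʳ i

  private
    arcs : Fin n → Fin n → List (Fin (n + n) × Fin (n + n))
    arcs i j = if arc G i j then (inl i , inl j) ∷ [] else []

    base pendant edges : List (Fin (n + n) × Fin (n + n))
    base = concatMap (λ i → concatMap (arcs i) (allFin n)) (allFin n)
    pendant = map (λ i → inl i , inr i) (allFin n)
    edges = base ++ pendant

    ∑-edges : ∀ F → ∑ edges F ≡ (∑[ i ∈ allFin n ] ∑[ j ∈ allFin n ] 𝟙 (arc G i j) * F (inl i , inl j)) + (∑[ i ∈ allFin n ] F (inl i , inr i))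
    ∑-edges F = trans (∑-++ base pendant F) (cong₂ _+_
        (trans (∑-concatMap (λ i → concatMap (arcs i) (allFin n)) (allFin n) F) (∑-cong (allFin n) λ i →
          trans (∑-concatMap (arcs i) (allFin n) F) (∑-cong (allFin n) λ j → one i j (arc G i j))))
        (∑-map _ (allFin n) F))
      where
      one : ∀ i j b → ∑ (if b then (inl i , inl j) ∷ [] else []) F ≡ 𝟙 b * F (inl i , inl j)
      one i j true  = refl
      one i j false = refl

  size : ℕ
  size = length edges

  src tgt : Fin size → Fin (n + n)
  src e = proj₁ (lookupˡ edges e)
  tgt e = proj₂ (lookupˡ edges e)

  size≡ : size ≡ edgeCount G + n
  size≡ = trans (sym (*-identityʳ size)) (trans (sym (∑-const edges 1)) (trans (∑-edges (λ _ → 1)) (cong₂ _+_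
      (trans (∑-cong (allFin n) (λ i → ∑-cong (allFin n) (λ j → *-identityʳ (𝟙 (arc G i j))))) (sym (edgeCount≡∑ G)))
      (trans (∑-const (allFin n) 1) (trans (*-identityʳ _) (length-tabulate {n = n} (λ i → i)))))))

  -- A pendant edge is charged to its new end, and this end pays for no other edge; so `1 ≤ D` keeps
  -- the density bound.
  sparse : ∀ D → 1 ≤ D → (∀ X → edgesIn G X ≤ D * card G X) → ∀ X →
           (∑[ e ∈ allFin size ] 𝟙 (Incidence.within src tgt X e)) ≤ D * (∑[ v ∈ allFin (n + n) ] 𝟙 (X v))
  sparse D 1≤D h X = begin
    (∑[ e ∈ allFin size ] 𝟙 (X (src e) ∧ X (tgt e)))
      ≡⟨ trans (∑-lookup edges (λ e → 𝟙 (X (proj₁ e) ∧ X (proj₂ e)))) (∑-edges (λ e → 𝟙 (X (proj₁ e) ∧ X (proj₂ e)))) ⟩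
    edgesIn G (λ i → X (inl i)) + (∑[ i ∈ allFin n ] 𝟙 (X (inl i) ∧ X (inr i)))
      ≤⟨ +-mono-≤ (h (λ i → X (inl i))) (∑-mono (allFin n) (λ i → 𝟙-mono (∧-trueʳ (X (inl i))))) ⟩
    D * (∑[ i ∈ allFin n ] 𝟙 (X (inl i))) + (∑[ i ∈ allFin n ] 𝟙 (X (inr i)))
      ≤⟨ +-monoʳ-≤ (D * (∑[ i ∈ allFin n ] 𝟙 (X (inl i)))) (m≤n*m _ D ⦃ >-nonZero 1≤D ⦄) ⟩
    D * (∑[ i ∈ allFin n ] 𝟙 (X (inl i))) + D * (∑[ i ∈ allFin n ] 𝟙 (X (inr i)))
      ≡⟨ *-distribˡ-+ D (∑[ i ∈ allFin n ] 𝟙 (X (inl i))) _ ⟨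
    D * ((∑[ i ∈ allFin n ] 𝟙 (X (inl i))) + (∑[ i ∈ allFin n ] 𝟙 (X (inr i))))
      ≡⟨ cong (D *_) (∑-allFin-+ n n (λ v → 𝟙 (X v))) ⟨
    D * (∑[ v ∈ allFin (n + n) ] 𝟙 (X v)) ∎
    where open ≤-Reasoning

  Joined : Fin (n + n) → Fin (n + n) → Set
  Joined a b = Σ (Fin size) λ e → (src e ≡ a × tgt e ≡ b) ⊎ (src e ≡ b × tgt e ≡ a)

  private
    joined-∈ : ∀ {a b} → (a , b) ∈ edges → Joined a b
    joined-∈ {a} {b} p = index p , inj₁ (cong proj₁ (sym (lookup-index p)) , cong proj₂ (sym (lookup-index p)))

    flip : ∀ {a b} → Joined a b → Joined b a
    flip (e , inj₁ h) = e , inj₂ h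
    flip (e , inj₂ h) = e , inj₁ h

    joined-arc : ∀ u v → arc G u v ≡ true → Joined (inl u) (inl v)
    joined-arc u v h = joined-∈ (∈-++⁺ˡ (∈-concatMap (λ i → concatMap (arcs i) (allFin n)) (∈-allFin u)
        (∈-concatMap (arcs u) (∈-allFin v) (one (arc G u v) h))))
      where
      one : ∀ b → b ≡ true → (inl u , inl v) ∈ (if b then (inl u , inl v) ∷ [] else [])
      one true refl = here refl

  joined-pendant : ∀ v → Joined (inl v) (inr v)
  joined-pendant v = joined-∈ (∈-++⁺ʳ base (∈-map⁺ (λ i → inl i , inr i) (∈-allFin v)))

  joined-adj : ∀ u v → adj G u v ≡ true → Joined (inl u) (inl v)
  joined-adj u v h = go (<-cmp (toℕ u) (toℕ v))
    where
    go : Tri (toℕ u < toℕ v) (toℕ u ≡ toℕ v) (toℕ v < toℕ u) → Joined (inl u) (inl v)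
    go (tri< u<v _ _) = joined-arc u v (cong₂ _∧_ h (So⇒≡ (<⇒<ᵇ u<v)))
    go (tri> _ _ v<u) = flip (joined-arc v u (cong₂ _∧_ (trans (adj-sym G v u) h) (So⇒≡ (<⇒<ᵇ v<u))))
    go (tri≈ _ u≡v _) = true≢false (trans (sym h) (trans (cong (adj G u) (sym (toℕ-injective u≡v))) (irrefl G u)))

  inl≢inl : ∀ {u v} → u ≢ v → inl u ≢ inl v
  inl≢inl u≢v e = u≢v (↑ˡ-injective n _ _ e)

  inr≢inr : ∀ {u v} → u ≢ v → inr u ≢ inr v
  inr≢inr u≢v e = u≢v (↑ʳ-injective n _ _ e)

  inl≢inr : ∀ u v → inl u ≢ inr v
  inl≢inr u v e = <⇒≢ (<-≤-trans (toℕ<n u) (m≤m+n n (toℕ v))) (trans (sym (toℕ-↑ˡ u n)) (trans (cong toℕ e) (toℕ-↑ʳ n v)))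

  -- The premise is `distinct` for four vertex labels written out, so that it matches
  -- `generic-drawing` without the data of a placement.
  Generic : (M : ℕ) → (Fin (n + n) → Grid.P M) → Set
  Generic M f = ∀ g e →
    (not (src g == tgt g) ∧ not (src g == src e) ∧ not (src g == tgt e)) ∧
    (not (tgt g == src e) ∧ not (tgt g == tgt e)) ∧ not (src e == tgt e) ≡ true →
    Grid.κ M (f (src g)) (f (tgt g)) (f (src e)) (f (tgt e)) ≡ 0

-- Constants and existence of the drawing

cube : ℕ → ℕ
cube M = M * (M * M)

abstract
  -- A power of two above the product in `C₀≥`, so that it enters `exponent-bound` only through the
  -- exponent 80.
  C₀ : ℕ
  C₀ = 2 ^ 80

  C₀≡ : C₀ ≡ 2 ^ 80
  C₀≡ = refl

  -- `coef` comes from the placement, 1024 and the six factors 5 from the count of singular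
  -- matrices, 2 from adding at most `k` pendant edges, and 128 from comparing the logarithms of the
  -- grid side and of `n`.
  C₀≥ : coef 512 4096 * (1024 * (5 * 5 * (5 * 5 * (5 * 5))) * (2 * 128)) ≤ C₀
  C₀≥ = ≤ᵇ⇒≤ _ _ _

1≤C₀ : 1 ≤ C₀
1≤C₀ = subst (1 ≤_) (sym C₀≡) (m^n>0 2 80)

module FromGeneric {n : ℕ} (G : Graph n) (M : ℕ) (f : Fin (n + n) → Grid.P M) (disjoint : Pendants.Generic G M f) where

  open Pendants G
  private
    module Gr = Grid M

    differs : ∀ {a b : Fin (n + n)} → a ≢ b → not (a == b) ≡ true
    differs {a} {b} a≢b with a ≟ b
    ... | yes a≡b = ⊥-elim (a≢b a≡b)
    ... | no _ = refl

    all-true : ∀ {p q r s t u} → p ≡ true → q ≡ true → r ≡ true → s ≡ true → t ≡ true → u ≡ true → (p ∧ q ∧ r) ∧ (s ∧ t) ∧ u ≡ true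
    all-true refl refl refl refl refl refl = refl

    Far : Fin (n + n) → Fin (n + n) → Fin (n + n) → Fin (n + n) → Set
    Far a b c d = (a ≢ b × a ≢ c × a ≢ d) × (b ≢ c × b ≢ d) × c ≢ d

    directed : ∀ g e → Far (src g) (tgt g) (src e) (tgt e) → Gr.κ (f (src g)) (f (tgt g)) (f (src e)) (f (tgt e)) ≡ 0
    directed g e ((ab , ac , ad) , (bc , bd) , cd) =
      disjoint g e (all-true (differs ab) (differs ac) (differs ad) (differs bc) (differs bd) (differs cd))

    half-directed : ∀ g c d → Joined c d → Far (src g) (tgt g) c d → Gr.κ (f (src g)) (f (tgt g)) (f c) (f d) ≡ 0
    half-directed g c d (e , inj₁ (refl , refl)) far = directed g e far
    half-directed g c d (e , inj₂ (refl , refl)) ((ab , ac , ad) , (bc , bd) , cd) =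
      trans (Gr.κ-swap₃₄ (f (src g)) (f (tgt g)) (f c) (f d)) (directed g e ((ab , ad , ac) , (bd , bc) , λ e → cd (sym e)))

    generic : ∀ a b c d → Joined a b → Joined c d → Far a b c d → Gr.κ (f a) (f b) (f c) (f d) ≡ 0
    generic a b c d (g , inj₁ (refl , refl)) j far = half-directed g c d j far
    generic a b c d (g , inj₂ (refl , refl)) j ((ab , ac , ad) , (bc , bd) , cd) =
      trans (Gr.κ-swap₁₂ (f a) (f b) (f c) (f d)) (half-directed g c d j (((λ e → ab (sym e)) , bc , bd) , (ac , ad) , cd))

    pt pt′ : Fin n → Gr.P
    pt v = f (inl v)
    pt′ v = f (inr v)

    adj⇒≢ : ∀ {u v} → adj G u v ≡ true → u ≢ v
    adj⇒≢ {u} h refl = true≢false (trans (sym h) (irrefl G u))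

  grid-drawing : GridDrawing G M
  grid-drawing = Geometry.drawing G M pt pt′
    (λ u v w uv w≢u w≢v → Gr.κ≡0⇒ (pt u) (pt v) (pt w) (pt′ w) (generic (inl u) (inl v) (inl w) (inr w) (joined-adj u v uv) (joined-pendant w)
       ((inl≢inl (adj⇒≢ uv) , inl≢inl (λ e → w≢u (sym e)) , inl≢inr u w) , (inl≢inl (λ e → w≢v (sym e)) , inl≢inr v w) , inl≢inr w w)))
    (λ u v r s uv rs u≢r u≢s v≢r v≢s → Gr.κ≡0⇒ (pt u) (pt v) (pt r) (pt s) (generic (inl u) (inl v) (inl r) (inl s) (joined-adj u v uv) (joined-adj r s rs)
       ((inl≢inl (adj⇒≢ uv) , inl≢inl u≢r , inl≢inl u≢s) , (inl≢inl v≢r , inl≢inl v≢s) , inl≢inl (adj⇒≢ rs))))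
    (λ u v u≢v → Gr.κ≡0⇒ (pt u) (pt′ u) (pt v) (pt′ v) (generic (inl u) (inr u) (inl v) (inr v) (joined-pendant u) (joined-pendant v)
       ((inl≢inr u u , inl≢inl u≢v , inl≢inr u v) , ((λ e → inl≢inr v u (sym e)) , inr≢inr u≢v) , inl≢inr v v)))

module Existence {n : ℕ} (G : Graph n) (D : ℕ) (1≤D : 1 ≤ D) (sparseG : ∀ X → edgesIn G X ≤ D * card G X)
                 (k ρ t : ℕ) (edges≤ : edgeCount G + n ≤ 2 * k) (t≤ : 2 + t ≤ 128 * ρ)
                 (room : C₀ * (D * k * ρ) ≤ cube (2 ^ t))
                 (a b c p : ℕ) (a≥ : 4 * (64 * 2) ≤ a) (b≥ : 4 * (64 * 16) ≤ b) (c≥ : coef a b ≤ c) (p≥ : 1024 ≤ p)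
                 (C₀≥ : c * (p * (5 * 5 * (5 * 5 * (5 * 5))) * (2 * 128)) ≤ C₀) where

  private
    M L : ℕ
    M = 2 ^ t
    L = 2 + t

    1≤M : 1 ≤ M
    1≤M = m^n>0 2 t

    2M<2^L : 2 * M < 2 ^ L
    2M<2^L = *-monoʳ-< 2 (<-≤-trans (m<m+n M {M} 1≤M) (≤-reflexive (cong (M +_) (sym (+-identityʳ M)))))

    open Pendants G
    module Gr = Grid M
    open Singular M L 1≤M 2M<2^L

    G₀ : ℕ
    G₀ = L * (p * (Bd * (Bd * Bd)))

    singular≤G₀ : singular M ≤ G₀
    singular≤G₀ = ≤-trans singular≤ (*-monoʳ-≤ L (*-monoˡ-≤ (Bd * (Bd * Bd)) p≥))

    N>0 : 0 < length Gr.grid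
    N>0 = subst (0 <_) (sym Gr.length-grid) (*-mono-< 1≤M (*-mono-< 1≤M 1≤M))

    open Assembly Gr.grid Gr.κ Gr.κ-swap₁₂ Gr.κ-swap₂₃ Gr.κ-swap₃₄ G₀ (λ a → ≤-trans (Gr.κ-sum a) singular≤G₀) N>0
      (n + n) size src tgt D 1≤D (sparse D 1≤D sparseG) a b c a≥ b≥ c≥ using (generic-drawing)

    Bd≤ : Bd ≤ 5 * M * (5 * M)
    Bd≤ = *-mono-≤ w≤ w≤
      where
      lemma : ∀ m → m + 2 * m + 2 * m ≡ 5 * m
      lemma = solve-∀
      w≤ : Box.w M + 2 * M ≤ 5 * M
      w≤ = ≤-trans (+-monoˡ-≤ (2 * M) (+-monoˡ-≤ (2 * M) 1≤M)) (≤-reflexive (lemma M))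

    -- `G₀` is of order `L` times `N` squared and `G₁` is `N` times that, so three factors `N`
    -- cancel against `N⁴` and the hypothesis `room` remains.
    volume-room : ∀ N c p f q r → N ≡ cube M → c * (p * (f * f * (f * f * (f * f))) * (q * r)) ≤ C₀ → size ≤ q * k → L ≤ r * ρ → Bd ≤ f * M * (f * M) →
                  c * (D * (size * (N * (L * (p * (Bd * (Bd * Bd))))))) ≤ N * (N * (N * N))
    volume-room N c p f q r refl C₀≥ m≤ L≤ Bd≤ = begin
      c * (D * (size * (N * (L * (p * (Bd * (Bd * Bd)))))))
        ≤⟨ *-monoʳ-≤ c (*-monoʳ-≤ D (*-mono-≤ m≤ (*-monoʳ-≤ N (*-mono-≤ L≤ (*-monoʳ-≤ p (*-mono-≤ Bd≤ (*-mono-≤ Bd≤ Bd≤))))))) ⟩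
      c * (D * (q * k * (N * (r * ρ * (p * (f * M * (f * M) * (f * M * (f * M) * (f * M * (f * M)))))))))
        ≡⟨ lemma c D q k N r ρ p f M ⟩
      c * (p * (f * f * (f * f * (f * f))) * (q * r)) * (D * k * ρ) * (N * (M * (M * M) * (M * (M * M))))
        ≤⟨ *-monoˡ-≤ (N * (N * N)) (≤-trans (*-monoˡ-≤ (D * k * ρ) C₀≥) room) ⟩
      N * (N * (N * N)) ∎
      where
      open ≤-Reasoning
      lemma : ∀ c D q k N r ρ p f M →
        c * (D * (q * k * (N * (r * ρ * (p * (f * M * (f * M) * (f * M * (f * M) * (f * M * (f * M))))))))) ≡
        c * (p * (f * f * (f * f * (f * f))) * (q * r)) * (D * k * ρ) * (N * (M * (M * M) * (M * (M * M))))
      lemma = solve-∀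

  grid-drawing : GridDrawing G M
  grid-drawing = from (generic-drawing (volume-room (length Gr.grid) c p 5 2 128 Gr.length-grid C₀≥
               (≤-trans (≤-reflexive size≡) edges≤) t≤ Bd≤))
    where
    from : Σ (Fin (n + n) → Gr.P) (Generic M) → GridDrawing G M
    from (f , disjoint) = FromGeneric.grid-drawing G M f disjoint

-- Choice of the grid size

⌊log₂⌋-upper : ∀ n → n < 2 ^ suc ⌊log₂ n ⌋
⌊log₂⌋-upper n = ≰⇒> λ le → <-irrefl refl (≤-trans (≤-reflexive (sym (⌊log₂[2^n]⌋≡n (suc ⌊log₂ n ⌋)))) (⌊log₂⌋-mono-≤ le))

n≤2^n : ∀ n → n ≤ 2 ^ n
n≤2^n zero    = z≤n
n≤2^n (suc n) = +-mono-≤ (m^n>0 2 n) (≤-trans (n≤2^n n) (≤-reflexive (sym (+-identityʳ (2 ^ n)))))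

⌊log₂⌋≤ : ∀ n → ⌊log₂ n ⌋ ≤ n
⌊log₂⌋≤ n = ≤-trans (⌊log₂⌋-mono-≤ (n≤2^n n)) (≤-reflexive (⌊log₂[2^n]⌋≡n n))

-- The exponent `Y` is certainly large enough; descending from it loses at most the ratio 8 between
-- consecutive cubes.
cube-root : ∀ Y → 1 ≤ Y → Σ ℕ λ t → (Y ≤ cube (2 ^ t)) × (cube (2 ^ t) ≤ 8 * Y)
cube-root Y 1≤Y = go Y (≤-trans (n≤2^n Y) (m≤m*n (2 ^ Y) (2 ^ Y * 2 ^ Y) ⦃ >-nonZero (*-mono-< (m^n>0 2 Y) (m^n>0 2 Y)) ⦄))
  where
  lemma : ∀ m → 2 * m * (2 * m * (2 * m)) ≡ 8 * (m * (m * m))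
  lemma = solve-∀
  go : ∀ t → Y ≤ cube (2 ^ t) → Σ ℕ λ t → (Y ≤ cube (2 ^ t)) × (cube (2 ^ t) ≤ 8 * Y)
  go zero    h = 0 , h , ≤-trans 1≤Y (m≤n*m Y 8)
  go (suc t) h with Y ≤? cube (2 ^ t)
  ... | yes h′ = go t h′
  ... | no  h′ = suc t , h , ≤-trans (≤-reflexive (lemma (2 ^ t))) (*-monoʳ-≤ 8 (<⇒≤ (≰⇒> h′)))

2^-cancel-≤ : ∀ {a b} → 2 ^ a ≤ 2 ^ b → a ≤ b
2^-cancel-≤ {a} {b} h = ≮⇒≥ λ b<a → <⇒≱ (^-monoʳ-< 2 (s≤s (s≤s z≤n)) b<a) h

cube-2^ : ∀ t → cube (2 ^ t) ≡ 2 ^ (t + (t + t))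
cube-2^ t = sym (trans (^-distribˡ-+-* 2 t (t + t)) (cong (2 ^ t *_) (^-distribˡ-+-* 2 t t)))

edgeCount≤ : ∀ {n} (G : Graph n) → edgeCount G ≤ n * n
edgeCount≤ {n} G = ≤-trans (≤-reflexive (edgeCount≡∑ G)) (≤-trans (∑-bound (allFin n) n (λ i →
    ≤-trans (∑-bound (allFin n) 1 (λ j → 𝟙≤1 (arc G i j))) (≤-reflexive (trans (*-identityʳ _) len))))
  (≤-reflexive (cong (_* n) len)))
  where
  len : length (allFin n) ≡ n
  len = length-tabulate {n = n} (λ i → i)

-- `D`, `k` and the logarithm together contribute at most the fourth power of `n`, and `n` is below
-- `2 ^ s`; the tripled exponent on the left is weakened to `t`.
exponent-bound : ∀ t D k n c e → c ≡ 2 ^ e → D ≤ n → k ≤ n * n → cube (2 ^ t) ≤ 8 * (c * (D * k * ⌊log₂ n ⌋)) →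
                 t ≤ 3 + (e + 4 * suc ⌊log₂ n ⌋)
exponent-bound t D k n c e c≡ D≤n k≤ h = ≤-trans (m≤m+n t (t + t)) (2^-cancel-≤ (begin
    2 ^ (t + (t + t))                               ≡⟨ cube-2^ t ⟨
    cube (2 ^ t)                                    ≤⟨ h ⟩
    8 * (c * (D * k * ⌊log₂ n ⌋))                   ≤⟨ *-monoʳ-≤ 8 (*-mono-≤ (≤-reflexive c≡) (*-mono-≤ (*-mono-≤ (≤-trans D≤n n≤)
                                                         (≤-trans k≤ (*-mono-≤ n≤ n≤))) (≤-trans (⌊log₂⌋≤ n) n≤))) ⟩
    8 * (2 ^ e * (2 ^ s * (2 ^ s * 2 ^ s) * 2 ^ s)) ≡⟨ cong (λ z → 8 * (2 ^ e * z)) (trans (regroup (2 ^ s)) (sym (power 3))) ⟩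
    8 * (2 ^ e * 2 ^ (4 * s))                       ≡⟨ cong (8 *_) (^-distribˡ-+-* 2 e (4 * s)) ⟨
    8 * 2 ^ (e + 4 * s)                             ≡⟨ ^-distribˡ-+-* 2 3 (e + 4 * s) ⟨
    2 ^ (3 + (e + 4 * s))                           ∎))
  where
  open ≤-Reasoning
  s : ℕ
  s = suc ⌊log₂ n ⌋
  n≤ : n ≤ 2 ^ s
  n≤ = <⇒≤ (⌊log₂⌋-upper n)
  regroup : ∀ a → a * (a * a) * a ≡ a * (a * (a * (a * 1)))
  regroup = solve-∀
  powers : ℕ → ℕ
  powers zero    = 1
  powers (suc i) = 2 ^ s * powers i
  power : ∀ i → 2 ^ (suc i * s) ≡ powers (suc i)
  power zero    = trans (cong (2 ^_) (+-identityʳ s)) (sym (*-identityʳ (2 ^ s)))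
  power (suc i) = trans (^-distribˡ-+-* 2 s (suc i * s)) (cong (2 ^ s *_) (power i))

log-bound : ∀ t ρ → 1 ≤ ρ → t ≤ 3 + (80 + 4 * suc ρ) → 2 + t ≤ 128 * ρ
log-bound t ρ 1≤ρ h = begin
  2 + t                       ≤⟨ +-monoʳ-≤ 2 h ⟩
  2 + (3 + (80 + 4 * suc ρ))  ≡⟨ lemma ρ ⟩
  89 * 1 + 4 * ρ              ≤⟨ +-monoˡ-≤ (4 * ρ) (*-monoʳ-≤ 89 1≤ρ) ⟩
  89 * ρ + 4 * ρ              ≡⟨ *-distribʳ-+ ρ 89 4 ⟨
  93 * ρ                      ≤⟨ *-monoˡ-≤ ρ (m≤m+n 93 35) ⟩
  128 * ρ                     ∎
  where
  open ≤-Reasoning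
  lemma : ∀ ρ → 2 + (3 + (80 + 4 * suc ρ)) ≡ 89 * 1 + 4 * ρ
  lemma = solve-∀

theorem1p1 : ∃[ C ] (0 < C × ((D n k : ℕ) (G : Graph n) → 1 ≤ D → 2 ≤ n →
    edgeCount G ≡ k → n ≤ k → Degenerate D G →
    ∃[ m ] (0 < m × m ^ 3 ≤ C * D * k * ⌊log₂ n ⌋ × GridDrawing G m)))
theorem1p1 = 8 * C₀ , ≤-trans 1≤C₀ (m≤n*m C₀ 8) , draw
  where
  draw : (D n k : ℕ) (G : Graph n) → 1 ≤ D → 2 ≤ n → edgeCount G ≡ k → n ≤ k → Degenerate D G →
         ∃[ m ] (0 < m × m ^ 3 ≤ 8 * C₀ * D * k * ⌊log₂ n ⌋ × GridDrawing G m)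
  draw D n k G 1≤D 2≤n refl n≤k degenerate = build (cube-root Y 1≤Y)
    where
    open ≤-Reasoning
    -- The degeneracy is below n, and replacing D by D ⊓ n keeps log m of order log n.
    D′ ρ Y : ℕ
    D′ = D ⊓ n
    ρ = ⌊log₂ n ⌋
    Y = C₀ * (D′ * k * ρ)

    1≤D′ : 1 ≤ D′
    1≤D′ = ⊓-glb 1≤D (≤-trans (s≤s z≤n) 2≤n)

    1≤ρ : 1 ≤ ρ
    1≤ρ = ⌊log₂⌋-mono-≤ 2≤n

    1≤Y : 1 ≤ Y
    1≤Y = *-mono-≤ 1≤C₀ (*-mono-≤ (*-mono-≤ 1≤D′ (≤-trans (≤-trans (s≤s z≤n) 2≤n) n≤k)) 1≤ρ)

    sparse : ∀ X → edgesIn G X ≤ D′ * card G X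
    sparse X = pick (⊓-sel D n)
      where
      pick : D′ ≡ D ⊎ D′ ≡ n → edgesIn G X ≤ D′ * card G X
      pick (inj₁ e) = ≤-trans (degenerate⇒sparse G D degenerate X) (≤-reflexive (cong (_* card G X) (sym e)))
      pick (inj₂ e) = ≤-trans (edgesIn≤n G X) (≤-reflexive (cong (_* card G X) (sym e)))

    build : (Σ ℕ λ t → (Y ≤ cube (2 ^ t)) × (cube (2 ^ t) ≤ 8 * Y)) →
            ∃[ m ] (0 < m × m ^ 3 ≤ 8 * C₀ * D * k * ρ × GridDrawing G m)
    build (t , lower , upper) = 2 ^ t , m^n>0 2 t , volume ,
      Existence.grid-drawing G D′ 1≤D′ sparse k ρ t (≤-trans (+-monoʳ-≤ k n≤k) (≤-reflexive (cong (k +_) (sym (+-identityʳ k)))))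
        (log-bound t ρ 1≤ρ (exponent-bound t D′ k n C₀ 80 C₀≡ (m⊓n≤n D n) (edgeCount≤ G) upper)) lower
        512 4096 (coef 512 4096) 1024 ≤-refl ≤-refl ≤-refl ≤-refl C₀≥
      where
      regroup : ∀ c d k r → 8 * (c * (d * k * r)) ≡ 8 * c * d * k * r
      regroup = solve-∀
      volume : (2 ^ t) ^ 3 ≤ 8 * C₀ * D * k * ρ
      volume = begin
        (2 ^ t) ^ 3                  ≡⟨ cong (λ z → 2 ^ t * (2 ^ t * z)) (*-identityʳ (2 ^ t)) ⟩
        cube (2 ^ t)                 ≤⟨ upper ⟩
        8 * (C₀ * (D′ * k * ρ))      ≤⟨ *-monoʳ-≤ 8 (*-monoʳ-≤ C₀ (*-monoˡ-≤ ρ (*-monoˡ-≤ k (m⊓n≤m D n)))) ⟩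
        8 * (C₀ * (D * k * ρ))       ≡⟨ regroup C₀ D k ρ ⟩
        8 * C₀ * D * k * ρ           ∎
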